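{- There is a function $\eta(n)\to 0$ (as $n\to\infty$) such that every Steiner triple system $S$ of order $n$ has at most \[ \left((1+\eta(n))\frac{n}{2e^{2}}\right)^{n/3} \] perfect matchings.
   Context: A Steiner triple system of order $n$ is a 3-uniform hypergraph on the vertex set $[n]$ such that every pair of vertices is contained in exactly one hyperedge. A perfect matching is a set of pairwise disjoint hyperedges covering all vertices. -}

module Defs where

open import Data.Nat as ℕ using (ℕ; zero; suc; _!)
import Data.Nat.Properties as ℕ
open import Data.Integer as ℤ using (+_)
import Data.Integer.Properties as ℤ
open import Data.Rational as ℚ using (ℚ; 0ℚ; 1ℚ; ½; ↥_)
import Data.Rational.Properties as ℚ
import Data.Rational.Unnormalised as ℚᵘ
import Data.Rational.Unnormalised.Properties as ℚᵘ
open import Data.Rational.Solver using (module +-*-Solver)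
open import Algebra.Definitions.RawSemiring ℚ.+-*-rawSemiring
  using () renaming (_^_ to _^ℚ_)
open import Data.Bool using (if_then_else_)
open import Data.Fin using (Fin; _≟_)
open import Data.Fin.Properties using (all?; any?)
open import Data.Fin.Subset as Subset using (Subset; inside; outside; _∈_; _∩_; Empty)
open import Data.Fin.Subset.Properties using (_∈?_; nonempty?)
open import Data.Vec using ([]; _∷_)
open import Data.List as List using (List; _++_; length; filter)
open import Data.Product using (∃; ∃!; _×_; _,_; proj₁; proj₂)
open import Data.Sum using (inj₁; inj₂)
open import Relation.Nullary using (Dec; yes; no; does; ¬_; contradiction)
open import Relation.Nullary.Decidable using (¬?; _×-dec_; _→-dec_)
open import Relation.Binary.PropositionalEquality
open import Function.Definitions using (Injective)

------------------------------------------------------------------------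
-- Auxiliary facts about ℚ

module RationalLemmas where
  open import Data.Rational hiding (_≟_)
  open ℚ.≤-Reasoning
  open +-*-Solver using (solve; _:=_; _:+_; _:*_; :-_; con)

  half-pos : ∀ {ε} → 0ℚ < ε → 0ℚ < ε * ½
  half-pos {ε} 0<ε = subst (_< ε * ½) (ℚ.*-zeroˡ ½) (ℚ.*-monoˡ-<-pos ½ 0<ε)

  half+half : ∀ ε → ε * ½ + ε * ½ ≡ ε
  half+half ε = trans (sym (ℚ.*-distribˡ-+ ε ½ ½)) (ℚ.*-identityʳ ε)

  *-pos : ∀ {a b} → 0ℚ < a → 0ℚ < b → 0ℚ < a * b
  *-pos {a} {b} 0<a 0<b =
    ℚ.positive⁻¹ (a * b) {{ℚ.pos*pos⇒pos a {{positive 0<a}} b {{positive 0<b}}}}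

  *-nonneg : ∀ {a b} → 0ℚ ≤ a → 0ℚ ≤ b → 0ℚ ≤ a * b
  *-nonneg {a} {b} 0≤a 0≤b =
    ℚ.nonNegative⁻¹ (a * b)
      {{ℚ.nonNeg*nonNeg⇒nonNeg a {{nonNegative 0≤a}} b {{nonNegative 0≤b}}}}

  1/-pos : ∀ p .{{_ : NonZero p}} → 0ℚ < p → 0ℚ < 1/ p
  1/-pos p@(mkℚ (+ suc _) _ _)  _ = ℚ.positive⁻¹ (1/ p)
  1/-pos (mkℚ (+ zero) _ _)     (*<* (ℤ.+<+ ()))
  1/-pos (mkℚ ℤ.-[1+ _ ] _ _)   (*<* ())

  +-nonneg : ∀ {a b} → 0ℚ ≤ a → 0ℚ ≤ b → 0ℚ ≤ a + b
  +-nonneg {a} {b} 0≤a 0≤b =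
    ℚ.nonNegative⁻¹ (a + b)
      {{ℚ.nonNeg+nonNeg⇒nonNeg a {{nonNegative 0≤a}} b {{nonNegative 0≤b}}}}

  +-pos : ∀ {a b} → 0ℚ ≤ a → 0ℚ < b → 0ℚ < a + b
  +-pos {a} {b} 0≤a 0<b =
    ℚ.positive⁻¹ (a + b) {{ℚ.nonNeg+pos⇒pos a {{nonNegative 0≤a}} b {{positive 0<b}}}}

  *-mono : ∀ {a b c d} → 0ℚ ≤ a → 0ℚ ≤ d → a ≤ b → c ≤ d → a * c ≤ b * d
  *-mono {a} {b} {c} {d} 0≤a 0≤d a≤b c≤d = ℚ.≤-trans
    (ℚ.*-monoˡ-≤-nonNeg a {{nonNegative 0≤a}} c≤d)
    (ℚ.*-monoʳ-≤-nonNeg d {{nonNegative 0≤d}} a≤b)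

  p≤∣p∣ : ∀ p → p ≤ ∣ p ∣
  p≤∣p∣ p with ℚ.≤-total 0ℚ p
  ... | inj₁ 0≤p = ℚ.≤-reflexive (sym (ℚ.0≤p⇒∣p∣≡p 0≤p))
  ... | inj₂ p≤0 = ℚ.≤-trans p≤0 (ℚ.0≤∣p∣ p)

  ≤+⇒-≤ : ∀ {a b ε} → a ≤ b + ε → a - b ≤ ε
  ≤+⇒-≤ {a} {b} {ε} a≤b+ε = begin
    a - b        ≤⟨ ℚ.+-monoˡ-≤ (- b) a≤b+ε ⟩
    b + ε - b    ≡⟨ solve 2 (λ x y → x :+ y :+ (:- x) := y) refl b ε ⟩
    ε            ∎

  ∣-∣≤ : ∀ {a b ε} → a ≤ b + ε → b ≤ a + ε → ∣ a - b ∣ ≤ ε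
  ∣-∣≤ {a} {b} {ε} a≤ b≤ with ℚ.∣p∣≡p∨∣p∣≡-p (a - b)
  ... | inj₁ eq = subst (_≤ ε) (sym eq) (≤+⇒-≤ a≤)
  ... | inj₂ eq = subst (_≤ ε)
    (trans (solve 2 (λ x y → y :+ (:- x) := :- (x :+ (:- y))) refl a b) (sym eq))
    (≤+⇒-≤ b≤)

  ∣-∣≤⇒≤+ : ∀ {a b ε} → ∣ a - b ∣ ≤ ε → a ≤ b + ε
  ∣-∣≤⇒≤+ {a} {b} {ε} d≤ε = begin
    a            ≡⟨ solve 2 (λ x y → x := y :+ (x :+ (:- y))) refl a b ⟩
    b + (a - b)  ≤⟨ ℚ.+-monoʳ-≤ b (ℚ.≤-trans (p≤∣p∣ (a - b)) d≤ε) ⟩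
    b + ε        ∎

  ^-nonneg : ∀ q {a} → 0ℚ ≤ a → 0ℚ ≤ a ^ℚ q
  ^-nonneg zero    0≤a = ℚ.nonNegative⁻¹ 1ℚ
  ^-nonneg (suc q) 0≤a = *-nonneg 0≤a (^-nonneg q 0≤a)

  ^-pos : ∀ q {a} → 0ℚ < a → 0ℚ < a ^ℚ q
  ^-pos zero    0<a = ℚ.positive⁻¹ 1ℚ
  ^-pos (suc q) 0<a = *-pos 0<a (^-pos q 0<a)

  ^-mono : ∀ q {a b} → 0ℚ ≤ a → a ≤ b → a ^ℚ q ≤ b ^ℚ q
  ^-mono zero    0≤a a≤b = ℚ.≤-refl
  ^-mono (suc q) 0≤a a≤b =
    *-mono 0≤a (^-nonneg q (ℚ.≤-trans 0≤a a≤b)) a≤b (^-mono q 0≤a a≤b)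

  ^-cancel-< : ∀ q {a b} → 0ℚ ≤ b → a ^ℚ q < b ^ℚ q → a < b
  ^-cancel-< q {a} {b} 0≤b a^q<b^q with a <? b
  ... | yes a<b = a<b
  ... | no  a≮b = contradiction
    (ℚ.<-≤-trans a^q<b^q (^-mono q 0≤b (ℚ.≮⇒≥ a≮b))) (ℚ.<-irrefl refl)

  ^-superadditive : ∀ q {a b} → 0ℚ ≤ a → 0ℚ ≤ b →
                    a ^ℚ suc q + b ^ℚ suc q ≤ (a + b) ^ℚ suc q
  ^-superadditive q {a} {b} 0≤a 0≤b = begin
    a * a ^ℚ q + b * b ^ℚ q              ≤⟨ ℚ.+-mono-≤ (*-mono 0≤a 0≤[a+b]^q ℚ.≤-refl (^-mono q 0≤a a≤a+b))
                                                       (*-mono 0≤b 0≤[a+b]^q ℚ.≤-refl (^-mono q 0≤b b≤a+b)) ⟩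
    a * (a + b) ^ℚ q + b * (a + b) ^ℚ q  ≡⟨ ℚ.*-distribʳ-+ ((a + b) ^ℚ q) a b ⟨
    (a + b) * (a + b) ^ℚ q               ∎
    where
    a≤a+b : a ≤ a + b
    a≤a+b = subst (_≤ a + b) (ℚ.+-identityʳ a) (ℚ.+-monoʳ-≤ a 0≤b)
    b≤a+b : b ≤ a + b
    b≤a+b = subst (_≤ a + b) (ℚ.+-identityˡ b) (ℚ.+-monoˡ-≤ b 0≤a)
    0≤[a+b]^q : 0ℚ ≤ (a + b) ^ℚ q
    0≤[a+b]^q = ^-nonneg q (ℚ.≤-trans 0≤a a≤a+b)

  1≤^ : ∀ q {a} → 1ℚ ≤ a → 1ℚ ≤ a ^ℚ q
  1≤^ zero    1≤a = ℚ.≤-refl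
  1≤^ (suc q) 1≤a = *-mono (ℚ.nonNegative⁻¹ 1ℚ)
    (^-nonneg q (ℚ.≤-trans (ℚ.nonNegative⁻¹ 1ℚ) 1≤a)) 1≤a (1≤^ q 1≤a)

  a≤a^ : ∀ q {a} → 1ℚ ≤ a → a ≤ a ^ℚ suc q
  a≤a^ q {a} 1≤a = begin
    a           ≡⟨ ℚ.*-identityʳ a ⟨
    a * 1ℚ      ≤⟨ ℚ.*-monoˡ-≤-nonNeg a {{nonNegative 0≤a}} (1≤^ q 1≤a) ⟩
    a * a ^ℚ q  ∎
    where
    0≤a : 0ℚ ≤ a
    0≤a = ℚ.≤-trans (ℚ.nonNegative⁻¹ 1ℚ) 1≤a

  /-≤ : ∀ a b c d → a ℤ.* + suc d ℤ.≤ b ℤ.* + suc c → a / suc c ≤ b / suc d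
  /-≤ a b c d h = ℚ.toℚᵘ-cancel-≤ (ℚᵘ.≤-trans
    (ℚᵘ.≤-reflexive (ℚ.toℚᵘ-fromℚᵘ (ℚᵘ.mkℚᵘ a c)))
    (ℚᵘ.≤-trans (ℚᵘ.*≤* h)
      (ℚᵘ.≤-reflexive (ℚᵘ.≃-sym (ℚ.toℚᵘ-fromℚᵘ (ℚᵘ.mkℚᵘ b d))))))

  0≤+/ : ∀ j k → 0ℚ ≤ + j / suc k
  0≤+/ j k = ℚ.nonNegative⁻¹ (+ j / suc k) {{ℚ.normalize-nonNeg j (suc k)}}

  suc-/ : ∀ j k → + suc j / suc k ≡ + j / suc k + + 1 / suc k
  suc-/ j k = ℚ.toℚᵘ-injective unnormalised
    where
    u v : ℚᵘ.ℚᵘ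
    u = ℚᵘ.mkℚᵘ (+ j) k
    v = ℚᵘ.mkℚᵘ (+ 1) k
    K = + suc k
    eq : + suc j ℤ.* (K ℤ.* K) ≡ (+ j ℤ.* K ℤ.+ + 1 ℤ.* K) ℤ.* K
    eq = trans (sym (ℤ.*-assoc (+ suc j) K K)) (cong (ℤ._* K)
           (trans (cong (ℤ._* K) (cong +_ (ℕ.+-comm 1 j))) (ℤ.*-distribʳ-+ K (+ j) (+ 1))))
    unnormalised : toℚᵘ (+ suc j / suc k) ℚᵘ.≃ toℚᵘ (+ j / suc k + + 1 / suc k)
    unnormalised =
      ℚᵘ.≃-trans (ℚ.toℚᵘ-fromℚᵘ (ℚᵘ.mkℚᵘ (+ suc j) k))
      (ℚᵘ.≃-trans (ℚᵘ.*≡* eq)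
      (ℚᵘ.≃-trans (ℚᵘ.+-cong (ℚᵘ.≃-sym (ℚ.toℚᵘ-fromℚᵘ u)) (ℚᵘ.≃-sym (ℚ.toℚᵘ-fromℚᵘ v)))
        (ℚᵘ.≃-sym (ℚ.toℚᵘ-homo-+ (+ j / suc k) (+ 1 / suc k)))))

  archimedean : ∀ ε → 0ℚ < ε → ∃ λ N → ∀ n → N ℕ.≤ n → + 1 / suc n ≤ ε
  archimedean ε@(mkℚ (+ suc a) d c) 0<ε = d , λ n d≤n → subst (+ 1 / suc n ≤_)
    (ℚ.fromℚᵘ-toℚᵘ ε)
    (/-≤ (+ 1) (+ suc a) n d (subst₂ ℤ._≤_ refl (ℤ.pos-* (suc a) (suc n))
      (ℤ.+≤+ (ℕ.*-mono-≤ {1} {suc a} (ℕ.s≤s ℕ.z≤n) (ℕ.s≤s d≤n)))))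
  archimedean (mkℚ (+ zero) d c) (*<* (ℤ.+<+ ()))
  archimedean (mkℚ (ℤ.-[1+ a ]) d c) (*<* ())

open RationalLemmas

------------------------------------------------------------------------
-- Cauchy sequences of rationals

-- Since m and n may be exchanged, this says |s m - s n| ≤ ε.
IsCauchy : (ℕ → ℚ) → Set
IsCauchy s = ∀ ε → 0ℚ ℚ.< ε →
             ∃ λ N → ∀ m n → N ℕ.≤ m → N ℕ.≤ n → s m ℚ.≤ s n ℚ.+ ε

module CauchyLemmas where
  open import Data.Rational hiding (_≟_)
  open ℚ.≤-Reasoning
  open +-*-Solver using (solve; _:=_; _:+_; _:*_; :-_)

  +-cauchy : ∀ {s t} → IsCauchy s → IsCauchy t → IsCauchy (λ n → s n + t n)
  +-cauchy {s} {t} cs ct ε 0<ε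
    with N , hs ← cs (ε * ½) (half-pos 0<ε) | M , ht ← ct (ε * ½) (half-pos 0<ε)
    = N ℕ.⊔ M , λ m n ≤m ≤n → begin
      s m + t m                      ≤⟨ ℚ.+-mono-≤
        (hs m n (ℕ.m⊔n≤o⇒m≤o N M ≤m) (ℕ.m⊔n≤o⇒m≤o N M ≤n))
        (ht m n (ℕ.m⊔n≤o⇒n≤o N M ≤m) (ℕ.m⊔n≤o⇒n≤o N M ≤n)) ⟩
      s n + ε * ½ + (t n + ε * ½)    ≡⟨ solve 3 (λ a b h → a :+ h :+ (b :+ h) := a :+ b :+ (h :+ h)) refl (s n) (t n) (ε * ½) ⟩
      s n + t n + (ε * ½ + ε * ½)    ≡⟨ cong (λ h → s n + t n + h) (half+half ε) ⟩
      s n + t n + ε                  ∎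

  neg-cauchy : ∀ {s} → IsCauchy s → IsCauchy (λ n → - s n)
  neg-cauchy {s} cs ε 0<ε with N , hs ← cs ε 0<ε = N , λ m n ≤m ≤n → begin
    - s m                     ≡⟨ solve 2 (λ a b → :- a := :- b :+ (b :+ :- a)) refl (s m) (s n) ⟩
    - s n + (s n - s m)       ≤⟨ ℚ.+-monoʳ-≤ (- s n) (≤+⇒-≤ (hs n m ≤n ≤m)) ⟩
    - s n + ε                 ∎

  abs-cauchy : ∀ {s} → IsCauchy s → IsCauchy (λ n → ∣ s n ∣)
  abs-cauchy {s} cs ε 0<ε with N , hs ← cs ε 0<ε = N , λ m n ≤m ≤n → begin
    ∣ s m ∣                   ≡⟨ cong ∣_∣ (solve 2 (λ a b → a := b :+ (a :+ :- b)) refl (s m) (s n)) ⟩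
    ∣ s n + (s m - s n) ∣     ≤⟨ ℚ.∣p+q∣≤∣p∣+∣q∣ (s n) (s m - s n) ⟩
    ∣ s n ∣ + ∣ s m - s n ∣   ≤⟨ ℚ.+-monoʳ-≤ ∣ s n ∣ (∣-∣≤ (hs m n ≤m ≤n) (hs n m ≤n ≤m)) ⟩
    ∣ s n ∣ + ε               ∎

  cauchy-bounded : ∀ {s} → IsCauchy s →
                   ∃ λ B → ∃ λ N → 0ℚ < B × (∀ n → N ℕ.≤ n → ∣ s n ∣ ≤ B)
  cauchy-bounded {s} cs = let N , hs = abs-cauchy cs 1ℚ (ℚ.positive⁻¹ 1ℚ) in
    ∣ s N ∣ + 1ℚ , N , +-pos (ℚ.0≤∣p∣ (s N)) (ℚ.positive⁻¹ 1ℚ) ,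
    λ n N≤n → hs n N N≤n ℕ.≤-refl

  *-cauchy-bounded : ∀ {s t B C} K L → 0ℚ < B → 0ℚ < C →
                     (∀ n → K ℕ.≤ n → ∣ s n ∣ ≤ B) → (∀ n → L ℕ.≤ n → ∣ t n ∣ ≤ C) →
                     IsCauchy s → IsCauchy t → IsCauchy (λ n → s n * t n)
  *-cauchy-bounded {s} {t} {B} {C} K L 0<B 0<C s≤B t≤C cs ct ε 0<ε = result
    where
    0<C+B : 0ℚ < C + B
    0<C+B = +-pos (ℚ.<⇒≤ 0<C) 0<B
    instance
      C+B≢0 : NonZero (C + B)
      C+B≢0 = >-nonZero 0<C+B
    δ : ℚ
    δ = ε * 1/ (C + B)
    0<δ : 0ℚ < δ
    0<δ = *-pos 0<ε (1/-pos (C + B) 0<C+B)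
    δ[C+B]≡ε : δ * C + B * δ ≡ ε
    δ[C+B]≡ε = trans (solve 4 (λ e r c b → e :* r :* c :+ b :* (e :* r) := e :* (r :* (c :+ b))) refl ε (1/ (C + B)) C B)
      (trans (cong (ε *_) (ℚ.*-inverseˡ (C + B))) (ℚ.*-identityʳ ε))
    result : ∃ λ N → ∀ m n → N ℕ.≤ m → N ℕ.≤ n → s m * t m ≤ s n * t n + ε
    result with N , hs ← cs δ 0<δ | M , ht ← ct δ 0<δ =
      (N ℕ.⊔ M) ℕ.⊔ (K ℕ.⊔ L) , λ m n ≤m ≤n →
      let N⊔M≤m = ℕ.m⊔n≤o⇒m≤o (N ℕ.⊔ M) (K ℕ.⊔ L) ≤m
          N⊔M≤n = ℕ.m⊔n≤o⇒m≤o (N ℕ.⊔ M) (K ℕ.⊔ L) ≤n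
          K⊔L≤m = ℕ.m⊔n≤o⇒n≤o (N ℕ.⊔ M) (K ℕ.⊔ L) ≤m
          K⊔L≤n = ℕ.m⊔n≤o⇒n≤o (N ℕ.⊔ M) (K ℕ.⊔ L) ≤n
          N≤m = ℕ.m⊔n≤o⇒m≤o N M N⊔M≤m
          N≤n = ℕ.m⊔n≤o⇒m≤o N M N⊔M≤n
          M≤m = ℕ.m⊔n≤o⇒n≤o N M N⊔M≤m
          M≤n = ℕ.m⊔n≤o⇒n≤o N M N⊔M≤n
          ds = ∣-∣≤ (hs m n N≤m N≤n) (hs n m N≤n N≤m)
          dt = ∣-∣≤ (ht m n M≤m M≤n) (ht n m M≤n M≤m)
      in ∣-∣≤⇒≤+ (begin
        ∣ s m * t m - s n * t n ∣
          ≡⟨ cong ∣_∣ (solve 4 (λ a b c d → a :* b :+ :- (c :* d) := (a :+ :- c) :* b :+ c :* (b :+ :- d))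
               refl (s m) (t m) (s n) (t n)) ⟩
        ∣ (s m - s n) * t m + s n * (t m - t n) ∣
          ≤⟨ ℚ.∣p+q∣≤∣p∣+∣q∣ ((s m - s n) * t m) (s n * (t m - t n)) ⟩
        ∣ (s m - s n) * t m ∣ + ∣ s n * (t m - t n) ∣
          ≡⟨ cong₂ _+_ (ℚ.∣p*q∣≡∣p∣*∣q∣ (s m - s n) (t m)) (ℚ.∣p*q∣≡∣p∣*∣q∣ (s n) (t m - t n)) ⟩
        ∣ s m - s n ∣ * ∣ t m ∣ + ∣ s n ∣ * ∣ t m - t n ∣
          ≤⟨ ℚ.+-mono-≤
               (*-mono (ℚ.0≤∣p∣ (s m - s n)) (ℚ.<⇒≤ 0<C) ds (t≤C m (ℕ.m⊔n≤o⇒n≤o K L K⊔L≤m)))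
               (*-mono (ℚ.0≤∣p∣ (s n)) (ℚ.<⇒≤ 0<δ) (s≤B n (ℕ.m⊔n≤o⇒m≤o K L K⊔L≤n)) dt) ⟩
        δ * C + B * δ
          ≡⟨ δ[C+B]≡ε ⟩
        ε ∎)

  *-cauchy : ∀ {s t} → IsCauchy s → IsCauchy t → IsCauchy (λ n → s n * t n)
  *-cauchy cs ct =
    let B , K , 0<B , s≤B = cauchy-bounded cs
        C , L , 0<C , t≤C = cauchy-bounded ct
    in *-cauchy-bounded K L 0<B 0<C s≤B t≤C cs ct

  ⊔-+ : ∀ {a b δ c} → 0ℚ ≤ δ → a ≤ b + δ → a ⊔ c ≤ (b ⊔ c) + δ
  ⊔-+ {a} {b} {δ} {c} 0≤δ a≤b+δ = ℚ.⊔-lub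
    (ℚ.≤-trans a≤b+δ (ℚ.+-monoˡ-≤ δ (ℚ.p≤p⊔q b c)))
    (begin
      c             ≡⟨ ℚ.+-identityʳ c ⟨
      c + 0ℚ        ≤⟨ ℚ.+-mono-≤ (ℚ.p≤q⊔p b c) 0≤δ ⟩
      (b ⊔ c) + δ   ∎)

  ⊔-nonZero : ∀ p {δ} → 0ℚ < δ → NonZero (p ⊔ δ)
  ⊔-nonZero p {δ} 0<δ = >-nonZero (ℚ.<-≤-trans 0<δ (ℚ.p≤q⊔p p δ))

  recip : ∀ δ → 0ℚ < δ → ℚ → ℚ
  recip δ 0<δ p = (1/ (p ⊔ δ)) {{⊔-nonZero p 0<δ}}

  recip-cauchy : ∀ δ (0<δ : 0ℚ < δ) {s} → IsCauchy s → IsCauchy (λ n → recip δ 0<δ (s n))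
  recip-cauchy δ 0<δ {s} cs ε 0<ε
    with N , hs ← cs (ε * (δ * δ)) (*-pos 0<ε (*-pos 0<δ 0<δ))
    = N , λ m n ≤m ≤n → close (s m) (s n) (hs n m ≤n ≤m)
    where
    close : ∀ p q → q ≤ p + ε * (δ * δ) → recip δ 0<δ p ≤ recip δ 0<δ q + ε
    close p q q≤p = begin
      1/ a                             ≡⟨ ℚ.*-identityˡ (1/ a) ⟨
      1ℚ * 1/ a                        ≡⟨ cong (_* 1/ a) (ℚ.*-inverseʳ b) ⟨
      b * 1/ b * 1/ a                  ≡⟨ ℚ.*-assoc b (1/ b) (1/ a) ⟩
      b * (1/ b * 1/ a)                ≤⟨ ℚ.*-monoʳ-≤-nonNeg (1/ b * 1/ a) {{nonNegative (ℚ.<⇒≤ (*-pos 0<1/b 0<1/a))}} b≤a+εab ⟩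
      (a + ε * (a * b)) * (1/ b * 1/ a)
        ≡⟨ solve 5 (λ x y e x′ y′ → (x :+ e :* (x :* y)) :* (y′ :* x′) := y′ :* (x :* x′) :+ e :* ((x :* x′) :* (y :* y′)))
             refl a b ε (1/ a) (1/ b) ⟩
      1/ b * (a * 1/ a) + ε * ((a * 1/ a) * (b * 1/ b))
        ≡⟨ cong₂ (λ u v → 1/ b * u + ε * (u * v)) (ℚ.*-inverseʳ a) (ℚ.*-inverseʳ b) ⟩
      1/ b * 1ℚ + ε * (1ℚ * 1ℚ)        ≡⟨ cong₂ _+_ (ℚ.*-identityʳ (1/ b)) (ℚ.*-identityʳ ε) ⟩
      1/ b + ε                         ∎
      where
      a b : ℚ
      a = p ⊔ δ
      b = q ⊔ δ
      δ≤a = ℚ.p≤q⊔p p δ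
      δ≤b = ℚ.p≤q⊔p q δ
      0<a = ℚ.<-≤-trans 0<δ δ≤a
      0<b = ℚ.<-≤-trans 0<δ δ≤b
      instance
        a≢0 : NonZero a
        a≢0 = ⊔-nonZero p 0<δ
        b≢0 : NonZero b
        b≢0 = ⊔-nonZero q 0<δ
      0<1/a = 1/-pos a 0<a
      0<1/b = 1/-pos b 0<b
      b≤a+εab : b ≤ a + ε * (a * b)
      b≤a+εab = begin
        b                    ≤⟨ ⊔-+ {b = p} (ℚ.<⇒≤ (*-pos 0<ε (*-pos 0<δ 0<δ))) q≤p ⟩
        a + ε * (δ * δ)      ≤⟨ ℚ.+-monoʳ-≤ a (ℚ.*-monoˡ-≤-nonNeg ε {{nonNegative (ℚ.<⇒≤ 0<ε)}}
                                 (*-mono (ℚ.<⇒≤ 0<δ) (ℚ.<⇒≤ 0<b) δ≤a δ≤b)) ⟩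
        a + ε * (a * b)      ∎

open CauchyLemmas

-- The largest j < B with P j, or 0 if there is none.
largest : {P : ℕ → Set} → (∀ j → Dec (P j)) → ℕ → ℕ
largest P? zero    = 0
largest P? (suc B) = if does (P? B) then B else largest P? B

-- approxRoot q k p is the q-th root of p ⊔ 0, for q ≥ 1, rounded down to a
-- multiple of 1 / suc k; p < suc ∣ ↥ p ∣ ≤ suc ∣ ↥ p ∣ ^ q bounds the search.
approxRootNum : (q k : ℕ) → ℚ → ℕ
approxRootNum q k p =
  largest (λ j → (+ j ℚ./ suc k) ^ℚ q ℚ.≤? p) (suc ℤ.∣ ↥ p ∣ ℕ.* suc k)

approxRoot : (q k : ℕ) → ℚ → ℚ
approxRoot q k p = + approxRootNum q k p ℚ./ suc k

module RootLemmas where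
  open import Data.Rational hiding (_≟_)
  open ℚ.≤-Reasoning
  open +-*-Solver using (solve; _:=_; _:+_; _:*_; :-_)

  approxRoot-nonneg : ∀ q k p → 0ℚ ≤ approxRoot q k p
  approxRoot-nonneg q k p = 0≤+/ (approxRootNum q k p) k

  0^ : ∀ q k → (+ 0 / suc k) ^ℚ suc q ≡ 0ℚ
  0^ q k = trans (cong (_* (+ 0 / suc k) ^ℚ q) 0/) (ℚ.*-zeroˡ ((+ 0 / suc k) ^ℚ q))
    where
    0/ : + 0 / suc k ≡ 0ℚ
    0/ = ℚ.fromℚᵘ-cong {ℚᵘ.mkℚᵘ (+ 0) k} {ℚᵘ.0ℚᵘ} (ℚᵘ.*≡* refl)

  largest-elim : ∀ {P Q : ℕ → Set} (P? : ∀ j → Dec (P j)) → Q 0 → (∀ j → P j → Q j) →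
                 ∀ B → Q (largest P? B)
  largest-elim P? q₀ P⊆Q zero = q₀
  largest-elim P? q₀ P⊆Q (suc B) with P? B
  ... | yes pB = P⊆Q B pB
  ... | no  _  = largest-elim P? q₀ P⊆Q B

  ¬suc-largest : ∀ {P : ℕ → Set} (P? : ∀ j → Dec (P j)) → (P 1 → P 0) →
                 ∀ B → ¬ P B → ¬ P (suc (largest P? B))
  ¬suc-largest P? P1⇒P0 zero ¬P0 = λ P1 → ¬P0 (P1⇒P0 P1)
  ¬suc-largest P? P1⇒P0 (suc B) ¬PsB with P? B
  ... | yes _   = ¬PsB
  ... | no  ¬PB = ¬suc-largest P? P1⇒P0 B ¬PB

  p<bound : ∀ k p → p < + (suc ℤ.∣ ↥ p ∣ ℕ.* suc k) / suc k
  p<bound k p@(mkℚ a d _) = ℚ.toℚᵘ-cancel-< (ℚᵘ.<-≤-trans {toℚᵘ p} {ℚᵘ.mkℚᵘ (+ suc ℤ.∣ a ∣) 0}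
    (ℚᵘ.*<* (ℤ.≤-<-trans (ℤ.≤-reflexive (ℤ.*-identityʳ a)) (ℤ.≤-<-trans (a≤∣a∣ a)
      (ℤ.<-≤-trans (ℤ.+<+ (ℕ.n<1+n ℤ.∣ a ∣)) (ℤ.≤-trans (ℤ.+≤+ (ℕ.m≤m*n (suc ℤ.∣ a ∣) (suc d)))
        (ℤ.≤-reflexive (ℤ.pos-* (suc ℤ.∣ a ∣) (suc d))))))))
    (ℚᵘ.≤-reflexive (ℚᵘ.≃-trans
      (ℚᵘ.*≡* (trans (sym (ℤ.pos-* (suc ℤ.∣ a ∣) (suc k))) (sym (ℤ.*-identityʳ (+ (suc ℤ.∣ a ∣ ℕ.* suc k))))))
      (ℚᵘ.≃-sym (ℚ.toℚᵘ-fromℚᵘ (ℚᵘ.mkℚᵘ (+ (suc ℤ.∣ a ∣ ℕ.* suc k)) k))))))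
    where
    a≤∣a∣ : ∀ a → a ℤ.≤ + ℤ.∣ a ∣
    a≤∣a∣ (+ n)      = ℤ.≤-refl
    a≤∣a∣ ℤ.-[1+ n ] = ℤ.-≤+

  1≤bound : ∀ k j → 1ℚ ≤ + (suc j ℕ.* suc k) / suc k
  1≤bound k j = /-≤ (+ 1) (+ (suc j ℕ.* suc k)) 0 k (subst₂ ℤ._≤_
    (sym (ℤ.*-identityˡ (+ suc k))) (sym (ℤ.*-identityʳ (+ (suc j ℕ.* suc k))))
    (ℤ.+≤+ (ℕ.m≤n*m (suc k) (suc j))))

  approxRoot-^≤ : ∀ q k p → approxRoot (suc q) k p ^ℚ suc q ≤ p ⊔ 0ℚ
  approxRoot-^≤ q k p = largest-elim {Q = λ j → (+ j / suc k) ^ℚ suc q ≤ p ⊔ 0ℚ}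
    (λ j → (+ j / suc k) ^ℚ suc q ≤? p)
    (ℚ.≤-trans (ℚ.≤-reflexive (0^ q k)) (ℚ.p≤q⊔p p 0ℚ))
    (λ j j^q≤p → ℚ.≤-trans j^q≤p (ℚ.p≤p⊔q p 0ℚ))
    (suc ℤ.∣ ↥ p ∣ ℕ.* suc k)

  <approxRoot-^ : ∀ q k p → p ⊔ 0ℚ < (approxRoot (suc q) k p + + 1 / suc k) ^ℚ suc q
  <approxRoot-^ q k p = subst (λ r → p ⊔ 0ℚ < r ^ℚ suc q)
    (suc-/ (approxRootNum (suc q) k p) k) (⊔-< p<r^ 0<r^)
    where
    B : ℕ
    B = suc ℤ.∣ ↥ p ∣ ℕ.* suc k
    r : ℚ
    r = + suc (approxRootNum (suc q) k p) / suc k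
    p<B^ : p < (+ B / suc k) ^ℚ suc q
    p<B^ = ℚ.<-≤-trans (p<bound k p) (a≤a^ q (1≤bound k ℤ.∣ ↥ p ∣))
    p<r^ : p < r ^ℚ suc q
    p<r^ = ℚ.≰⇒> (¬suc-largest (λ j → (+ j / suc k) ^ℚ suc q ≤? p)
      (ℚ.≤-trans (^-mono (suc q) (0≤+/ 0 k) (/-≤ (+ 0) (+ 1) k k (ℤ.+≤+ ℕ.z≤n))))
      B (λ B^≤p → ℚ.<-irrefl refl (ℚ.<-≤-trans p<B^ B^≤p)))
    0<r^ : 0ℚ < r ^ℚ suc q
    0<r^ = ^-pos (suc q) (ℚ.positive⁻¹ r {{ℚ.normalize-pos (suc (approxRootNum (suc q) k p)) (suc k)}})
    ⊔-< : ∀ {a b c} → a < c → b < c → a ⊔ b < c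
    ⊔-< {a} {b} {c} a<c b<c with ℚ.⊔-sel a b
    ... | inj₁ eq = subst (_< c) (sym eq) a<c
    ... | inj₂ eq = subst (_< c) (sym eq) b<c

  root-close : ∀ q {a s p p′ h} → 0ℚ ≤ s → 0ℚ < h →
               a ^ℚ suc q ≤ p ⊔ 0ℚ → p ≤ p′ + h ^ℚ suc q → p′ ⊔ 0ℚ < s ^ℚ suc q →
               a < s + h
  root-close q {a} {s} {p} {p′} {h} 0≤s 0<h a^≤p p≤p′ p′<s^ =
    ^-cancel-< (suc q) (+-nonneg 0≤s (ℚ.<⇒≤ 0<h)) (begin-strict
      a ^ℚ suc q                  ≤⟨ a^≤p ⟩
      p ⊔ 0ℚ                      ≤⟨ ⊔-+ {b = p′} (ℚ.<⇒≤ (^-pos (suc q) 0<h)) p≤p′ ⟩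
      (p′ ⊔ 0ℚ) + h ^ℚ suc q      <⟨ ℚ.+-monoˡ-< (h ^ℚ suc q) p′<s^ ⟩
      s ^ℚ suc q + h ^ℚ suc q     ≤⟨ ^-superadditive q 0≤s (ℚ.<⇒≤ 0<h) ⟩
      (s + h) ^ℚ suc q            ∎)

  <⇒≤+ε : ∀ {a r u h} → a < r + u + h → u ≤ h → a ≤ r + (h + h)
  <⇒≤+ε {a} {r} {u} {h} a< u≤h = begin
    a               ≤⟨ ℚ.<⇒≤ a< ⟩
    r + u + h       ≤⟨ ℚ.+-monoˡ-≤ h (ℚ.+-monoʳ-≤ r u≤h) ⟩
    r + h + h       ≡⟨ ℚ.+-assoc r h h ⟩
    r + (h + h)     ∎

  root-cauchy-half : ∀ q {s} → IsCauchy s → ∀ h → 0ℚ < h →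
    ∃ λ N → ∀ m n → N ℕ.≤ m → N ℕ.≤ n →
      approxRoot (suc q) m (s m) ≤ approxRoot (suc q) n (s n) + (h + h)
  root-cauchy-half q {s} cs h 0<h =
    let N , hs    = cs (h ^ℚ suc q) (^-pos (suc q) 0<h)
        M , small = archimedean h 0<h
    in N ℕ.⊔ M , λ m n ≤m ≤n →
      <⇒≤+ε {r = approxRoot (suc q) n (s n)} {u = + 1 / suc n}
        (root-close q {p = s m} {p′ = s n}
          (+-nonneg (approxRoot-nonneg (suc q) n (s n)) (0≤+/ 1 n)) 0<h
          (approxRoot-^≤ q m (s m))
          (hs m n (ℕ.m⊔n≤o⇒m≤o N M ≤m) (ℕ.m⊔n≤o⇒m≤o N M ≤n))
          (<approxRoot-^ q n (s n)))
        (small n (ℕ.m⊔n≤o⇒n≤o N M ≤n))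

  root-cauchy : ∀ q .{{_ : ℕ.NonZero q}} {s} → IsCauchy s → IsCauchy (λ n → approxRoot q n (s n))
  root-cauchy (suc q) {s} cs ε 0<ε =
    let N , close = root-cauchy-half q cs (ε * ½) (half-pos 0<ε) in
    N , λ m n ≤m ≤n → subst (λ ε → approxRoot (suc q) m (s m) ≤ approxRoot (suc q) n (s n) + ε)
      (half+half ε) (close m n ≤m ≤n)

open RootLemmas

invFact : ℕ → ℚ
invFact n = (+ 1 ℚ./ (n !)) {{n ℕ.!≢0}}

-- 1/0! + ... + 1/(n-1)!
expSum : ℕ → ℚ
expSum zero    = 0ℚ
expSum (suc n) = expSum n ℚ.+ invFact n

module ExpLemmas where
  open import Data.Rational hiding (_≟_)
  open ℚ.≤-Reasoning

  1/-antitone : ∀ a b .{{_ : ℕ.NonZero a}} .{{_ : ℕ.NonZero b}} →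
                b ℕ.≤ a → + 1 / a ≤ + 1 / b
  1/-antitone (suc a) (suc b) b≤a = /-≤ (+ 1) (+ 1) a b
    (subst₂ ℤ._≤_ (sym (ℤ.*-identityˡ (+ suc b))) (sym (ℤ.*-identityˡ (+ suc a))) (ℤ.+≤+ b≤a))

  1/-double : ∀ a b .{{_ : ℕ.NonZero a}} .{{_ : ℕ.NonZero b}} →
              2 ℕ.* b ℕ.≤ a → + 1 / a + + 1 / a ≤ + 1 / b
  1/-double (suc a) (suc b) 2b≤a = subst (_≤ + 1 / suc b) (suc-/ 1 a)
    (/-≤ (+ 2) (+ 1) a b (subst₂ ℤ._≤_ (ℤ.pos-* 2 (suc b)) (sym (ℤ.*-identityˡ (+ suc a))) (ℤ.+≤+ 2b≤a)))

  0≤invFact : ∀ n → 0ℚ ≤ invFact n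
  0≤invFact n = ℚ.nonNegative⁻¹ (invFact n) {{ℚ.normalize-nonNeg 1 (n !) {{n ℕ.!≢0}}}}

  invFact-double : ∀ n → invFact (suc (suc n)) + invFact (suc (suc n)) ≤ invFact (suc n)
  invFact-double n = 1/-double (suc (suc n) !) (suc n !) {{suc (suc n) ℕ.!≢0}} {{suc n ℕ.!≢0}}
    (ℕ.*-monoˡ-≤ (suc n !) {2} {suc (suc n)} (ℕ.s≤s (ℕ.s≤s ℕ.z≤n)))

  invFact≤1/ : ∀ n → invFact (suc n) ≤ + 1 / suc n
  invFact≤1/ n = 1/-antitone (suc n !) (suc n) {{suc n ℕ.!≢0}}
    (ℕ.m≤m*n (suc n) (n !) {{n ℕ.!≢0}})

  expSum-mono : ∀ {m n} → m ℕ.≤′ n → expSum m ≤ expSum n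
  expSum-mono ℕ.≤′-refl = ℚ.≤-refl
  expSum-mono {m} {suc n} (ℕ.≤′-step m≤n) = begin
    expSum m               ≤⟨ expSum-mono m≤n ⟩
    expSum n               ≡⟨ ℚ.+-identityʳ (expSum n) ⟨
    expSum n + 0ℚ          ≤⟨ ℚ.+-monoʳ-≤ (expSum n) (0≤invFact n) ⟩
    expSum n + invFact n      ∎

  upper : ℕ → ℚ
  upper n = expSum (suc n) + (invFact (suc n) + invFact (suc n))

  upper-antitone : ∀ {m n} → m ℕ.≤′ n → upper n ≤ upper m
  upper-antitone ℕ.≤′-refl = ℚ.≤-refl
  upper-antitone {m} {suc n} (ℕ.≤′-step m≤n) = begin
    expSum (suc n) + invFact (suc n) + (invFact (suc (suc n)) + invFact (suc (suc n)))
      ≤⟨ ℚ.+-monoʳ-≤ (expSum (suc n) + invFact (suc n)) (invFact-double n) ⟩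
    expSum (suc n) + invFact (suc n) + invFact (suc n)
      ≡⟨ ℚ.+-assoc (expSum (suc n)) (invFact (suc n)) (invFact (suc n)) ⟩
    upper n
      ≤⟨ upper-antitone m≤n ⟩
    upper m
      ∎

  expSum≤upper : ∀ n → expSum (suc n) ≤ upper n
  expSum≤upper n = subst (_≤ upper n) (ℚ.+-identityʳ (expSum (suc n)))
    (ℚ.+-monoʳ-≤ (expSum (suc n)) (+-nonneg (0≤invFact (suc n)) (0≤invFact (suc n))))

  expSum-cauchy : IsCauchy expSum
  expSum-cauchy ε 0<ε =
    let N , small = archimedean (ε * ½) (half-pos 0<ε) in suc N , close N (small N ℕ.≤-refl)
    where
    close : ∀ N → + 1 / suc N ≤ ε * ½ →
            ∀ m n → suc N ℕ.≤ m → suc N ℕ.≤ n → expSum m ≤ expSum n + ε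
    close N 1/N≤ (suc m) n (ℕ.s≤s N≤m) N<n = begin
      expSum (suc m)                          ≤⟨ expSum≤upper m ⟩
      upper m                                 ≤⟨ upper-antitone (ℕ.≤⇒≤′ N≤m) ⟩
      expSum (suc N) + (invFact (suc N) + invFact (suc N))
        ≤⟨ ℚ.+-mono-≤ (expSum-mono (ℕ.≤⇒≤′ N<n))
             (ℚ.+-mono-≤ (ℚ.≤-trans (invFact≤1/ N) 1/N≤) (ℚ.≤-trans (invFact≤1/ N) 1/N≤)) ⟩
      expSum n + (ε * ½ + ε * ½)              ≡⟨ cong (_+_ (expSum n)) (half+half ε) ⟩
      expSum n + ε                            ∎

open ExpLemmas

------------------------------------------------------------------------
-- Real numbers

record ℝ : Set where
  no-eta-equality
  field
    seq    : ℕ → ℚ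
    cauchy : IsCauchy seq

open ℝ public

infix 4 _≤_ _<_

_≤_ : ℝ → ℝ → Set
x ≤ y = ∀ ε → 0ℚ ℚ.< ε → ∃ λ N → ∀ n → N ℕ.≤ n → seq x n ℚ.≤ seq y n ℚ.+ ε

record _<_ (x y : ℝ) : Set where
  field
    gap        : ℚ
    gap>0      : 0ℚ ℚ.< gap
    from       : ℕ
    eventually : ∀ n → from ℕ.≤ n → seq x n ℚ.+ gap ℚ.≤ seq y n

fromℚ : ℚ → ℝ
fromℚ p .seq _ = p
fromℚ p .cauchy ε 0<ε = 0 , λ _ _ _ _ → begin
  p           ≡⟨ ℚ.+-identityʳ p ⟨
  p ℚ.+ 0ℚ    ≤⟨ ℚ.+-monoʳ-≤ p (ℚ.<⇒≤ 0<ε) ⟩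
  p ℚ.+ ε     ∎
  where open ℚ.≤-Reasoning

fromℕ : ℕ → ℝ
fromℕ n = fromℚ (+ n ℚ./ 1)

0ℝ 1ℝ : ℝ
0ℝ = fromℕ 0
1ℝ = fromℕ 1

infix  8 -_
infixl 7 _*_ _÷_
infixl 6 _+_ _-_
infixr 8 _^_

_+_ : ℝ → ℝ → ℝ
(x + y) .seq n  = seq x n ℚ.+ seq y n
(x + y) .cauchy = +-cauchy (cauchy x) (cauchy y)

-_ : ℝ → ℝ
(- x) .seq n  = ℚ.- seq x n
(- x) .cauchy = neg-cauchy (cauchy x)

_-_ : ℝ → ℝ → ℝ
x - y = x + (- y)

∣_∣ : ℝ → ℝ
∣ x ∣ .seq n  = ℚ.∣ seq x n ∣
∣ x ∣ .cauchy = abs-cauchy (cauchy x)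

_*_ : ℝ → ℝ → ℝ
(x * y) .seq n  = seq x n ℚ.* seq y n
(x * y) .cauchy = *-cauchy (cauchy x) (cauchy y)

_^_ : ℝ → ℕ → ℝ
x ^ zero  = 1ℝ
x ^ suc n = x * x ^ n

-- The entries of y are eventually at least the gap of 0 < y; cutting the
-- earlier ones off there makes every entry invertible and does not change
-- the limit.
1/_ : (y : ℝ) → {{0ℝ < y}} → ℝ
(1/ y) {{0<y}} .seq n  = recip (_<_.gap 0<y) (_<_.gap>0 0<y) (seq y n)
(1/ y) {{0<y}} .cauchy = recip-cauchy (_<_.gap 0<y) (_<_.gap>0 0<y) (cauchy y)

_÷_ : (x y : ℝ) → {{0ℝ < y}} → ℝ
x ÷ y = x * 1/ y

-- The rounding error of the n-th entry is below 1 / suc n.  Negative reals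
-- are sent to 0.
root : (q : ℕ) .{{_ : ℕ.NonZero q}} → ℝ → ℝ
root q x .seq n  = approxRoot q n (seq x n)
root q x .cauchy = root-cauchy q (cauchy x)

infixl 8 _^[_/_]

-- x ^[ p / q ] is x to the power p/q, for x ≥ 0.
_^[_/_] : ℝ → ℕ → (q : ℕ) .{{_ : ℕ.NonZero q}} → ℝ
x ^[ p / q ] = root q x ^ p

e : ℝ
e .seq    = expSum
e .cauchy = expSum-cauchy

instance
  0<2e² : 0ℝ < fromℕ 2 * e ^ 2
  0<2e² = record
    { gap = 1ℚ ; gap>0 = ℚ.positive⁻¹ 1ℚ ; from = 1
    ; eventually = λ n 1≤n → begin
        0ℚ ℚ.+ 1ℚ                                        ≤⟨ 1≤* 1≤2 (1≤* (1≤e n 1≤n) (1≤* (1≤e n 1≤n) ℚ.≤-refl)) ⟩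
        (+ 2 ℚ./ 1) ℚ.* (expSum n ℚ.* (expSum n ℚ.* 1ℚ))  ∎
    }
    where
    open ℚ.≤-Reasoning
    1≤2 : 1ℚ ℚ.≤ + 2 ℚ./ 1
    1≤2 = /-≤ (+ 1) (+ 2) 0 0 (ℤ.+≤+ (ℕ.s≤s ℕ.z≤n))
    1≤e : ∀ n → 1 ℕ.≤ n → 1ℚ ℚ.≤ expSum n
    1≤e n 1≤n = expSum-mono (ℕ.≤⇒≤′ 1≤n)
    1≤* : ∀ {a b} → 1ℚ ℚ.≤ a → 1ℚ ℚ.≤ b → 1ℚ ℚ.≤ a ℚ.* b
    1≤* 1≤a 1≤b = *-mono (ℚ.nonNegative⁻¹ 1ℚ) (ℚ.≤-trans (ℚ.nonNegative⁻¹ 1ℚ) 1≤b) 1≤a 1≤b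

infix 4 _⟶_

_⟶_ : (ℕ → ℝ) → ℝ → Set
a ⟶ L = ∀ ε → 0ℝ < ε → ∃ λ N → ∀ n → N ℕ.≤ n → ∣ a n - L ∣ < ε

------------------------------------------------------------------------
-- Hypergraphs and Steiner triple systems

record Hypergraph (n : ℕ) : Set where
  field
    size     : ℕ
    edge     : Fin size → Subset n
    distinct : Injective _≡_ _≡_ edge

open Hypergraph public

record IsSteinerTripleSystem {n} (H : Hypergraph n) : Set where
  field
    uniform : ∀ i → Subset.∣ edge H i ∣ ≡ 3
    pairs   : ∀ u v → u ≢ v → ∃! _≡_ λ i → u ∈ edge H i × v ∈ edge H i

-- A set of hyperedges is given by the set of their indices.
IsPerfectMatching : ∀ {n} (H : Hypergraph n) → Subset (size H) → Set
IsPerfectMatching H M =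
  (∀ i j → i ∈ M → j ∈ M → i ≢ j → Empty (edge H i ∩ edge H j)) ×
  (∀ v → ∃ λ i → i ∈ M × v ∈ edge H i)

isPerfectMatching? : ∀ {n} (H : Hypergraph n) M → Dec (IsPerfectMatching H M)
isPerfectMatching? H M =
  all? (λ i → all? λ j → i ∈? M →-dec (j ∈? M →-dec
    (¬? (i ≟ j) →-dec ¬? (nonempty? (edge H i ∩ edge H j))))) ×-dec
  all? (λ v → any? λ i → i ∈? M ×-dec v ∈? edge H i)

subsets : ∀ m → List (Subset m)
subsets zero    = [] List.∷ List.[]
subsets (suc m) = List.map (outside ∷_) (subsets m) ++ List.map (inside ∷_) (subsets m)

#perfectMatchings : ∀ {n} → Hypergraph n → ℕ
#perfectMatchings H = length (filter (isPerfectMatching? H) (subsets (size H)))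

-- Let n = 3m. Reveal a perfect matching M edge by edge: a uniformly random
-- edge of M that is still hidden is revealed at a uniformly random vertex v of
-- it. If d is the number of edges at v that avoid what was revealed before, a
-- player who guesses each revealed edge uniformly among those d reproduces M
-- with probability E ∏ 1/d, and these probabilities sum to at most 1 over all
-- M. By AM-GM, E ∏ 1/d ≥ ∏ 1/c as soon as each c bounds the mean of its d.
-- When r edges are hidden, an edge outside M survives with probability about
-- (r/m)³, since it meets three edges of M, so c = 1 + 3r²/2m will do. Hence
-- there are at most ∏_{r ≤ m} (1 + 3r²/2m) perfect matchings, which Stirling's
-- estimate compares with (3m/2e²)^m = (n/2e²)^m.
module Submission where

open import Algebra using (CommutativeRing)
import Algebra.Properties.CommutativeSemiring.Exp as CommutativeExp
import Algebra.Properties.Semiring.Exp as Exp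
import Algebra.Properties.Semiring.Sum as Sum
open import Data.Bool using (true; false; if_then_else_)
open import Data.Fin as Fin using (Fin; zero; suc)
import Data.Fin.Properties as Fin
open import Data.Fin.Subset as Subset using (Subset; inside; outside; _∈_; _⊆_; _─_)
import Data.Fin.Subset.Properties as Subset
import Data.Integer as ℤ
import Data.Integer.Properties as ℤ
open import Data.List as List using (List; []; _∷_; foldr; length; filter)
import Data.List.Properties as List
open import Data.List.Relation.Unary.All using (All; []; _∷_)
open import Data.Nat as ℕ using (ℕ; zero; suc; _!)
open import Data.Nat.Divisibility using (_∣_; _∣?_; divides)
import Data.Nat.DivMod as ℕ
import Data.Nat.Properties as ℕ
import Data.Nat.Tactic.RingSolver as ℕ-Solver
open import Data.Product using (∃; Σ-syntax; _×_; _,_; proj₁; proj₂)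
import Data.Rational
import Data.Rational.Properties as ℚ
import Data.Rational.Unnormalised as ℚᵘ
open import Data.Sum using (inj₁; inj₂)
open import Data.Vec as Vec using ([]; _∷_; lookup; _[_]≔_)
import Data.Vec.Properties as Vec
open import Function using (_∘_)
open import Relation.Binary using (tri<; tri≈; tri>)
open import Relation.Binary.PropositionalEquality
open import Relation.Nullary using (Dec; yes; no; does; ¬_; contradiction)
open import Relation.Nullary.Decidable using (dec⇒maybe)
open import Tactic.RingSolver using (solve-∀)
open import Tactic.RingSolver.Core.AlmostCommutativeRing using (AlmostCommutativeRing; fromCommutativeRing)
import Defs as Real
open import Defs hiding (_≤_; _<_; _+_; _*_; -_; _-_; 1/_; ∣_∣; _^_; _÷_; e)

-- The probabilities sum to at most 1 because M covers each uncovered vertex exactly once: a random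
-- hidden edge and a random vertex v of it make v uniform among the uncovered vertices, whatever M
-- is. So the player can be run without knowing M, from v and the uncovered set alone. To stay
-- within the rationals and to cope with numbers d that depend on the past, AM-GM is used in the
-- form 1/∏x ≥ 1 + N - ∑x for the N ratios x = d/c of a run. The right side is linear in the ratios
-- still to come, so expectations can be taken one round at a time. The expected future ratios are
-- controlled by the number T of edges outside M that still survive. With r edges hidden, one round
-- multiplies T by at most 1 - 3/r in expectation; since 1 - 3/r ≤ (1 - 1/r)³, a cubic bound κr³ is
-- carried from each round to the next. In the asymptotics the obstacle is the summand 1 in 1 + κr².
-- Shifting r by a number of order √m absorbs it, at a cost that disappears in η. The estimates hold
-- with every partial sum in place of e, so they are inequalities between rationals at each index.

-- Rational arithmetic, convexity of powers, and AM-GM.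

module RationalArithmetic where
  open import Data.Rational
  open import Algebra.Definitions.RawSemiring ℚ.+-*-rawSemiring using (_^_) public
  open RationalLemmas public
  open Exp (CommutativeRing.semiring ℚ.+-*-commutativeRing) using (^-homo-*; ^-assocʳ) public
  open CommutativeExp (CommutativeRing.commutativeSemiring ℚ.+-*-commutativeRing) using (^-distrib-*) public
  open ℚ.≤-Reasoning

  ℚ-ring : AlmostCommutativeRing _ _
  ℚ-ring = fromCommutativeRing ℚ.+-*-commutativeRing (λ x → dec⇒maybe (0ℚ ≟ x))

  ι : ℕ → ℚ
  ι n = (ℤ.+ n) / 1

  ι-suc : ∀ n → ι (suc n) ≡ 1ℚ + ι n
  ι-suc n = trans (suc-/ n 0) (ℚ.+-comm (ι n) 1ℚ)

  ι-+ : ∀ m n → ι (m ℕ.+ n) ≡ ι m + ι n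
  ι-+ zero    n = sym (ℚ.+-identityˡ (ι n))
  ι-+ (suc m) n = begin-equality
    ι (suc (m ℕ.+ n))   ≡⟨ ι-suc (m ℕ.+ n) ⟩
    1ℚ + ι (m ℕ.+ n)    ≡⟨ cong (1ℚ +_) (ι-+ m n) ⟩
    1ℚ + (ι m + ι n)    ≡⟨ ℚ.+-assoc 1ℚ (ι m) (ι n) ⟨
    1ℚ + ι m + ι n      ≡⟨ cong (_+ ι n) (ι-suc m) ⟨
    ι (suc m) + ι n     ∎

  ι-* : ∀ m n → ι (m ℕ.* n) ≡ ι m * ι n
  ι-* zero    n = sym (ℚ.*-zeroˡ (ι n))
  ι-* (suc m) n = begin-equality
    ι (n ℕ.+ m ℕ.* n)   ≡⟨ ι-+ n (m ℕ.* n) ⟩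
    ι n + ι (m ℕ.* n)   ≡⟨ cong (ι n +_) (ι-* m n) ⟩
    ι n + ι m * ι n     ≡⟨ expand (ι m) (ι n) ⟩
    (1ℚ + ι m) * ι n    ≡⟨ cong (_* ι n) (ι-suc m) ⟨
    ι (suc m) * ι n     ∎
    where
    expand : ∀ a b → b + a * b ≡ (1ℚ + a) * b
    expand = solve-∀ ℚ-ring

  ι-^ : ∀ m n → ι (m ℕ.^ n) ≡ ι m ^ n
  ι-^ m zero    = refl
  ι-^ m (suc n) = trans (ι-* m (m ℕ.^ n)) (cong (ι m *_) (ι-^ m n))

  0≤ι : ∀ n → 0ℚ ≤ ι n
  0≤ι n = 0≤+/ n 0

  -- Reduces an inequality to an identity that the ring solver can check, once the slack is written
  -- down.
  ≤-byDifference : ∀ {a b} c → 0ℚ ≤ c → a + c ≡ b → a ≤ b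
  ≤-byDifference {a} {b} c 0≤c eq = begin
    a        ≡⟨ ℚ.+-identityʳ a ⟨
    a + 0ℚ   ≤⟨ ℚ.+-monoʳ-≤ a 0≤c ⟩
    a + c    ≡⟨ eq ⟩
    b        ∎

  ι-mono-≤ : ∀ {m n} → m ℕ.≤ n → ι m ≤ ι n
  ι-mono-≤ {m} {n} m≤n = ≤-byDifference (ι (n ℕ.∸ m)) (0≤ι (n ℕ.∸ m))
    (trans (sym (ι-+ m (n ℕ.∸ m))) (cong ι (ℕ.m+[n∸m]≡n m≤n)))

  1≤ι : ∀ n → 1ℚ ≤ ι (suc n)
  1≤ι n = ι-mono-≤ {1} {suc n} (ℕ.s≤s ℕ.z≤n)

  0≤1 : 0ℚ ≤ 1ℚ
  0≤1 = ℚ.nonNegative⁻¹ 1ℚ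

  0<1 : 0ℚ < 1ℚ
  0<1 = ℚ.positive⁻¹ 1ℚ

  0<ι : ∀ n → 0ℚ < ι (suc n)
  0<ι n = ℚ.<-≤-trans 0<1 (1≤ι n)

  ι-mono-< : ∀ {m n} → m ℕ.< n → ι m < ι n
  ι-mono-< {m} m<n = ℚ.<-≤-trans
    (subst₂ _<_ (ℚ.+-identityˡ (ι m)) (sym (ι-suc m)) (ℚ.+-monoˡ-< (ι m) 0<1)) (ι-mono-≤ m<n)

  ι-injective : ∀ {m n} → ι m ≡ ι n → m ≡ n
  ι-injective {m} {n} eq with ℕ.<-cmp m n
  ... | tri< m<n _ _ = contradiction (ι-mono-< m<n) (ℚ.<-irrefl eq)
  ... | tri≈ _ m≡n _ = m≡n
  ... | tri> _ _ m>n = contradiction (ι-mono-< m>n) (ℚ.<-irrefl (sym eq))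

  *-monoʳ : ∀ {a b c} → 0ℚ ≤ c → a ≤ b → c * a ≤ c * b
  *-monoʳ {c = c} 0≤c = ℚ.*-monoˡ-≤-nonNeg c {{nonNegative 0≤c}}

  *-monoˡ : ∀ {a b c} → 0ℚ ≤ c → a ≤ b → a * c ≤ b * c
  *-monoˡ {c = c} 0≤c = ℚ.*-monoʳ-≤-nonNeg c {{nonNegative 0≤c}}

  *-cancelˡ : ∀ {a b} c → 0ℚ < c → c * a ≤ c * b → a ≤ b
  *-cancelˡ c 0<c = ℚ.*-cancelˡ-≤-pos c {{positive 0<c}}

  square-nonneg : ∀ a → 0ℚ ≤ a * a
  square-nonneg a with ℚ.≤-total 0ℚ a
  ... | inj₁ 0≤a = *-nonneg 0≤a 0≤a
  ... | inj₂ a≤0 = subst (0ℚ ≤_) (neg² a) (*-nonneg 0≤-a 0≤-a)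
    where
    0≤-a : 0ℚ ≤ - a
    0≤-a = ℚ.neg-antimono-≤ a≤0
    neg² : ∀ a → (- a) * (- a) ≡ a * a
    neg² = solve-∀ ℚ-ring

  p≤q⇒0≤q-p : ∀ {p q} → p ≤ q → 0ℚ ≤ q - p
  p≤q⇒0≤q-p {p} {q} p≤q = subst (_≤ q - p) (ℚ.+-inverseʳ p) (ℚ.+-monoˡ-≤ (- p) p≤q)

  -- For p < 1 the junk value is 1.
  inv : ℚ → ℚ
  inv = CauchyLemmas.recip 1ℚ 0<1

  0<inv : ∀ p → 0ℚ < inv p
  0<inv p = 1/-pos (p ⊔ 1ℚ) {{CauchyLemmas.⊔-nonZero p 0<1}} (ℚ.<-≤-trans 0<1 (ℚ.p≤q⊔p p 1ℚ))

  0≤inv : ∀ p → 0ℚ ≤ inv p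
  0≤inv p = ℚ.<⇒≤ (0<inv p)

  *-inv≤1 : ∀ p → p * inv p ≤ 1ℚ
  *-inv≤1 p = ℚ.≤-trans (*-monoˡ (0≤inv p) (ℚ.p≤p⊔q p 1ℚ))
    (ℚ.≤-reflexive (ℚ.*-inverseʳ (p ⊔ 1ℚ) {{CauchyLemmas.⊔-nonZero p 0<1}}))

  *-inv : ∀ {p} → 1ℚ ≤ p → p * inv p ≡ 1ℚ
  *-inv {p} 1≤p = trans (cong (_* inv p) (sym (ℚ.p≥q⇒p⊔q≡p 1≤p)))
    (ℚ.*-inverseʳ (p ⊔ 1ℚ) {{CauchyLemmas.⊔-nonZero p 0<1}})

  -- Convexity of t^(n+1): the curve lies above its tangent at a. In the induction, b times the
  -- tangent for one degree exceeds the tangent for the next by (n+1) a^n (b - a)². AM-GM,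
  -- Bernoulli, the decay of the exponential series and the perturbation of powers all rest on this.
  ^-tangent : ∀ n {a b} → 0ℚ ≤ a → 0ℚ ≤ b →
              a ^ suc n + ι (suc n) * (a ^ n * (b - a)) ≤ b ^ suc n
  ^-tangent zero {a} {b} 0≤a 0≤b = ℚ.≤-reflexive (linear a b)
    where
    linear : ∀ a b → a * 1ℚ + 1ℚ * (1ℚ * (b - a)) ≡ b * 1ℚ
    linear = solve-∀ ℚ-ring
  ^-tangent (suc n) {a} {b} 0≤a 0≤b = begin
    a * (a * a ^ n) + ι (suc (suc n)) * (a * a ^ n * (b - a))
      ≤⟨ ≤-byDifference (ι (suc n) * (a ^ n * ((b - a) * (b - a))))
           (*-nonneg (0≤ι (suc n)) (*-nonneg (^-nonneg n 0≤a) (square-nonneg (b - a)))) refl ⟩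
    a * (a * a ^ n) + ι (suc (suc n)) * (a * a ^ n * (b - a)) + ι (suc n) * (a ^ n * ((b - a) * (b - a)))
      ≡⟨ cong (λ r → a * (a * a ^ n) + r * (a * a ^ n * (b - a)) + ι (suc n) * (a ^ n * ((b - a) * (b - a)))) (ι-suc (suc n)) ⟩
    a * (a * a ^ n) + (1ℚ + ι (suc n)) * (a * a ^ n * (b - a)) + ι (suc n) * (a ^ n * ((b - a) * (b - a)))
      ≡⟨ regroup a b (a ^ n) (ι (suc n)) ⟩
    b * (a * a ^ n + ι (suc n) * (a ^ n * (b - a)))
      ≤⟨ *-monoʳ 0≤b (^-tangent n 0≤a 0≤b) ⟩
    b * (b * b ^ n)
      ∎
    where
    regroup : ∀ a b p r →
      a * (a * p) + (1ℚ + r) * (a * p * (b - a)) + r * (p * ((b - a) * (b - a))) ≡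
      b * (a * p + r * (p * (b - a)))
    regroup = solve-∀ ℚ-ring

  1^ : ∀ n → 1ℚ ^ n ≡ 1ℚ
  1^ zero    = refl
  1^ (suc n) = trans (ℚ.*-identityˡ (1ℚ ^ n)) (1^ n)

  bernoulli : ∀ n {x} → 0ℚ ≤ x → 1ℚ + ι n * x ≤ (1ℚ + x) ^ n
  bernoulli zero    {x} _   = ℚ.≤-reflexive (cong (1ℚ +_) (ℚ.*-zeroˡ x))
  bernoulli (suc n) {x} 0≤x = begin
    1ℚ + ι (suc n) * x                                          ≡⟨ expand (ι (suc n)) x ⟩
    1ℚ + ι (suc n) * (1ℚ * (1ℚ + x - 1ℚ))                       ≡⟨ cong₂ (λ p q → p + ι (suc n) * (q * (1ℚ + x - 1ℚ))) (1^ (suc n)) (1^ n) ⟨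
    1ℚ ^ suc n + ι (suc n) * (1ℚ ^ n * (1ℚ + x - 1ℚ))           ≤⟨ ^-tangent n 0≤1 (+-nonneg 0≤1 0≤x) ⟩
    (1ℚ + x) ^ suc n                                            ∎
    where
    expand : ∀ r x → 1ℚ + r * x ≡ 1ℚ + r * (1ℚ * (1ℚ + x - 1ℚ))
    expand = solve-∀ ℚ-ring

  ^-monoʳ : ∀ {a} → 1ℚ ≤ a → ∀ {m n} → m ℕ.≤ n → a ^ m ≤ a ^ n
  ^-monoʳ {a} 1≤a {m} {n} m≤n = begin
    a ^ m                     ≡⟨ ℚ.*-identityʳ (a ^ m) ⟨
    a ^ m * 1ℚ                ≤⟨ *-monoʳ (^-nonneg m (ℚ.≤-trans 0≤1 1≤a)) (1≤^ (n ℕ.∸ m) 1≤a) ⟩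
    a ^ m * a ^ (n ℕ.∸ m)     ≡⟨ ^-homo-* a m (n ℕ.∸ m) ⟨
    a ^ (m ℕ.+ (n ℕ.∸ m))     ≡⟨ cong (a ^_) (ℕ.m+[n∸m]≡n m≤n) ⟩
    a ^ n                     ∎

  *-swap : ∀ a b c → a * (b * c) ≡ b * (a * c)
  *-swap = solve-∀ ℚ-ring

  sumᴸ productᴸ : List ℚ → ℚ
  sumᴸ     = foldr _+_ 0ℚ
  productᴸ = foldr _*_ 1ℚ

  NonNegList : List ℚ → Set
  NonNegList = All (0ℚ ≤_)

  sumᴸ-nonneg : ∀ {xs} → NonNegList xs → 0ℚ ≤ sumᴸ xs
  sumᴸ-nonneg []           = ℚ.≤-refl
  sumᴸ-nonneg (0≤x ∷ 0≤xs) = +-nonneg 0≤x (sumᴸ-nonneg 0≤xs)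

  productᴸ-nonneg : ∀ {xs} → NonNegList xs → 0ℚ ≤ productᴸ xs
  productᴸ-nonneg []           = 0≤1
  productᴸ-nonneg (0≤x ∷ 0≤xs) = *-nonneg 0≤x (productᴸ-nonneg 0≤xs)

  mean : ∀ xs → NonNegList xs → ∃ λ μ → 0ℚ ≤ μ × ι (length xs) * μ ≡ sumᴸ xs
  mean []       []   = 0ℚ , ℚ.≤-refl , refl
  mean (x ∷ xs) 0≤xs =
    sumᴸ (x ∷ xs) * inv N , *-nonneg (sumᴸ-nonneg 0≤xs) (0≤inv N) ,
    trans (*-swap N (sumᴸ (x ∷ xs)) (inv N))
      (trans (cong (sumᴸ (x ∷ xs) *_) (*-inv (1≤ι (length xs)))) (ℚ.*-identityʳ (sumᴸ (x ∷ xs))))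
    where
    N : ℚ
    N = ι (suc (length xs))

  -- With ν the mean of the tail, x = (N+1)μ - Nν, so x ν^N is exactly the tangent of t^(N+1) at ν,
  -- evaluated at μ.
  am-gm : ∀ xs → NonNegList xs → ∀ μ → 0ℚ ≤ μ → ι (length xs) * μ ≡ sumᴸ xs →
          productᴸ xs ≤ μ ^ length xs
  am-gm []       []           μ 0≤μ _  = ℚ.≤-refl
  am-gm (x ∷ xs) (0≤x ∷ 0≤xs) μ 0≤μ eq with ν , 0≤ν , eqν ← mean xs 0≤xs = begin
    x * productᴸ xs                                 ≤⟨ *-monoʳ 0≤x (am-gm xs 0≤xs ν 0≤ν eqν) ⟩
    x * ν ^ N                                       ≡⟨ cong (_* ν ^ N) x≡ ⟩
    (ι (suc N) * μ - ι N * ν) * ν ^ N               ≡⟨ cong (λ r → (r * μ - ι N * ν) * ν ^ N) (ι-suc N) ⟩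
    ((1ℚ + ι N) * μ - ι N * ν) * ν ^ N              ≡⟨ regroup (ι N) μ ν (ν ^ N) ⟩
    ν * ν ^ N + (1ℚ + ι N) * (ν ^ N * (μ - ν))      ≡⟨ cong (λ r → ν * ν ^ N + r * (ν ^ N * (μ - ν))) (ι-suc N) ⟨
    ν * ν ^ N + ι (suc N) * (ν ^ N * (μ - ν))       ≤⟨ ^-tangent N 0≤ν 0≤μ ⟩
    μ ^ suc N                                       ∎
    where
    N : ℕ
    N = length xs
    cancel : ∀ a b → a ≡ a + b - b
    cancel = solve-∀ ℚ-ring
    x≡ : x ≡ ι (suc N) * μ - ι N * ν
    x≡ = trans (cancel x (sumᴸ xs)) (cong₂ _-_ (sym eq) (sym eqν))
    regroup : ∀ n μ ν p → ((1ℚ + n) * μ - n * ν) * p ≡ ν * p + (1ℚ + n) * (p * (μ - ν))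
    regroup = solve-∀ ℚ-ring

  -- AM-GM for the numbers xs together with 1 + length xs - sum xs, whose mean is 1.
  am-gm-deficit : ∀ xs → NonNegList xs →
                  productᴸ xs * (1ℚ + ι (length xs) - sumᴸ xs) ≤ 1ℚ
  am-gm-deficit xs 0≤xs with ℚ.≤-total 0ℚ (1ℚ + ι (length xs) - sumᴸ xs)
  ... | inj₂ ≤0 = ℚ.≤-trans
    (ℚ.≤-trans (*-monoʳ (productᴸ-nonneg 0≤xs) ≤0) (ℚ.≤-reflexive (ℚ.*-zeroʳ (productᴸ xs)))) 0≤1
  ... | inj₁ 0≤ with μ , 0≤μ , eq ← mean xs 0≤xs = begin
    productᴸ xs * (1ℚ + ι N - sumᴸ xs)             ≤⟨ *-monoˡ 0≤ (am-gm xs 0≤xs μ 0≤μ eq) ⟩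
    μ ^ N * (1ℚ + ι N - sumᴸ xs)                   ≡⟨ cong (λ s → μ ^ N * (1ℚ + ι N - s)) eq ⟨
    -- Regrouped, this is the tangent of t^(N+1) at μ, evaluated at t = 1.
    μ ^ N * (1ℚ + ι N - ι N * μ)                   ≡⟨ regroup (ι N) μ (μ ^ N) ⟩
    μ * μ ^ N + (1ℚ + ι N) * (μ ^ N * (1ℚ - μ))    ≡⟨ cong (λ r → μ * μ ^ N + r * (μ ^ N * (1ℚ - μ))) (ι-suc N) ⟨
    μ * μ ^ N + ι (suc N) * (μ ^ N * (1ℚ - μ))     ≤⟨ ^-tangent N 0≤μ 0≤1 ⟩
    1ℚ ^ suc N                                     ≡⟨ 1^ (suc N) ⟩
    1ℚ                                             ∎
    where
    N : ℕ
    N = length xs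
    regroup : ∀ n μ p → p * (1ℚ + n - n * μ) ≡ μ * p + (1ℚ + n) * (p * (1ℚ - μ))
    regroup = solve-∀ ℚ-ring

-- Indicator values, sums over vertices and sums over all subsets.

module Indicators where
  open import Data.Rational
  open RationalArithmetic
  open ℚ.≤-Reasoning
  open Sum (CommutativeRing.semiring ℚ.+-*-commutativeRing) public
    using (sum; sum-cong-≗; ∑-distrib-+; ∑-comm; *-distribˡ-sum; *-distribʳ-sum)

  sum-mono : ∀ {n} {f g : Fin n → ℚ} → (∀ i → f i ≤ g i) → sum f ≤ sum g
  sum-mono {zero}  f≤g = ℚ.≤-refl
  sum-mono {suc n} f≤g = ℚ.+-mono-≤ (f≤g zero) (sum-mono (f≤g ∘ suc))

  sum-nonneg : ∀ {n} {f : Fin n → ℚ} → (∀ i → 0ℚ ≤ f i) → 0ℚ ≤ sum f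
  sum-nonneg {zero}  0≤f = ℚ.≤-refl
  sum-nonneg {suc n} 0≤f = +-nonneg (0≤f zero) (sum-nonneg (0≤f ∘ suc))

  sum-const : ∀ n c → sum {n} (λ _ → c) ≡ ι n * c
  sum-const zero    c = sym (ℚ.*-zeroˡ c)
  sum-const (suc n) c = begin-equality
    c + sum {n} (λ _ → c)   ≡⟨ cong (c +_) (sum-const n c) ⟩
    c + ι n * c             ≡⟨ factor c (ι n) ⟩
    (1ℚ + ι n) * c          ≡⟨ cong (_* c) (ι-suc n) ⟨
    ι (suc n) * c           ∎
    where
    factor : ∀ c n → c + n * c ≡ (1ℚ + n) * c
    factor = solve-∀ ℚ-ring

  term≤sum : ∀ {n} {f : Fin n → ℚ} → (∀ i → 0ℚ ≤ f i) → ∀ i → f i ≤ sum f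
  term≤sum {suc n} {f} 0≤f zero    = ≤-byDifference (sum (f ∘ suc)) (sum-nonneg (0≤f ∘ suc)) refl
  term≤sum {suc n} {f} 0≤f (suc i) = ℚ.≤-trans (term≤sum (0≤f ∘ suc) i)
    (≤-byDifference (f zero) (0≤f zero) (ℚ.+-comm (sum (f ∘ suc)) (f zero)))

  sum-sub : ∀ {n} (f g : Fin n → ℚ) → sum (λ i → f i - g i) ≡ sum f - sum g
  sum-sub {zero}  f g = refl
  sum-sub {suc n} f g = trans (cong (f zero - g zero +_) (sum-sub (f ∘ suc) (g ∘ suc)))
    (regroup (f zero) (g zero) (sum (f ∘ suc)) (sum (g ∘ suc)))
    where
    regroup : ∀ a b c d → a - b + (c - d) ≡ a + c - (b + d)
    regroup = solve-∀ ℚ-ring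

  -- A relation rather than a function: matching on it replaces the rational by 0 or 1 and supplies
  -- the proof or refutation at once, so that inequalities between products of indicators split into
  -- finitely many trivial cases.
  data Indicates (P : Set) : ℚ → Set where
    holds : P → Indicates P 1ℚ
    fails : ¬ P → Indicates P 0ℚ

  ind-nonneg : ∀ {P a} → Indicates P a → 0ℚ ≤ a
  ind-nonneg (holds _) = 0≤1
  ind-nonneg (fails _) = ℚ.≤-refl

  ind≤1 : ∀ {P a} → Indicates P a → a ≤ 1ℚ
  ind≤1 (holds _) = ℚ.≤-refl
  ind≤1 (fails _) = 0≤1

  ind-× : ∀ {P Q a b} → Indicates P a → Indicates Q b → Indicates (P × Q) (a * b)
  ind-× (holds p)  (holds q)  = holds (p , q)
  ind-× (holds p)  (fails ¬q) = fails (¬q ∘ proj₂)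
  ind-× (fails ¬p) (holds q)  = fails (¬p ∘ proj₁)
  ind-× (fails ¬p) (fails ¬q) = fails (¬p ∘ proj₁)

  ind≡1 : ∀ {P a} → Indicates P a → P → a ≡ 1ℚ
  ind≡1 (holds _)  _ = refl
  ind≡1 (fails ¬p) p = contradiction p ¬p

  ind≡0 : ∀ {P a} → Indicates P a → ¬ P → a ≡ 0ℚ
  ind≡0 (holds p) ¬p = contradiction p ¬p
  ind≡0 (fails _) _  = refl

  1≤ind⇒holds : ∀ {P a} → Indicates P a → 1ℚ ≤ a → P
  1≤ind⇒holds (holds p) _   = p
  1≤ind⇒holds (fails _) 1≤0 = contradiction (ℚ.<-≤-trans 0<1 1≤0) (ℚ.<-irrefl refl)

  𝟙 : ∀ {P : Set} → Dec P → ℚ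
  𝟙 P? = if does P? then 1ℚ else 0ℚ

  𝟙-indicates : ∀ {P} (P? : Dec P) → Indicates P (𝟙 P?)
  𝟙-indicates (yes p) = holds p
  𝟙-indicates (no ¬p) = fails ¬p

  χ : ∀ {n} → Subset n → Fin n → ℚ
  χ p x = if lookup p x then 1ℚ else 0ℚ

  χ-indicates : ∀ {n} (p : Subset n) x → Indicates (x ∈ p) (χ p x)
  χ-indicates p x with lookup p x in eq
  ... | true  = holds (Vec.lookup⇒[]= x p eq)
  ... | false = fails λ x∈p → contradiction (trans (sym eq) (Vec.[]=⇒lookup x∈p)) λ ()

  sum-atMostOne : ∀ {n} {P : Fin n → Set} {f : Fin n → ℚ} → (∀ i → Indicates (P i) (f i)) →
                  (∀ i j → P i → P j → i ≡ j) → sum f ≤ 1ℚ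
  sum-atMostOne {zero}  Pf unique = 0≤1
  sum-atMostOne {suc n} {P} {f} Pf unique = atZero (Pf zero)
    where
    atZero : ∀ {a} → Indicates (P zero) a → a + sum (f ∘ suc) ≤ 1ℚ
    atZero (fails _)  = ℚ.≤-trans (ℚ.≤-reflexive (ℚ.+-identityˡ (sum (f ∘ suc))))
      (sum-atMostOne (Pf ∘ suc) λ i j Pi Pj → Fin.suc-injective (unique (suc i) (suc j) Pi Pj))
    atZero (holds p₀) = ℚ.≤-reflexive (cong (1ℚ +_) (trans
      (sum-cong-≗ {n} {f ∘ suc} {λ _ → 0ℚ} λ i → ind≡0 (Pf (suc i)) λ Pi → contradiction (unique zero (suc i) p₀ Pi) λ ())
      (trans (sum-const n 0ℚ) (ℚ.*-zeroʳ (ι n)))))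

  ι∣∣ : ∀ {n} (p : Subset n) → ι Subset.∣ p ∣ ≡ sum (χ p)
  ι∣∣ []          = refl
  ι∣∣ (true ∷ p)  = trans (ι-suc Subset.∣ p ∣) (cong (1ℚ +_) (ι∣∣ p))
  ι∣∣ (false ∷ p) = trans (ι∣∣ p) (sym (ℚ.+-identityˡ (sum (χ p))))

  sum-erase : ∀ {n} (p : Subset n) x → x ∈ p → (h : Fin n → ℚ) →
              sum (λ y → χ p y * h y) ≡ sum (λ y → χ (p [ x ]≔ outside) y * h y) + h x
  sum-erase (.inside ∷ p) zero Vec.here h =
    regroup (h zero) (sum (λ y → χ p y * h (suc y)))
    where
    regroup : ∀ a b → 1ℚ * a + b ≡ 0ℚ * a + b + a
    regroup = solve-∀ ℚ-ring
  sum-erase (b ∷ p) (suc x) (Vec.there x∈p) h =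
    trans (cong (χ (b ∷ p) zero * h zero +_) (sum-erase p x x∈p (h ∘ suc)))
      (sym (ℚ.+-assoc (χ (b ∷ p) zero * h zero) (sum (λ y → χ (p [ x ]≔ outside) y * h (suc y))) (h (suc x))))

  χ-─ : ∀ {n} (p q : Subset n) x → χ (p ─ q) x ≡ χ p x * (1ℚ - χ q x)
  χ-─ (true  ∷ p) (true  ∷ q) zero    = refl
  χ-─ (true  ∷ p) (false ∷ q) zero    = refl
  χ-─ (false ∷ p) (true  ∷ q) zero    = refl
  χ-─ (false ∷ p) (false ∷ q) zero    = refl
  χ-─ (_     ∷ p) (_     ∷ q) (suc x) = χ-─ p q x

  -- The recursion follows that of `subsets`, which makes it agree with the counting by `filter` and
  -- lets one coordinate be erased by induction.
  ∑ˢ : ∀ n → (Subset n → ℚ) → ℚ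
  ∑ˢ zero    F = F []
  ∑ˢ (suc n) F = ∑ˢ n (F ∘ (outside ∷_)) + ∑ˢ n (F ∘ (inside ∷_))

  ∑ˢ-mono : ∀ n {F G : Subset n → ℚ} → (∀ p → F p ≤ G p) → ∑ˢ n F ≤ ∑ˢ n G
  ∑ˢ-mono zero    F≤G = F≤G []
  ∑ˢ-mono (suc n) F≤G = ℚ.+-mono-≤ (∑ˢ-mono n (F≤G ∘ (outside ∷_))) (∑ˢ-mono n (F≤G ∘ (inside ∷_)))

  ∑ˢ-zero : ∀ n → ∑ˢ n (λ _ → 0ℚ) ≡ 0ℚ
  ∑ˢ-zero zero    = refl
  ∑ˢ-zero (suc n) = cong₂ _+_ (∑ˢ-zero n) (∑ˢ-zero n)

  ∑ˢ-cong : ∀ n {F G : Subset n → ℚ} → (∀ p → F p ≡ G p) → ∑ˢ n F ≡ ∑ˢ n G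
  ∑ˢ-cong zero    F≡G = F≡G []
  ∑ˢ-cong (suc n) F≡G = cong₂ _+_ (∑ˢ-cong n (F≡G ∘ (outside ∷_))) (∑ˢ-cong n (F≡G ∘ (inside ∷_)))

  ∑ˢ-nonneg : ∀ n {F : Subset n → ℚ} → (∀ p → 0ℚ ≤ F p) → 0ℚ ≤ ∑ˢ n F
  ∑ˢ-nonneg n 0≤F = ℚ.≤-trans (ℚ.≤-reflexive (sym (∑ˢ-zero n))) (∑ˢ-mono n 0≤F)

  ∑ˢ-distrib-+ : ∀ n (F G : Subset n → ℚ) → ∑ˢ n (λ p → F p + G p) ≡ ∑ˢ n F + ∑ˢ n G
  ∑ˢ-distrib-+ zero    F G = refl
  ∑ˢ-distrib-+ (suc n) F G = trans
    (cong₂ _+_ (∑ˢ-distrib-+ n (F ∘ (outside ∷_)) (G ∘ (outside ∷_))) (∑ˢ-distrib-+ n (F ∘ (inside ∷_)) (G ∘ (inside ∷_))))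
    (regroup (∑ˢ n (F ∘ (outside ∷_))) (∑ˢ n (G ∘ (outside ∷_))) (∑ˢ n (F ∘ (inside ∷_))) (∑ˢ n (G ∘ (inside ∷_))))
    where
    regroup : ∀ a b c d → a + b + (c + d) ≡ a + c + (b + d)
    regroup = solve-∀ ℚ-ring

  ∑ˢ-*ˡ : ∀ n c (F : Subset n → ℚ) → ∑ˢ n (λ p → c * F p) ≡ c * ∑ˢ n F
  ∑ˢ-*ˡ zero    c F = refl
  ∑ˢ-*ˡ (suc n) c F = trans (cong₂ _+_ (∑ˢ-*ˡ n c (F ∘ (outside ∷_))) (∑ˢ-*ˡ n c (F ∘ (inside ∷_))))
    (sym (ℚ.*-distribˡ-+ c (∑ˢ n (F ∘ (outside ∷_))) (∑ˢ n (F ∘ (inside ∷_)))))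

  ∑ˢ-sum : ∀ n {k} (F : Subset n → Fin k → ℚ) → ∑ˢ n (λ p → sum (F p)) ≡ sum (λ i → ∑ˢ n (λ p → F p i))
  ∑ˢ-sum n {zero}  F = ∑ˢ-zero n
  ∑ˢ-sum n {suc k} F = trans (∑ˢ-distrib-+ n (λ p → F p zero) (λ p → sum (F p ∘ suc)))
    (cong (∑ˢ n (λ p → F p zero) +_) (∑ˢ-sum n (λ p → F p ∘ suc)))

  -- Erasing `x` is injective on the sets that contain `x`, so every value of `h` is used at most
  -- once on the left.
  ∑ˢ-erase : ∀ n x {h : Subset n → ℚ} → (∀ p → 0ℚ ≤ h p) →
             ∑ˢ n (λ p → χ p x * h (p [ x ]≔ outside)) ≤ ∑ˢ n h
  ∑ˢ-erase (suc n) zero {h} 0≤h = begin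
    ∑ˢ n (λ p → 0ℚ * h (outside ∷ p)) + ∑ˢ n (λ p → 1ℚ * h (outside ∷ p))
      ≡⟨ cong₂ _+_ (∑ˢ-*ˡ n 0ℚ (h ∘ (outside ∷_))) (∑ˢ-*ˡ n 1ℚ (h ∘ (outside ∷_))) ⟩
    0ℚ * ∑ˢ n (h ∘ (outside ∷_)) + 1ℚ * ∑ˢ n (h ∘ (outside ∷_))
      ≡⟨ regroup (∑ˢ n (h ∘ (outside ∷_))) ⟩
    ∑ˢ n (h ∘ (outside ∷_)) + 0ℚ
      ≤⟨ ℚ.+-monoʳ-≤ (∑ˢ n (h ∘ (outside ∷_))) (∑ˢ-nonneg n (0≤h ∘ (inside ∷_))) ⟩
    ∑ˢ n (h ∘ (outside ∷_)) + ∑ˢ n (h ∘ (inside ∷_))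
      ∎
    where
    regroup : ∀ a → 0ℚ * a + 1ℚ * a ≡ a + 0ℚ
    regroup = solve-∀ ℚ-ring
  ∑ˢ-erase (suc n) (suc x) 0≤h =
    ℚ.+-mono-≤ (∑ˢ-erase n x (0≤h ∘ (outside ∷_))) (∑ˢ-erase n x (0≤h ∘ (inside ∷_)))

  ι-length-filter-subsets : ∀ n {P : Subset n → Set} (P? : ∀ p → Dec (P p)) →
                            ι (length (filter P? (subsets n))) ≡ ∑ˢ n (λ p → 𝟙 (P? p))
  ι-length-filter-subsets zero    P? with does (P? [])
  ... | true  = refl
  ... | false = refl
  ι-length-filter-subsets (suc n) P? = begin-equality
    ι (length (filter P? (List.map (outside ∷_) (subsets n) List.++ List.map (inside ∷_) (subsets n))))
      ≡⟨ cong (ι ∘ length) (List.filter-++ P? (List.map (outside ∷_) (subsets n)) (List.map (inside ∷_) (subsets n))) ⟩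
    ι (length (filter P? (List.map (outside ∷_) (subsets n)) List.++ filter P? (List.map (inside ∷_) (subsets n))))
      ≡⟨ cong ι (List.length-++ (filter P? (List.map (outside ∷_) (subsets n)))) ⟩
    ι (length (filter P? (List.map (outside ∷_) (subsets n))) ℕ.+ length (filter P? (List.map (inside ∷_) (subsets n))))
      ≡⟨ ι-+ (length (filter P? (List.map (outside ∷_) (subsets n)))) (length (filter P? (List.map (inside ∷_) (subsets n)))) ⟩
    ι (length (filter P? (List.map (outside ∷_) (subsets n)))) + ι (length (filter P? (List.map (inside ∷_) (subsets n))))
      ≡⟨ cong₂ (λ a b → ι a + ι b) (length-filter-map outside (subsets n)) (length-filter-map inside (subsets n)) ⟩
    ι (length (filter (P? ∘ (outside ∷_)) (subsets n))) + ι (length (filter (P? ∘ (inside ∷_)) (subsets n)))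
      ≡⟨ cong₂ _+_ (ι-length-filter-subsets n (P? ∘ (outside ∷_))) (ι-length-filter-subsets n (P? ∘ (inside ∷_))) ⟩
    ∑ˢ n (λ p → 𝟙 (P? (outside ∷ p))) + ∑ˢ n (λ p → 𝟙 (P? (inside ∷ p)))
      ∎
    where
    length-filter-map : ∀ b ps → length (filter P? (List.map (b ∷_) ps)) ≡ length (filter (P? ∘ (b ∷_)) ps)
    length-filter-map b []       = refl
    length-filter-map b (p ∷ ps) with does (P? (b ∷ p))
    ... | true  = cong suc (length-filter-map b ps)
    ... | false = length-filter-map b ps

-- The product of the bounds c and its asymptotics.

module Factors (κ : Data.Rational.ℚ) where
  open import Data.Rational
  open RationalArithmetic

  factor : ℕ → ℚ
  factor r = 1ℚ + κ * (ι r * ι r)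

  factors : ℕ → ℚ
  factors zero    = 1ℚ
  factors (suc r) = factor (suc r) * factors r

module Asymptotics where
  open import Data.Rational
  open RationalArithmetic
  open Factors
  open ℚ.≤-Reasoning

  1/suc : ℕ → ℚ
  1/suc k = (ℤ.+ 1) / suc k

  0≤1/suc : ∀ k → 0ℚ ≤ 1/suc k
  0≤1/suc k = 0≤+/ 1 k

  ι-*-1/suc : ∀ j k → ι j * 1/suc k ≡ (ℤ.+ j) / suc k
  ι-*-1/suc zero    k = trans (ℚ.*-zeroˡ (1/suc k)) (sym (ℚ.fromℚᵘ-cong {ℚᵘ.mkℚᵘ (ℤ.+ 0) k} {ℚᵘ.0ℚᵘ} (ℚᵘ.*≡* refl)))
  ι-*-1/suc (suc j) k = begin-equality
    ι (suc j) * 1/suc k               ≡⟨ cong (_* 1/suc k) (ι-suc j) ⟩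
    (1ℚ + ι j) * 1/suc k              ≡⟨ expand (ι j) (1/suc k) ⟩
    ι j * 1/suc k + 1/suc k           ≡⟨ cong (_+ 1/suc k) (ι-*-1/suc j k) ⟩
    (ℤ.+ j) / suc k + 1/suc k         ≡⟨ suc-/ j k ⟨
    (ℤ.+ suc j) / suc k               ∎
    where
    expand : ∀ a b → (1ℚ + a) * b ≡ a * b + b
    expand = solve-∀ ℚ-ring

  suc*1/suc : ∀ k → ι (suc k) * 1/suc k ≡ 1ℚ
  suc*1/suc k = trans (ι-*-1/suc (suc k) k)
    (ℚ.fromℚᵘ-cong {ℚᵘ.mkℚᵘ (ℤ.+ suc k) k} {ℚᵘ.1ℚᵘ} (ℚᵘ.*≡* (ℤ.*-comm (ℤ.+ suc k) (ℤ.+ 1))))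

  1/suc≤1 : ∀ k → 1/suc k ≤ 1ℚ
  1/suc≤1 k = begin
    1/suc k                  ≡⟨ ℚ.*-identityˡ (1/suc k) ⟨
    1ℚ * 1/suc k             ≤⟨ *-monoˡ (0≤1/suc k) (1≤ι k) ⟩
    ι (suc k) * 1/suc k      ≡⟨ suc*1/suc k ⟩
    1ℚ                       ∎

  1/nonZero : ∀ m .{{_ : ℕ.NonZero m}} → ι m * ((ℤ.+ 1) / m) ≡ 1ℚ
  1/nonZero (suc m) = suc*1/suc m

  invFact-suc : ∀ n → invFact n ≡ ι (suc n) * invFact (suc n)
  invFact-suc n = begin-equality
    invFact n                                                   ≡⟨ ℚ.*-identityˡ (invFact n) ⟨
    1ℚ * invFact n                                              ≡⟨ cong (_* invFact n) (1/nonZero (suc n !) {{suc n ℕ.!≢0}}) ⟨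
    ι (suc n !) * invFact (suc n) * invFact n                   ≡⟨ cong (λ a → a * invFact (suc n) * invFact n) (ι-* (suc n) (n !)) ⟩
    ι (suc n) * ι (n !) * invFact (suc n) * invFact n           ≡⟨ regroup (ι (suc n)) (ι (n !)) (invFact (suc n)) (invFact n) ⟩
    ι (suc n) * invFact (suc n) * (ι (n !) * invFact n)         ≡⟨ cong (ι (suc n) * invFact (suc n) *_) (1/nonZero (n !) {{n ℕ.!≢0}}) ⟩
    ι (suc n) * invFact (suc n) * 1ℚ                            ≡⟨ ℚ.*-identityʳ (ι (suc n) * invFact (suc n)) ⟩
    ι (suc n) * invFact (suc n)                                 ∎
    where
    regroup : ∀ a b c d → a * b * c * d ≡ a * c * (b * d)
    regroup = solve-∀ ℚ-ring

  -- The exponential series cut off after `N` terms. Differentiation drops a term: the derivative of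
  -- `expPoly (suc N)` is `expPoly N`.
  expPoly : ℕ → ℚ → ℚ
  expPoly zero    x = 0ℚ
  expPoly (suc N) x = expPoly N x + x ^ N * invFact N

  expPoly-1 : ∀ N → expPoly N 1ℚ ≡ expSum N
  expPoly-1 zero    = refl
  expPoly-1 (suc N) = cong₂ _+_ (expPoly-1 N) (trans (cong (_* invFact N) (1^ N)) (ℚ.*-identityˡ (invFact N)))

  expPoly-0 : ∀ N → expPoly (suc N) 0ℚ ≡ 1ℚ
  expPoly-0 zero    = refl
  expPoly-0 (suc N) = trans (cong₂ _+_ (expPoly-0 N)
    (trans (cong (_* invFact (suc N)) (ℚ.*-zeroˡ (0ℚ ^ N))) (ℚ.*-zeroˡ (invFact (suc N))))) (ℚ.+-identityʳ 1ℚ)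

  -- The left side is the tangent at x + y, evaluated at x, and the series is convex. Term by term
  -- this is `^-tangent` divided by a factorial.
  expPoly-shift : ∀ N x y → 0ℚ ≤ x → 0ℚ ≤ y →
                  expPoly (suc N) (x + y) - y * expPoly N (x + y) ≤ expPoly (suc N) x
  expPoly-shift zero    x y 0≤x 0≤y = ℚ.≤-reflexive (drop y)
    where
    drop : ∀ y → 0ℚ + 1ℚ * 1ℚ - y * 0ℚ ≡ 0ℚ + 1ℚ * 1ℚ
    drop = solve-∀ ℚ-ring
  expPoly-shift (suc N) x y 0≤x 0≤y = begin
    expPoly (suc N) z + z ^ suc N * f′ - y * (expPoly N z + z ^ N * invFact N)
      ≡⟨ cong (λ f → expPoly (suc N) z + z ^ suc N * f′ - y * (expPoly N z + z ^ N * f)) (invFact-suc N) ⟩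
    expPoly (suc N) z + z ^ suc N * f′ - y * (expPoly N z + z ^ N * (ι (suc N) * f′))
      ≡⟨ regroup (expPoly (suc N) z) (expPoly N z) (z ^ N) (ι (suc N)) f′ x y ⟩
    (expPoly (suc N) z - y * expPoly N z) + (z ^ suc N + ι (suc N) * (z ^ N * (x - z))) * f′
      ≤⟨ ℚ.+-mono-≤ (expPoly-shift N x y 0≤x 0≤y) (*-monoˡ (ExpLemmas.0≤invFact (suc N)) (^-tangent N (+-nonneg 0≤x 0≤y) 0≤x)) ⟩
    expPoly (suc N) x + x ^ suc N * f′
      ∎
    where
    z f′ : ℚ
    z  = x + y
    f′ = invFact (suc N)
    regroup : ∀ e e′ p r f x y →
      e + (x + y) * p * f - y * (e′ + p * (r * f)) ≡
      (e - y * e′) + ((x + y) * p + r * (p * (x - (x + y)))) * f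
    regroup = solve-∀ ℚ-ring

  -- The truncated form of e^(x+y) (1 - y) ≤ e^x. Using the longer series in the subtracted term as
  -- well only lowers the left side of `expPoly-shift`.
  expPoly-decay : ∀ N x y → 0ℚ ≤ x → 0ℚ ≤ y → expPoly (suc N) (x + y) * (1ℚ - y) ≤ expPoly (suc N) x
  expPoly-decay N x y 0≤x 0≤y = ℚ.≤-trans
    (≤-byDifference (y * (z ^ N * invFact N)) (*-nonneg 0≤y (*-nonneg (^-nonneg N (+-nonneg 0≤x 0≤y)) (ExpLemmas.0≤invFact N)))
      (regroup (expPoly N z) (z ^ N * invFact N) y))
    (expPoly-shift N x y 0≤x 0≤y)
    where
    z : ℚ
    z = x + y
    regroup : ∀ e t y → (e + t) * (1ℚ - y) + y * t ≡ e + t - y * e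
    regroup = solve-∀ ℚ-ring

  -- Walks from 0 to iu in steps of u. At u = 1/(k+1) and i = k+1 it reads e (k/(k+1))^(k+1) ≤ 1,
  -- with a partial sum for e.
  expPoly-multiples : ∀ N i {u} → 0ℚ ≤ u → u ≤ 1ℚ → expPoly (suc N) (ι i * u) * (1ℚ - u) ^ i ≤ 1ℚ
  expPoly-multiples N zero    {u} 0≤u u≤1 = ℚ.≤-reflexive (trans (ℚ.*-identityʳ (expPoly (suc N) (0ℚ * u)))
    (trans (cong (expPoly (suc N)) (ℚ.*-zeroˡ u)) (expPoly-0 N)))
  expPoly-multiples N (suc i) {u} 0≤u u≤1 = begin
    expPoly (suc N) (ι (suc i) * u) * ((1ℚ - u) * (1ℚ - u) ^ i)
      ≡⟨ cong (λ x → expPoly (suc N) x * ((1ℚ - u) * (1ℚ - u) ^ i)) (trans (cong (_* u) (ι-suc i)) (expand (ι i) u)) ⟩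
    expPoly (suc N) (ι i * u + u) * ((1ℚ - u) * (1ℚ - u) ^ i)
      ≡⟨ ℚ.*-assoc (expPoly (suc N) (ι i * u + u)) (1ℚ - u) ((1ℚ - u) ^ i) ⟨
    expPoly (suc N) (ι i * u + u) * (1ℚ - u) * (1ℚ - u) ^ i
      ≤⟨ *-monoˡ (^-nonneg i (p≤q⇒0≤q-p u≤1)) (expPoly-decay N (ι i * u) u (*-nonneg (0≤ι i) 0≤u) 0≤u) ⟩
    expPoly (suc N) (ι i * u) * (1ℚ - u) ^ i
      ≤⟨ expPoly-multiples N i 0≤u u≤1 ⟩
    1ℚ
      ∎
    where
    expand : ∀ i u → (1ℚ + i) * u ≡ i * u + u
    expand = solve-∀ ℚ-ring

  -- e ≤ (1 + 1/k)^(k+1)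
  e*k^[k+1]≤[k+1]^[k+1] : ∀ N k → expSum (suc N) * ι k ^ suc k ≤ ι (suc k) ^ suc k
  e*k^[k+1]≤[k+1]^[k+1] N k = begin
    expSum (suc N) * ι k ^ q                                  ≡⟨ cong₂ (λ a b → a * b ^ q) (trans (cong (expPoly (suc N)) (suc*1/suc k)) (expPoly-1 (suc N))) q[1-u]≡k ⟨
    expPoly (suc N) (ι q * u) * (ι q * (1ℚ - u)) ^ q          ≡⟨ cong (expPoly (suc N) (ι q * u) *_) (^-distrib-* (ι q) (1ℚ - u) q) ⟩
    expPoly (suc N) (ι q * u) * (ι q ^ q * (1ℚ - u) ^ q)      ≡⟨ *-swap (expPoly (suc N) (ι q * u)) (ι q ^ q) ((1ℚ - u) ^ q) ⟩
    ι q ^ q * (expPoly (suc N) (ι q * u) * (1ℚ - u) ^ q)      ≤⟨ *-monoʳ (^-nonneg q (0≤ι q)) (expPoly-multiples N q (0≤1/suc k) (1/suc≤1 k)) ⟩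
    ι q ^ q * 1ℚ                                              ≡⟨ ℚ.*-identityʳ (ι q ^ q) ⟩
    ι q ^ q                                                   ∎
    where
    q : ℕ
    q = suc k
    u : ℚ
    u = 1/suc k
    q[1-u]≡k : ι q * (1ℚ - u) ≡ ι k
    q[1-u]≡k = begin-equality
      ι q * (1ℚ - u)         ≡⟨ expand (ι q) u ⟩
      ι q - ι q * u          ≡⟨ cong₂ _-_ (ι-suc k) (suc*1/suc k) ⟩
      1ℚ + ι k - 1ℚ          ≡⟨ cancel (ι k) ⟩
      ι k                    ∎
      where
      expand : ∀ a u → a * (1ℚ - u) ≡ a - a * u
      expand = solve-∀ ℚ-ring
      cancel : ∀ a → 1ℚ + a - 1ℚ ≡ a
      cancel = solve-∀ ℚ-ring

  -- The rising factorial a (a+1) ... (a+m-1).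
  rising : ℕ → ℕ → ℚ
  rising a zero    = 1ℚ
  rising a (suc m) = ι (a ℕ.+ m) * rising a m

  rising-nonneg : ∀ a m → 0ℚ ≤ rising a m
  rising-nonneg a zero    = 0≤1
  rising-nonneg a (suc m) = *-nonneg (0≤ι (a ℕ.+ m)) (rising-nonneg a m)

  0≤expSum : ∀ N → 0ℚ ≤ expSum N
  0≤expSum N = ExpLemmas.expSum-mono (ℕ.≤⇒≤′ (ℕ.z≤n {N}))

  -- The inequalities e k ≤ (k+1)^(k+1) / k^k for k from a to a+m-1 telescope. This is the part of
  -- Stirling's estimate that is needed, with a^a multiplied out.
  rising-bound : ∀ N a m → rising a m * (ι a ^ a * expSum (suc N) ^ m) ≤ ι (a ℕ.+ m) ^ (a ℕ.+ m)
  rising-bound N a zero = ℚ.≤-reflexive (trans (unit (ι a ^ a)) (cong (λ k → ι k ^ k) (sym (ℕ.+-identityʳ a))))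
    where
    unit : ∀ p → 1ℚ * (p * 1ℚ) ≡ p
    unit = solve-∀ ℚ-ring
  rising-bound N a (suc m) = begin
    ι k * rising a m * (ι a ^ a * (e * e ^ m))       ≡⟨ regroup (ι k) (rising a m) (ι a ^ a) e (e ^ m) ⟩
    e * ι k * (rising a m * (ι a ^ a * e ^ m))       ≤⟨ *-monoʳ (*-nonneg (0≤expSum (suc N)) (0≤ι k)) (rising-bound N a m) ⟩
    e * ι k * ι k ^ k                                ≡⟨ ℚ.*-assoc e (ι k) (ι k ^ k) ⟩
    e * ι k ^ suc k                                  ≤⟨ e*k^[k+1]≤[k+1]^[k+1] N k ⟩
    ι (suc k) ^ suc k                                ≡⟨ cong (λ k → ι k ^ k) (ℕ.+-suc a m) ⟨
    ι (a ℕ.+ suc m) ^ (a ℕ.+ suc m)                  ∎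
    where
    k : ℕ
    k = a ℕ.+ m
    e : ℚ
    e = expSum (suc N)
    regroup : ∀ k r p e q → k * r * (p * (e * q)) ≡ e * k * (r * (p * q))
    regroup = solve-∀ ℚ-ring

  -- The shift by s absorbs the summand 1: κs² ≥ 1 gives 1 + κr² ≤ κ(s+r)², and the numbers s + r
  -- for r from 1 to m form a rising factorial.
  factors≤rising² : ∀ {κ} → 0ℚ ≤ κ → ∀ s → 1ℚ ≤ κ * (ι s * ι s) → ∀ m →
                    factors κ m ≤ κ ^ m * (rising (suc s) m * rising (suc s) m)
  factors≤rising² 0≤κ s 1≤κs² zero    = ℚ.≤-refl
  factors≤rising² {κ} 0≤κ s 1≤κs² (suc m) = begin
    (1ℚ + κ * (ι r * ι r)) * factors κ m
      ≤⟨ *-mono (+-nonneg 0≤1 (*-nonneg 0≤κ (square-nonneg (ι r)))) (*-nonneg (^-nonneg m 0≤κ) (square-nonneg R)) factor≤ (factors≤rising² 0≤κ s 1≤κs² m) ⟩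
    κ * (ι (suc s ℕ.+ m) * ι (suc s ℕ.+ m)) * (κ ^ m * (R * R))
      ≡⟨ regroup κ (ι (suc s ℕ.+ m)) (κ ^ m) R ⟩
    κ * κ ^ m * (ι (suc s ℕ.+ m) * R * (ι (suc s ℕ.+ m) * R))
      ∎
    where
    r : ℕ
    r = suc m
    R : ℚ
    R = rising (suc s) m
    regroup : ∀ k t p R → k * (t * t) * (p * (R * R)) ≡ k * p * (t * R * (t * R))
    regroup = solve-∀ ℚ-ring
    factor≤ : 1ℚ + κ * (ι r * ι r) ≤ κ * (ι (suc s ℕ.+ m) * ι (suc s ℕ.+ m))
    factor≤ = begin
      1ℚ + κ * (ι r * ι r)                           ≤⟨ ℚ.+-monoˡ-≤ (κ * (ι r * ι r)) 1≤κs² ⟩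
      κ * (ι s * ι s) + κ * (ι r * ι r)              ≤⟨ ≤-byDifference (κ * (ι s * ι r + ι s * ι r))
                                                          (*-nonneg 0≤κ (+-nonneg (*-nonneg (0≤ι s) (0≤ι r)) (*-nonneg (0≤ι s) (0≤ι r))))
                                                          (square κ (ι s) (ι r)) ⟩
      κ * ((ι s + ι r) * (ι s + ι r))                ≡⟨ cong (λ t → κ * (t * t)) (trans (sym (ι-+ s r)) (cong ι (ℕ.+-suc s m))) ⟩
      κ * (ι (suc s ℕ.+ m) * ι (suc s ℕ.+ m))        ∎
      where
      square : ∀ k a b → k * (a * a) + k * (b * b) + k * (a * b + a * b) ≡ k * ((a + b) * (a + b))
      square = solve-∀ ℚ-ring

  -- With m ≈ j⁴ and a ≈ j², the quotient (a+m)^(a+m) / a^a exceeds m^m only by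
  -- the m-th power of a factor that tends to 1.
  module Scale (i m : ℕ) (j⁴≤m : suc i ℕ.^ 4 ℕ.≤ m) (m<[j+1]⁴ : m ℕ.< suc (suc i) ℕ.^ 4) where
    j s a : ℕ
    j = suc i
    -- (j+1)⁴ > m makes s² at least m, and κs² ≥ κm = 3/2 is then more than `factors≤rising²` asks
    -- for.
    s = suc j ℕ.* suc j
    a = suc s

    u g : ℚ
    u = 1/suc i
    g = 1ℚ + u

    1≤g : 1ℚ ≤ g
    1≤g = ≤-byDifference u (0≤1/suc i) refl

    0≤g : 0ℚ ≤ g
    0≤g = ℚ.≤-trans 0≤1 1≤g

    m≤s*s : m ℕ.≤ s ℕ.* s
    m≤s*s = ℕ.≤-trans (ℕ.<⇒≤ m<[j+1]⁴) (ℕ.≤-reflexive (fourth (suc j)))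
      where
      fourth : ∀ k → k ℕ.* (k ℕ.* (k ℕ.* (k ℕ.* 1))) ≡ k ℕ.* k ℕ.* (k ℕ.* k)
      fourth = ℕ-Solver.solve-∀

    j⁴ : j ℕ.* j ℕ.* (j ℕ.* j) ℕ.≤ m
    j⁴ = ℕ.≤-trans (ℕ.≤-reflexive (fourth j)) j⁴≤m
      where
      fourth : ∀ k → k ℕ.* k ℕ.* (k ℕ.* k) ≡ k ℕ.* (k ℕ.* (k ℕ.* (k ℕ.* 1)))
      fourth = ℕ-Solver.solve-∀

    -- The constant 5 is the value of a at j = 1.
    a≤5j² : a ℕ.≤ 5 ℕ.* (j ℕ.* j)
    a≤5j² = ℕ.≤-trans (ℕ.m≤m+n a (4 ℕ.* (i ℕ.* i) ℕ.+ 6 ℕ.* i)) (ℕ.≤-reflexive (identity i))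
      where
      identity : ∀ i → suc ((2 ℕ.+ i) ℕ.* (2 ℕ.+ i)) ℕ.+ (4 ℕ.* (i ℕ.* i) ℕ.+ 6 ℕ.* i) ≡ 5 ℕ.* ((1 ℕ.+ i) ℕ.* (1 ℕ.+ i))
      identity = ℕ-Solver.solve-∀

    5j²≤[j+1]³ : 5 ℕ.* (j ℕ.* j) ℕ.≤ suc j ℕ.^ 3
    5j²≤[j+1]³ = ℕ.≤-trans (ℕ.m≤m+n (5 ℕ.* (j ℕ.* j)) (i ℕ.* i ℕ.* i ℕ.+ i ℕ.* i ℕ.+ 2 ℕ.* i ℕ.+ 3)) (ℕ.≤-reflexive (identity i))
      where
      identity : ∀ i → 5 ℕ.* ((1 ℕ.+ i) ℕ.* (1 ℕ.+ i)) ℕ.+ (i ℕ.* i ℕ.* i ℕ.+ i ℕ.* i ℕ.+ 2 ℕ.* i ℕ.+ 3) ≡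
                       (2 ℕ.+ i) ℕ.* ((2 ℕ.+ i) ℕ.* ((2 ℕ.+ i) ℕ.* 1))
      identity = ℕ-Solver.solve-∀

    a+m≤a*a : a ℕ.+ m ℕ.≤ a ℕ.* a
    a+m≤a*a = ℕ.≤-trans (ℕ.+-monoʳ-≤ a m≤s*s)
      (ℕ.≤-trans (ℕ.m≤m+n (a ℕ.+ s ℕ.* s) s) (ℕ.≤-reflexive (identity s)))
      where
      identity : ∀ s → suc s ℕ.+ s ℕ.* s ℕ.+ s ≡ suc s ℕ.* suc s
      identity = ℕ-Solver.solve-∀

    a*j≤5m : a ℕ.* j ℕ.≤ 5 ℕ.* m
    a*j≤5m = ℕ.≤-trans (ℕ.*-mono-≤ a≤5j² (ℕ.m≤m*n j j))
      (ℕ.≤-trans (ℕ.≤-reflexive (ℕ.*-assoc 5 (j ℕ.* j) (j ℕ.* j))) (ℕ.*-monoʳ-≤ 5 j⁴))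

    2≤g^j : 1ℚ + 1ℚ ≤ g ^ j
    2≤g^j = ℚ.≤-trans (ℚ.≤-reflexive (cong (1ℚ +_) (sym (suc*1/suc i)))) (bernoulli j (0≤1/suc i))

    suc-j≤g^[j*j] : ι (suc j) ≤ g ^ (j ℕ.* j)
    suc-j≤g^[j*j] = begin
      ι (suc j)               ≡⟨ trans (ι-suc j) (cong (1ℚ +_) (sym (ℚ.*-identityʳ (ι j)))) ⟩
      1ℚ + ι j * 1ℚ           ≤⟨ bernoulli j 0≤1 ⟩
      (1ℚ + 1ℚ) ^ j           ≤⟨ ^-mono j (+-nonneg 0≤1 0≤1) 2≤g^j ⟩
      (g ^ j) ^ j             ≡⟨ ^-assocʳ g j j ⟩
      g ^ (j ℕ.* j)           ∎

    -- Only the order of the exponent matters: a power of g with exponent of order j², raised to the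
    -- a-th power with a of order j², has exponent of order j⁴, hence of order m.
    a≤g^ : ι a ≤ g ^ (j ℕ.* j ℕ.* 3)
    a≤g^ = begin
      ι a                         ≤⟨ ι-mono-≤ (ℕ.≤-trans a≤5j² 5j²≤[j+1]³) ⟩
      ι (suc j ℕ.^ 3)             ≡⟨ ι-^ (suc j) 3 ⟩
      ι (suc j) ^ 3               ≤⟨ ^-mono 3 (0≤ι (suc j)) suc-j≤g^[j*j] ⟩
      (g ^ (j ℕ.* j)) ^ 3         ≡⟨ ^-assocʳ g (j ℕ.* j) 3 ⟩
      g ^ (j ℕ.* j ℕ.* 3)         ∎

    3j²a≤15m : j ℕ.* j ℕ.* 3 ℕ.* a ℕ.≤ 15 ℕ.* m
    3j²a≤15m = ℕ.≤-trans (ℕ.*-monoʳ-≤ (j ℕ.* j ℕ.* 3) a≤5j²)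
      (ℕ.≤-trans (ℕ.≤-reflexive (regroup (j ℕ.* j))) (ℕ.*-monoʳ-≤ 15 j⁴))
      where
      regroup : ∀ q → q ℕ.* 3 ℕ.* (5 ℕ.* q) ≡ 15 ℕ.* (q ℕ.* q)
      regroup = ℕ-Solver.solve-∀

    a^a≤g^15m : ι a ^ a ≤ (g ^ 15) ^ m
    a^a≤g^15m = begin
      ι a ^ a                             ≤⟨ ^-mono a (0≤ι a) a≤g^ ⟩
      (g ^ (j ℕ.* j ℕ.* 3)) ^ a           ≡⟨ ^-assocʳ g (j ℕ.* j ℕ.* 3) a ⟩
      g ^ (j ℕ.* j ℕ.* 3 ℕ.* a)           ≤⟨ ^-monoʳ 1≤g 3j²a≤15m ⟩
      g ^ (15 ℕ.* m)                      ≡⟨ ^-assocʳ g 15 m ⟨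
      (g ^ 15) ^ m                        ∎

    -- The ratio a/m is at most 5/j = 5u, and 1 + 5u ≤ g⁵ by Bernoulli.
    a+m≤mg⁵ : ι (a ℕ.+ m) ≤ ι m * g ^ 5
    a+m≤mg⁵ = begin
      ι (a ℕ.+ m)                    ≡⟨ ι-+ a m ⟩
      ι a + ι m                      ≡⟨ cong (_+ ι m) (trans (sym (ℚ.*-identityʳ (ι a))) (cong (ι a *_) (sym (suc*1/suc i)))) ⟩
      ι a * (ι j * u) + ι m          ≡⟨ cong (_+ ι m) (trans (sym (ℚ.*-assoc (ι a) (ι j) u)) (cong (_* u) (sym (ι-* a j)))) ⟩
      ι (a ℕ.* j) * u + ι m          ≤⟨ ℚ.+-monoˡ-≤ (ι m) (*-monoˡ (0≤1/suc i) (ι-mono-≤ a*j≤5m)) ⟩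
      ι (5 ℕ.* m) * u + ι m          ≡⟨ cong (λ b → b * u + ι m) (ι-* 5 m) ⟩
      ι 5 * ι m * u + ι m            ≡⟨ factorOut (ι 5) (ι m) u ⟩
      ι m * (1ℚ + ι 5 * u)           ≤⟨ *-monoʳ (0≤ι m) (bernoulli 5 (0≤1/suc i)) ⟩
      ι m * g ^ 5                    ∎
      where
      factorOut : ∀ c m u → c * m * u + m ≡ m * (1ℚ + c * u)
      factorOut = solve-∀ ℚ-ring

    -- Of the a+m factors, a are bounded by a²: one a^a is kept for cancellation, the other costs
    -- g^(15m). The remaining m factors cost g⁵ each, and 15 + 5 = 20.
    [a+m]^[a+m]≤ : ι (a ℕ.+ m) ^ (a ℕ.+ m) ≤ ι a ^ a * (ι m * g ^ 20) ^ m
    [a+m]^[a+m]≤ = begin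
      ι (a ℕ.+ m) ^ (a ℕ.+ m)                              ≡⟨ ^-homo-* (ι (a ℕ.+ m)) a m ⟩
      ι (a ℕ.+ m) ^ a * ι (a ℕ.+ m) ^ m                    ≤⟨ *-mono (^-nonneg a (0≤ι (a ℕ.+ m))) (^-nonneg m (*-nonneg (0≤ι m) (^-nonneg 5 0≤g)))
                                                                (^-mono a (0≤ι (a ℕ.+ m)) (ℚ.≤-trans (ι-mono-≤ a+m≤a*a) (ℚ.≤-reflexive (ι-* a a))))
                                                                (^-mono m (0≤ι (a ℕ.+ m)) a+m≤mg⁵) ⟩
      (ι a * ι a) ^ a * (ι m * g ^ 5) ^ m                  ≡⟨ cong (_* (ι m * g ^ 5) ^ m) (^-distrib-* (ι a) (ι a) a) ⟩
      ι a ^ a * ι a ^ a * (ι m * g ^ 5) ^ m                ≤⟨ *-monoˡ (^-nonneg m (*-nonneg (0≤ι m) (^-nonneg 5 0≤g)))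
                                                                (*-monoʳ (^-nonneg a (0≤ι a)) a^a≤g^15m) ⟩
      ι a ^ a * (g ^ 15) ^ m * (ι m * g ^ 5) ^ m           ≡⟨ ℚ.*-assoc (ι a ^ a) ((g ^ 15) ^ m) ((ι m * g ^ 5) ^ m) ⟩
      ι a ^ a * ((g ^ 15) ^ m * (ι m * g ^ 5) ^ m)         ≡⟨ cong (ι a ^ a *_) (^-distrib-* (g ^ 15) (ι m * g ^ 5) m) ⟨
      ι a ^ a * (g ^ 15 * (ι m * g ^ 5)) ^ m               ≡⟨ cong (λ b → ι a ^ a * b ^ m) (*-swap (g ^ 15) (ι m) (g ^ 5)) ⟩
      ι a ^ a * (ι m * (g ^ 15 * g ^ 5)) ^ m               ≡⟨ cong (λ b → ι a ^ a * (ι m * b) ^ m) (^-homo-* g 15 5) ⟨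
      ι a ^ a * (ι m * g ^ 20) ^ m                         ∎

    rising≤ : ∀ N → rising a m * expSum (suc N) ^ m ≤ (ι m * g ^ 20) ^ m
    rising≤ N = *-cancelˡ (ι a ^ a) (^-pos a (0<ι s)) (begin
      ι a ^ a * (rising a m * expSum (suc N) ^ m)       ≡⟨ *-swap (ι a ^ a) (rising a m) (expSum (suc N) ^ m) ⟩
      rising a m * (ι a ^ a * expSum (suc N) ^ m)       ≤⟨ rising-bound N a m ⟩
      ι (a ℕ.+ m) ^ (a ℕ.+ m)                           ≤⟨ [a+m]^[a+m]≤ ⟩
      ι a ^ a * (ι m * g ^ 20) ^ m                      ∎)

    -- Here y stands for 1/2e². Inserting 1 = (e · e · 2y)^m gives each of the two rising factorials
    -- its own e^m; they contribute g²⁰ each, hence g⁴⁰. What remains of the base is κm² · 2y =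
    -- (2mκ) m y = 3my.
    factors≤ : ∀ {κ} → 0ℚ ≤ κ → ι 2 * ι m * κ ≡ ι 3 → ∀ N y → 0ℚ ≤ y →
               ι 2 * (expSum (suc N) * (expSum (suc N) * 1ℚ)) * y ≡ 1ℚ →
               factors κ m ≤ (g ^ 40 * (ι (3 ℕ.* m) * y)) ^ m
    factors≤ {κ} 0≤κ 2mκ≡3 N y 0≤y 2e²y≡1 = begin
      factors κ m                                                             ≤⟨ factors≤rising² 0≤κ s 1≤κs² m ⟩
      κ ^ m * (Q * Q)                                                         ≡⟨ ℚ.*-identityʳ (κ ^ m * (Q * Q)) ⟨
      κ ^ m * (Q * Q) * 1ℚ                                                    ≡⟨ cong (κ ^ m * (Q * Q) *_) (1^ m) ⟨
      κ ^ m * (Q * Q) * 1ℚ ^ m                                                ≡⟨ cong (λ b → κ ^ m * (Q * Q) * b ^ m) (trans (rearrange e y) 2e²y≡1) ⟨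
      κ ^ m * (Q * Q) * (e * (e * (ι 2 * y))) ^ m                             ≡⟨ cong (κ ^ m * (Q * Q) *_) (trans (^-distrib-* e (e * (ι 2 * y)) m)
                                                                                   (cong (e ^ m *_) (^-distrib-* e (ι 2 * y) m))) ⟩
      κ ^ m * (Q * Q) * (e ^ m * (e ^ m * (ι 2 * y) ^ m))                     ≡⟨ regroup (κ ^ m) Q (e ^ m) ((ι 2 * y) ^ m) ⟩
      κ ^ m * (Q * e ^ m * (Q * e ^ m)) * (ι 2 * y) ^ m                       ≤⟨ *-monoˡ (^-nonneg m (*-nonneg (0≤ι 2) 0≤y)) (*-monoʳ (^-nonneg m 0≤κ)
                                                                                   (*-mono 0≤Qe (ℚ.≤-trans 0≤Qe (rising≤ N)) (rising≤ N) (rising≤ N))) ⟩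
      κ ^ m * (G ^ m * G ^ m) * (ι 2 * y) ^ m                                 ≡⟨ cong (_* (ι 2 * y) ^ m) (trans (cong (κ ^ m *_) (sym (^-distrib-* G G m))) (sym (^-distrib-* κ (G * G) m))) ⟩
      (κ * (G * G)) ^ m * (ι 2 * y) ^ m                                       ≡⟨ ^-distrib-* (κ * (G * G)) (ι 2 * y) m ⟨
      (κ * (G * G) * (ι 2 * y)) ^ m                                           ≡⟨ cong (_^ m) base ⟩
      (g ^ 40 * (ι (3 ℕ.* m) * y)) ^ m                                        ∎
      where
      e Q G : ℚ
      e = expSum (suc N)
      Q = rising a m
      G = ι m * g ^ 20
      0≤Qe : 0ℚ ≤ Q * e ^ m
      0≤Qe = *-nonneg (rising-nonneg a m) (^-nonneg m (0≤expSum (suc N)))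
      regroup : ∀ k q f h → k * (q * q) * (f * (f * h)) ≡ k * (q * f * (q * f)) * h
      regroup = solve-∀ ℚ-ring
      rearrange : ∀ e y → e * (e * (ι 2 * y)) ≡ ι 2 * (e * (e * 1ℚ)) * y
      rearrange e y = lemma (ι 2) e y
        where
        lemma : ∀ t e y → e * (e * (t * y)) ≡ t * (e * (e * 1ℚ)) * y
        lemma = solve-∀ ℚ-ring
      1≤κs² : 1ℚ ≤ κ * (ι s * ι s)
      1≤κs² = *-cancelˡ (ι 2) (0<ι 1) (begin
        ι 2 * 1ℚ                    ≡⟨ ℚ.*-identityʳ (ι 2) ⟩
        ι 2                         ≤⟨ ι-mono-≤ {2} {3} (ℕ.n≤1+n 2) ⟩
        ι 3                         ≡⟨ 2mκ≡3 ⟨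
        ι 2 * ι m * κ               ≡⟨ regroup′ (ι 2) (ι m) κ ⟩
        ι 2 * (κ * ι m)             ≤⟨ *-monoʳ (0≤ι 2) (*-monoʳ 0≤κ (ℚ.≤-trans (ι-mono-≤ m≤s*s) (ℚ.≤-reflexive (ι-* s s)))) ⟩
        ι 2 * (κ * (ι s * ι s))     ∎)
        where
        regroup′ : ∀ t m k → t * m * k ≡ t * (k * m)
        regroup′ = solve-∀ ℚ-ring
      base : κ * (G * G) * (ι 2 * y) ≡ g ^ 40 * (ι (3 ℕ.* m) * y)
      base = begin-equality
        κ * (ι m * g ^ 20 * (ι m * g ^ 20)) * (ι 2 * y)        ≡⟨ collect κ (ι m) (g ^ 20) (ι 2) y ⟩
        g ^ 20 * g ^ 20 * (ι 2 * ι m * κ * ι m * y)            ≡⟨ cong₂ (λ p q → p * (q * ι m * y)) (sym (^-homo-* g 20 20)) 2mκ≡3 ⟩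
        g ^ 40 * (ι 3 * ι m * y)                               ≡⟨ cong (λ p → g ^ 40 * (p * y)) (ι-* 3 m) ⟨
        g ^ 40 * (ι (3 ℕ.* m) * y)                             ∎
        where
        collect : ∀ k m p t y → k * (m * p * (m * p)) * (t * y) ≡ p * p * (t * m * k * m * y)
        collect = solve-∀ ℚ-ring

  -- A convex function on [0, 1] lies below its chord.
  [1+u]^k≤1+[2^k-1]u : ∀ k {u} → 0ℚ ≤ u → u ≤ 1ℚ → (1ℚ + u) ^ k ≤ 1ℚ + ((1ℚ + 1ℚ) ^ k - 1ℚ) * u
  [1+u]^k≤1+[2^k-1]u zero    {u} 0≤u u≤1 = ℚ.≤-reflexive (vanish u)
    where
    vanish : ∀ u → 1ℚ ≡ 1ℚ + (1ℚ - 1ℚ) * u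
    vanish = solve-∀ ℚ-ring
  [1+u]^k≤1+[2^k-1]u (suc k) {u} 0≤u u≤1 = begin
    (1ℚ + u) * (1ℚ + u) ^ k                      ≤⟨ *-monoʳ (+-nonneg 0≤1 0≤u) ([1+u]^k≤1+[2^k-1]u k 0≤u u≤1) ⟩
    (1ℚ + u) * (1ℚ + (p - 1ℚ) * u)               ≤⟨ ≤-byDifference ((p - 1ℚ) * (u * (1ℚ - u)))
                                                      (*-nonneg (p≤q⇒0≤q-p (1≤^ k 1≤2)) (*-nonneg 0≤u (p≤q⇒0≤q-p u≤1)))
                                                      (regroup p u) ⟩
    1ℚ + ((1ℚ + 1ℚ) * p - 1ℚ) * u                ∎
    where
    p : ℚ
    p = (1ℚ + 1ℚ) ^ k
    1≤2 : 1ℚ ≤ 1ℚ + 1ℚ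
    1≤2 = ≤-byDifference 1ℚ 0≤1 refl
    regroup : ∀ p u → (1ℚ + u) * (1ℚ + (p - 1ℚ) * u) + (p - 1ℚ) * (u * (1ℚ - u)) ≡ 1ℚ + ((1ℚ + 1ℚ) * p - 1ℚ) * u
    regroup = solve-∀ ℚ-ring

  [1+u]^k≤1+2^ku : ∀ k {u} → 0ℚ ≤ u → u ≤ 1ℚ → (1ℚ + u) ^ k ≤ 1ℚ + (1ℚ + 1ℚ) ^ k * u
  [1+u]^k≤1+2^ku k {u} 0≤u u≤1 = ℚ.≤-trans ([1+u]^k≤1+[2^k-1]u k 0≤u u≤1)
    (≤-byDifference u 0≤u (regroup ((1ℚ + 1ℚ) ^ k) u))
    where
    regroup : ∀ p u → 1ℚ + (p - 1ℚ) * u + u ≡ 1ℚ + p * u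
    regroup = solve-∀ ℚ-ring

  -- For m + 1 edges, suc (scale m) is the integer part of the fourth root of m + 1.
  scale-spec : ∀ m → ∃ λ i → suc i ℕ.^ 4 ℕ.≤ suc m × suc m ℕ.< suc (suc i) ℕ.^ 4
  scale-spec zero = 0 , ℕ.≤-refl , ℕ.s≤s (ℕ.s≤s ℕ.z≤n)
  scale-spec (suc m) with scale-spec m
  ... | i , lo , hi with suc (suc i) ℕ.^ 4 ℕ.≤? suc (suc m)
  ... | yes ≤m = suc i , ≤m , ℕ.≤-<-trans hi (ℕ.^-monoˡ-< 4 (ℕ.n<1+n (suc (suc i))))
  ... | no  ≰m = i , ℕ.m≤n⇒m≤1+n lo , ℕ.≰⇒> ≰m

  scale : ℕ → ℕ
  scale m = proj₁ (scale-spec m)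

  scale-unbounded : ∀ k m → suc k ℕ.^ 4 ℕ.≤ suc m → k ℕ.≤ scale m
  scale-unbounded k m ≤m with k ℕ.≤? scale m
  ... | yes k≤ = k≤
  ... | no  k≰ = contradiction (ℕ.<-≤-trans (proj₂ (proj₂ (scale-spec m)))
    (ℕ.≤-trans (ℕ.^-monoˡ-≤ 4 (ℕ.s≤s (ℕ.≰⇒> k≰))) ≤m)) (ℕ.<-irrefl refl)

-- The guessing game on a Steiner triple system.

module Greedy {n} (H : Hypergraph n) (sts : IsSteinerTripleSystem H) where
  open import Data.Rational
  open RationalArithmetic
  open Indicators
  open IsSteinerTripleSystem sts
  open ℚ.≤-Reasoning

  E : Fin (size H) → Fin n → ℚ
  E f = χ (edge H f)

  E-indicates : ∀ f v → Indicates (v ∈ edge H f) (E f v)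
  E-indicates f = χ-indicates (edge H f)

  0≤E : ∀ f v → 0ℚ ≤ E f v
  0≤E f v = ind-nonneg (E-indicates f v)

  sum-E : ∀ f → sum (E f) ≡ ι 3
  sum-E f = trans (sym (ι∣∣ (edge H f))) (cong ι (uniform f))

  common-pair : ∀ {u v e f} → u ≢ v → u ∈ edge H e → v ∈ edge H e →
                u ∈ edge H f → v ∈ edge H f → e ≡ f
  common-pair u≢v u∈e v∈e u∈f v∈f with _ , _ , unique ← pairs _ _ u≢v =
    trans (sym (unique (u∈e , v∈e))) (unique (u∈f , v∈f))

  sum-meet≤1 : ∀ {e f} → e ≢ f → sum (λ v → E e v * E f v) ≤ 1ℚ
  sum-meet≤1 {e} {f} e≢f = sum-atMostOne (λ v → ind-× (E-indicates e v) (E-indicates f v)) unique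
    where
    unique : ∀ u v → u ∈ edge H e × u ∈ edge H f → v ∈ edge H e × v ∈ edge H f → u ≡ v
    unique u v (u∈e , u∈f) (v∈e , v∈f) with u Fin.≟ v
    ... | yes u≡v = u≡v
    ... | no  u≢v = contradiction (common-pair u≢v u∈e v∈e u∈f v∈f) e≢f

  -- Exact cover: `M` meets every vertex of `U` once and no vertex outside. Stated as a linear
  -- equation, it can be substituted after an exchange of sums over edges and vertices.
  Covers : Subset n → Subset (size H) → Set
  Covers U M = ∀ v → sum (λ f → χ M f * E f v) ≡ χ U v

  covers? : ∀ U M → Dec (Covers U M)
  covers? U M = Fin.all? λ v → sum (λ f → χ M f * E f v) ≟ χ U v

  In : Subset n → Fin (size H) → ℚ
  In U e = 𝟙 (edge H e Subset.⊆? U)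

  In-indicates : ∀ U e → Indicates (edge H e ⊆ U) (In U e)
  In-indicates U e = 𝟙-indicates (edge H e Subset.⊆? U)

  _∖_ : Subset n → Fin (size H) → Subset n
  U ∖ f = U ─ edge H f

  erase : Subset (size H) → Fin (size H) → Subset (size H)
  erase M f = M [ f ]≔ outside

  covers⇒⊆ : ∀ {U M f} → Covers U M → f ∈ M → edge H f ⊆ U
  covers⇒⊆ {U} {M} {f} cov f∈M {v} v∈f = 1≤ind⇒holds (χ-indicates U v) (begin
    1ℚ                                  ≡⟨ cong₂ _*_ (ind≡1 (χ-indicates M f) f∈M) (ind≡1 (E-indicates f v) v∈f) ⟨
    χ M f * E f v                       ≤⟨ term≤sum (λ g → *-nonneg (ind-nonneg (χ-indicates M g)) (0≤E g v)) f ⟩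
    sum (λ g → χ M g * E g v)           ≡⟨ cov v ⟩
    χ U v                               ∎)

  χ-∖ : ∀ {U f} → edge H f ⊆ U → ∀ v → χ (U ∖ f) v ≡ χ U v - E f v
  χ-∖ {U} {f} f⊆U v = trans (χ-─ U (edge H f) v) (cases (χ-indicates U v) (E-indicates f v))
    where
    cases : ∀ {a b} → Indicates (v ∈ U) a → Indicates (v ∈ edge H f) b → a * (1ℚ - b) ≡ a - b
    cases (holds _)   (holds _)   = refl
    cases (holds _)   (fails _)   = refl
    cases (fails v∉U) (holds v∈f) = contradiction (f⊆U v∈f) v∉U
    cases (fails _)   (fails _)   = refl

  covers-erase : ∀ {U M f} → Covers U M → f ∈ M → Covers (U ∖ f) (erase M f)
  covers-erase {U} {M} {f} cov f∈M v = begin-equality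
    sum (λ g → χ (erase M f) g * E g v)                          ≡⟨ cancel (sum (λ g → χ (erase M f) g * E g v)) (E f v) ⟩
    sum (λ g → χ (erase M f) g * E g v) + E f v - E f v          ≡⟨ cong (_- E f v) (sum-erase M f f∈M (λ g → E g v)) ⟨
    sum (λ g → χ M g * E g v) - E f v                            ≡⟨ cong (_- E f v) (cov v) ⟩
    χ U v - E f v                                                ≡⟨ χ-∖ {U} {f} (covers⇒⊆ cov f∈M) v ⟨
    χ (U ∖ f) v                                                  ∎
    where
    cancel : ∀ a b → a ≡ a + b - b
    cancel = solve-∀ ℚ-ring

  sum-χ-erase : ∀ {M f} → f ∈ M → sum (χ (erase M f)) ≡ sum (χ M) - 1ℚ
  sum-χ-erase {M} {f} f∈M = begin-equality
    sum (χ (erase M f))                                ≡⟨ sum-cong-≗ (λ g → ℚ.*-identityʳ (χ (erase M f) g)) ⟨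
    sum (λ g → χ (erase M f) g * 1ℚ)                   ≡⟨ cancel (sum (λ g → χ (erase M f) g * 1ℚ)) ⟩
    sum (λ g → χ (erase M f) g * 1ℚ) + 1ℚ - 1ℚ         ≡⟨ cong (_- 1ℚ) (sum-erase M f f∈M (λ _ → 1ℚ)) ⟨
    sum (λ g → χ M g * 1ℚ) - 1ℚ                        ≡⟨ cong (_- 1ℚ) (sum-cong-≗ (λ g → ℚ.*-identityʳ (χ M g))) ⟩
    sum (χ M) - 1ℚ                                     ∎
    where
    cancel : ∀ a → a ≡ a + 1ℚ - 1ℚ
    cancel = solve-∀ ℚ-ring

  degree : Subset n → Fin n → ℚ
  degree U v = sum (λ e → E e v * In U e)

  isEmpty : ∀ {k} → Subset k → ℚ
  isEmpty []      = 1ℚ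
  isEmpty (b ∷ p) = (1ℚ - χ (b ∷ p) zero) * isEmpty p

  isEmpty-nonneg : ∀ {k} (p : Subset k) → 0ℚ ≤ isEmpty p
  isEmpty-nonneg []          = 0≤1
  isEmpty-nonneg (true ∷ p)  = ℚ.≤-reflexive (sym (ℚ.*-zeroˡ (isEmpty p)))
  isEmpty-nonneg (false ∷ p) = *-nonneg 0≤1 (isEmpty-nonneg p)

  ∑ˢ-isEmpty : ∀ k → ∑ˢ k isEmpty ≡ 1ℚ
  ∑ˢ-isEmpty zero    = refl
  ∑ˢ-isEmpty (suc k) = begin-equality
    ∑ˢ k (λ p → 1ℚ * isEmpty p) + ∑ˢ k (λ p → 0ℚ * isEmpty p)   ≡⟨ cong₂ _+_ (∑ˢ-*ˡ k 1ℚ isEmpty) (∑ˢ-*ˡ k 0ℚ isEmpty) ⟩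
    1ℚ * ∑ˢ k isEmpty + 0ℚ * ∑ˢ k isEmpty                       ≡⟨ cong (λ a → 1ℚ * a + 0ℚ * a) (∑ˢ-isEmpty k) ⟩
    1ℚ                                                          ∎

  isEmpty≡1 : ∀ {k} (p : Subset k) → sum (χ p) ≡ 0ℚ → isEmpty p ≡ 1ℚ
  isEmpty≡1 []          _  = refl
  isEmpty≡1 (false ∷ p) eq = trans (ℚ.*-identityˡ (isEmpty p))
    (isEmpty≡1 p (trans (sym (ℚ.+-identityˡ (sum (χ p)))) eq))
  isEmpty≡1 (true ∷ p)  eq = contradiction
    (subst (0ℚ <_) eq (ℚ.<-≤-trans 0<1
      (≤-byDifference (sum (χ p)) (sum-nonneg (λ x → ind-nonneg (χ-indicates p x))) refl)))
    (ℚ.<-irrefl refl)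

  -- The probability that all r guesses are right when M is revealed: each round
  -- picks a random edge f of M and a random vertex v of f, and guesses f among
  -- the edges at v inside U.
  weight : ℕ → Subset n → Subset (size H) → ℚ
  -- With no round left, only the empty set has been reproduced in full; the total over all sets is
  -- then 1.
  weight zero    U M = isEmpty M
  weight (suc r) U M = inv (ι 3 * ι (suc r)) *
    sum (λ f → sum (λ v → χ M f * E f v * (inv (degree U v) * weight r (U ∖ f) (erase M f))))

  weight-nonneg : ∀ r U M → 0ℚ ≤ weight r U M
  weight-nonneg zero    U M = isEmpty-nonneg M
  weight-nonneg (suc r) U M = *-nonneg (0≤inv (ι 3 * ι (suc r)))
    (sum-nonneg λ f → sum-nonneg λ v → *-nonneg (*-nonneg (ind-nonneg (χ-indicates M f)) (0≤E f v))
      (*-nonneg (0≤inv (degree U v)) (weight-nonneg r (U ∖ f) (erase M f))))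

  -- For an exact cover the random vertex of a round is uniform on `U`, which is what frees the
  -- totals from their dependence on `M`.
  coveringWeight : ℕ → Subset n → Subset (size H) → ℚ
  coveringWeight r U M = 𝟙 (covers? U M) * weight r U M

  coveringWeight-nonneg : ∀ r U M → 0ℚ ≤ coveringWeight r U M
  coveringWeight-nonneg r U M = *-nonneg (ind-nonneg (𝟙-indicates (covers? U M))) (weight-nonneg r U M)

  sum-∖ : ∀ {U f} r → edge H f ⊆ U → sum (χ U) ≡ ι 3 * ι (suc r) → sum (χ (U ∖ f)) ≡ ι 3 * ι r
  sum-∖ {U} {f} r f⊆U eq = begin-equality
    sum (χ (U ∖ f))                  ≡⟨ sum-cong-≗ (χ-∖ {U} {f} f⊆U) ⟩
    sum (λ v → χ U v - E f v)        ≡⟨ sum-sub (χ U) (E f) ⟩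
    sum (χ U) - sum (E f)            ≡⟨ cong₂ _-_ eq (sum-E f) ⟩
    ι 3 * ι (suc r) - ι 3            ≡⟨ cong (λ a → ι 3 * a - ι 3) (ι-suc r) ⟩
    ι 3 * (1ℚ + ι r) - ι 3           ≡⟨ regroup (ι 3) (ι r) ⟩
    ι 3 * ι r                        ∎
    where
    regroup : ∀ a b → a * (1ℚ + b) - a ≡ a * b
    regroup = solve-∀ ℚ-ring

  1≤3* : ∀ r → 1ℚ ≤ ι 3 * ι (suc r)
  1≤3* r = *-mono 0≤1 (0≤ι (suc r)) (1≤ι 2) (1≤ι r)

  -- For v in `U`, the chance of guessing f at v. It depends on `U` but not on `M`.
  selection : Subset n → Fin n → Fin (size H) → ℚ
  selection U v f = χ U v * inv (degree U v) * (E f v * In U f)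

  sum-selection≤ : ∀ U v → sum (selection U v) ≤ χ U v
  sum-selection≤ U v = begin
    sum (selection U v)                        ≡⟨ *-distribˡ-sum (χ U v * inv (degree U v)) (λ f → E f v * In U f) ⟨
    χ U v * inv (degree U v) * degree U v      ≡⟨ regroup (χ U v) (inv (degree U v)) (degree U v) ⟩
    χ U v * (degree U v * inv (degree U v))    ≤⟨ *-monoʳ (ind-nonneg (χ-indicates U v)) (*-inv≤1 (degree U v)) ⟩
    χ U v * 1ℚ                                 ≡⟨ ℚ.*-identityʳ (χ U v) ⟩
    χ U v                                      ∎
    where
    regroup : ∀ a b c → a * b * c ≡ a * (c * b)
    regroup = solve-∀ ℚ-ring

  -- If `M` covers `U`, contains f and f contains v, all indicators on the right are 1 and the sides
  -- agree; otherwise the left side vanishes.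
  coveringWeight-step : ∀ r U M f v →
    𝟙 (covers? U M) * (χ M f * E f v * (inv (degree U v) * weight r (U ∖ f) (erase M f))) ≤
    selection U v f * (χ M f * coveringWeight r (U ∖ f) (erase M f))
  coveringWeight-step r U M f v =
    cases (𝟙-indicates (covers? U M)) (χ-indicates M f) (E-indicates f v) (χ-indicates U v)
      (In-indicates U f) (𝟙-indicates (covers? (U ∖ f) (erase M f)))
      (0≤inv (degree U v)) (weight-nonneg r (U ∖ f) (erase M f))
    where
    cases : ∀ {c m x u i c′ d w} → Indicates (Covers U M) c → Indicates (f ∈ M) m →
            Indicates (v ∈ edge H f) x → Indicates (v ∈ U) u → Indicates (edge H f ⊆ U) i →
            Indicates (Covers (U ∖ f) (erase M f)) c′ → 0ℚ ≤ d → 0ℚ ≤ w →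
            c * (m * x * (d * w)) ≤ u * d * (x * i) * (m * (c′ * w))
    cases {m = m} {x} {u} {i} {c′} {d} {w} (fails _) Im Ix Iu Ii Ic′ 0≤d 0≤w =
      ℚ.≤-trans (ℚ.≤-reflexive (ℚ.*-zeroˡ (m * x * (d * w))))
        (*-nonneg (*-nonneg (*-nonneg (ind-nonneg Iu) 0≤d) (*-nonneg (ind-nonneg Ix) (ind-nonneg Ii)))
          (*-nonneg (ind-nonneg Im) (*-nonneg (ind-nonneg Ic′) 0≤w)))
    cases {x = x} {u} {i} {c′} {d} {w} (holds _) (fails _) _ _ _ _ _ _ = ℚ.≤-reflexive (vanish x u i c′ d w)
      where
      vanish : ∀ x u i c′ d w → 1ℚ * (0ℚ * x * (d * w)) ≡ u * d * (x * i) * (0ℚ * (c′ * w))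
      vanish = solve-∀ ℚ-ring
    cases {u = u} {i} {c′} {d} {w} (holds _) (holds _) (fails _) _ _ _ _ _ = ℚ.≤-reflexive (vanish u i c′ d w)
      where
      vanish : ∀ u i c′ d w → 1ℚ * (1ℚ * 0ℚ * (d * w)) ≡ u * d * (0ℚ * i) * (1ℚ * (c′ * w))
      vanish = solve-∀ ℚ-ring
    cases (holds cov) (holds f∈M) (holds v∈f) (fails v∉U) _ _ _ _ = contradiction (covers⇒⊆ {U} cov f∈M v∈f) v∉U
    cases (holds cov) (holds f∈M) (holds v∈f) (holds _) (fails f⊈U) _ _ _ =
      contradiction (λ {x} → covers⇒⊆ {U} cov f∈M {x}) f⊈U
    cases (holds cov) (holds f∈M) (holds v∈f) (holds _) (holds _) (fails ¬cov) _ _ =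
      contradiction (covers-erase {U} cov f∈M) ¬cov
    cases {d = d} {w} (holds _) (holds _) (holds _) (holds _) (holds _) (holds _) _ _ = ℚ.≤-reflexive (full d w)
      where
      full : ∀ d w → 1ℚ * (1ℚ * 1ℚ * (d * w)) ≡ 1ℚ * d * (1ℚ * 1ℚ) * (1ℚ * (1ℚ * w))
      full = solve-∀ ℚ-ring

  -- For fixed f and v, the sum over `M` runs over continuations that cover `U ∖ f`, so it is at
  -- most 1 by induction. The chances of the guesses at one vertex add up to at most 1, and the
  -- 3(r+1) vertices of `U` cancel the normalisation.
  total-weight≤1 : ∀ r U → sum (χ U) ≡ ι 3 * ι r → ∑ˢ (size H) (coveringWeight r U) ≤ 1ℚ
  total-weight≤1 zero U _ = begin
    ∑ˢ (size H) (coveringWeight zero U)   ≤⟨ ∑ˢ-mono (size H) (λ M → ℚ.≤-trans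
                                               (*-monoˡ (isEmpty-nonneg M) (ind≤1 (𝟙-indicates (covers? U M))))
                                               (ℚ.≤-reflexive (ℚ.*-identityˡ (isEmpty M)))) ⟩
    ∑ˢ (size H) isEmpty                   ≡⟨ ∑ˢ-isEmpty (size H) ⟩
    1ℚ                                    ∎
  total-weight≤1 (suc r) U eq = begin
    ∑ˢ (size H) (λ M → 𝟙 (covers? U M) * (k * sum (λ f → sum (λ v → term M f v))))
      ≡⟨ ∑ˢ-cong (size H) (λ M → trans (*-swap (𝟙 (covers? U M)) k (sum (λ f → sum (λ v → term M f v))))
           (cong (k *_) (trans (*-distribˡ-sum (𝟙 (covers? U M)) (λ f → sum (λ v → term M f v)))
             (sum-cong-≗ λ f → *-distribˡ-sum (𝟙 (covers? U M)) (λ v → term M f v))))) ⟩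
    ∑ˢ (size H) (λ M → k * sum (λ f → sum (λ v → 𝟙 (covers? U M) * term M f v)))
      ≤⟨ ∑ˢ-mono (size H) (λ M → *-monoʳ (0≤inv (ι 3 * ι (suc r)))
           (sum-mono λ f → sum-mono λ v → coveringWeight-step r U M f v)) ⟩
    ∑ˢ (size H) (λ M → k * sum (λ f → sum (λ v → selection U v f * rest f M)))
      ≡⟨ ∑ˢ-*ˡ (size H) k (λ M → sum (λ f → sum (λ v → selection U v f * rest f M))) ⟩
    k * ∑ˢ (size H) (λ M → sum (λ f → sum (λ v → selection U v f * rest f M)))
      ≡⟨ cong (k *_) (trans (∑ˢ-sum (size H) (λ M f → sum (λ v → selection U v f * rest f M)))
           (sum-cong-≗ λ f → trans (∑ˢ-sum (size H) (λ M v → selection U v f * rest f M))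
             (sum-cong-≗ λ v → ∑ˢ-*ˡ (size H) (selection U v f) (rest f)))) ⟩
    k * sum (λ f → sum (λ v → selection U v f * ∑ˢ (size H) (rest f)))
      ≤⟨ *-monoʳ (0≤inv (ι 3 * ι (suc r))) (sum-mono λ f → sum-mono λ v → rest≤1 f v (In-indicates U f)) ⟩
    k * sum (λ f → sum (λ v → selection U v f))
      ≡⟨ cong (k *_) (∑-comm (λ f v → selection U v f)) ⟩
    k * sum (λ v → sum (selection U v))
      ≤⟨ *-monoʳ (0≤inv (ι 3 * ι (suc r))) (sum-mono (sum-selection≤ U)) ⟩
    k * sum (χ U)
      ≡⟨ cong (k *_) eq ⟩
    k * (ι 3 * ι (suc r))
      ≡⟨ trans (ℚ.*-comm k (ι 3 * ι (suc r))) (*-inv (1≤3* r)) ⟩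
    1ℚ
      ∎
    where
    k : ℚ
    k = inv (ι 3 * ι (suc r))
    term : Subset (size H) → Fin (size H) → Fin n → ℚ
    term M f v = χ M f * E f v * (inv (degree U v) * weight r (U ∖ f) (erase M f))
    rest : Fin (size H) → Subset (size H) → ℚ
    rest f M = χ M f * coveringWeight r (U ∖ f) (erase M f)
    rest≤1 : ∀ f v {i} → Indicates (edge H f ⊆ U) i →
             χ U v * inv (degree U v) * (E f v * i) * ∑ˢ (size H) (rest f) ≤
             χ U v * inv (degree U v) * (E f v * i)
    rest≤1 f v (fails _) = ℚ.≤-reflexive (vanish (χ U v * inv (degree U v)) (E f v) (∑ˢ (size H) (rest f)))
      where
      vanish : ∀ a b c → a * (b * 0ℚ) * c ≡ a * (b * 0ℚ)
      vanish = solve-∀ ℚ-ring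
    rest≤1 f v (holds f⊆U) = ℚ.≤-trans
      (*-monoʳ (*-nonneg (*-nonneg (ind-nonneg (χ-indicates U v)) (0≤inv (degree U v))) (*-nonneg (0≤E f v) 0≤1))
        (ℚ.≤-trans (∑ˢ-erase (size H) f (coveringWeight-nonneg r (U ∖ f)))
          (total-weight≤1 r (U ∖ f) (sum-∖ {U} {f} r f⊆U eq))))
      (ℚ.≤-reflexive (ℚ.*-identityʳ (χ U v * inv (degree U v) * (E f v * 1ℚ))))

  -- Survival of the edges outside the matching, and the sum of the degrees.

  -- The name: if `M` covers `U`, an edge inside `U` but not in `M` meets three different edges of
  -- `M`, in one vertex each.
  transversals : Subset n → Subset (size H) → ℚ
  transversals U M = sum (λ e → In U e * (1ℚ - χ M e))

  0≤transversal : ∀ U M e → 0ℚ ≤ In U e * (1ℚ - χ M e)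
  0≤transversal U M e = *-nonneg (ind-nonneg (In-indicates U e)) (p≤q⇒0≤q-p (ind≤1 (χ-indicates M e)))

  transversals-nonneg : ∀ U M → 0ℚ ≤ transversals U M
  transversals-nonneg U M = sum-nonneg (0≤transversal U M)

  transversals≤size : ∀ U M → transversals U M ≤ ι (size H)
  transversals≤size U M = begin
    transversals U M                   ≤⟨ sum-mono (λ e → cases (In-indicates U e) (χ-indicates M e)) ⟩
    sum {size H} (λ _ → 1ℚ)            ≡⟨ sum-const (size H) 1ℚ ⟩
    ι (size H) * 1ℚ                    ≡⟨ ℚ.*-identityʳ (ι (size H)) ⟩
    ι (size H)                         ∎
    where
    cases : ∀ {P Q i m} → Indicates P i → Indicates Q m → i * (1ℚ - m) ≤ 1ℚ
    cases (holds _) (holds _) = 0≤1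
    cases (holds _) (fails _) = ℚ.≤-refl
    cases (fails _) (holds _) = 0≤1
    cases (fails _) (fails _) = 0≤1

  meet : Fin (size H) → Fin (size H) → ℚ
  meet e f = sum (λ v → E e v * E f v)

  ∖-⊆ : ∀ {U f e} → edge H e ⊆ U ∖ f → edge H e ⊆ U
  ∖-⊆ {U} {f} e⊆ v∈e = Subset.p─q⊆p U (edge H f) (e⊆ v∈e)

  meet≡0 : ∀ {U f e} → edge H e ⊆ U ∖ f → meet e f ≡ 0ℚ
  meet≡0 {U} {f} {e} e⊆ = trans
    (sum-cong-≗ λ v → cases v {u = χ U v} (E-indicates e v) (E-indicates f v) (χ-─ U (edge H f) v) (χ-indicates (U ∖ f) v))
    (trans (sum-const n 0ℚ) (ℚ.*-zeroʳ (ι n)))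
    where
    cases : ∀ v {a b u x} → Indicates (v ∈ edge H e) a → Indicates (v ∈ edge H f) b →
            x ≡ u * (1ℚ - b) → Indicates (v ∈ U ∖ f) x → a * b ≡ 0ℚ
    cases v {u = u} (holds v∈e) (holds _) eq Ix = contradiction
      (trans (sym (ind≡1 Ix (e⊆ v∈e))) (trans eq (ℚ.*-zeroʳ u))) λ ()
    cases v (holds _) (fails _) _ _ = refl
    cases v (fails _) (holds _) _ _ = refl
    cases v (fails _) (fails _) _ _ = refl

  meet-self : ∀ f → meet f f ≡ ι 3
  meet-self f = trans (sum-cong-≗ λ v → idem (E-indicates f v)) (sum-E f)
    where
    idem : ∀ {P a} → Indicates P a → a * a ≡ a
    idem (holds _) = refl
    idem (fails _) = refl

  χ-erase : ∀ {M e f} → e ≢ f → χ (erase M f) e ≡ χ M e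
  χ-erase {M} e≢f = cong (λ b → if b then 1ℚ else 0ℚ) (Vec.lookup∘update′ e≢f M outside)

  -- A survivor misses f, so its last factor is 1. For the others that factor is still nonnegative
  -- when e is not in `M`, since two distinct edges share at most one vertex. The bound is linear in
  -- `meet e f`, so it can be summed over f.
  transversal-erase : ∀ {U M f} → f ∈ M → ∀ e →
    In (U ∖ f) e * (1ℚ - χ (erase M f) e) ≤ In U e * (1ℚ - χ M e) * (1ℚ - meet e f)
  transversal-erase {U} {M} {f} f∈M e =
    cases (In-indicates (U ∖ f) e) (In-indicates U e) (χ-indicates M e)
    where
    cases : ∀ {i′ i} → Indicates (edge H e ⊆ U ∖ f) i′ → Indicates (edge H e ⊆ U) i → Indicates (e ∈ M) (χ M e) →
            i′ * (1ℚ - χ (erase M f) e) ≤ i * (1ℚ - χ M e) * (1ℚ - meet e f)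
    cases {i = i} (holds e⊆) Ii Im with e Fin.≟ f
    -- Having left the matching, f would itself count as a transversal, were it not for its
    -- vertices, which have left `U` too.
    ... | yes refl = contradiction (trans (sym (meet≡0 {U} e⊆)) (meet-self e)) λ ()
    ... | no  e≢f = ℚ.≤-reflexive (begin-equality
      1ℚ * (1ℚ - χ (erase M f) e)              ≡⟨ cong (λ m → 1ℚ * (1ℚ - m)) (χ-erase {M} e≢f) ⟩
      1ℚ * (1ℚ - χ M e)                        ≡⟨ cong (_* (1ℚ - χ M e)) (ind≡1 Ii (∖-⊆ {U} {f} {e} e⊆)) ⟨
      i * (1ℚ - χ M e)                         ≡⟨ times-[1-0] (i * (1ℚ - χ M e)) ⟨
      i * (1ℚ - χ M e) * (1ℚ - 0ℚ)             ≡⟨ cong (λ a → i * (1ℚ - χ M e) * (1ℚ - a)) (meet≡0 {U} {f} {e} e⊆) ⟨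
      i * (1ℚ - χ M e) * (1ℚ - meet e f)       ∎)
      where
      times-[1-0] : ∀ a → a * (1ℚ - 0ℚ) ≡ a
      times-[1-0] = solve-∀ ℚ-ring
    cases (fails _) Ii Im = ℚ.≤-trans (ℚ.≤-reflexive (ℚ.*-zeroˡ (1ℚ - χ (erase M f) e))) (nonneg Ii Im)
      where
      nonneg : ∀ {P i m} → Indicates P i → Indicates (e ∈ M) m → 0ℚ ≤ i * (1ℚ - m) * (1ℚ - meet e f)
      nonneg {i = i} Ii (holds _) = ℚ.≤-reflexive (sym (vanish i (1ℚ - meet e f)))
        where
        vanish : ∀ a b → a * (1ℚ - 1ℚ) * b ≡ 0ℚ
        vanish = solve-∀ ℚ-ring
      nonneg Ii (fails e∉M) = *-nonneg (*-nonneg (ind-nonneg Ii) 0≤1)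
        (p≤q⇒0≤q-p (sum-meet≤1 λ { refl → e∉M f∈M }))

  -- An edge that is not in M meets three edges of M, and it survives the
  -- removal of every other edge of M.
  sum-transversals-erase : ∀ {U M} → Covers U M →
    sum (λ f → χ M f * transversals (U ∖ f) (erase M f)) ≤ (sum (χ M) - ι 3) * transversals U M
  sum-transversals-erase {U} {M} cov = begin
    sum (λ f → χ M f * transversals (U ∖ f) (erase M f))
      ≤⟨ sum-mono (λ f → survivors f (χ-indicates M f)) ⟩
    sum (λ f → χ M f * sum (λ e → τ e * (1ℚ - meet e f)))
      ≡⟨ sum-cong-≗ (λ f → *-distribˡ-sum (χ M f) (λ e → τ e * (1ℚ - meet e f))) ⟩
    sum (λ f → sum (λ e → χ M f * (τ e * (1ℚ - meet e f))))
      ≡⟨ ∑-comm (λ f e → χ M f * (τ e * (1ℚ - meet e f))) ⟩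
    sum (λ e → sum (λ f → χ M f * (τ e * (1ℚ - meet e f))))
      ≡⟨ sum-cong-≗ perEdge ⟩
    sum (λ e → (sum (χ M) - ι 3) * τ e)
      ≡⟨ *-distribˡ-sum (sum (χ M) - ι 3) τ ⟨
    (sum (χ M) - ι 3) * transversals U M
      ∎
    where
    τ : Fin (size H) → ℚ
    τ e = In U e * (1ℚ - χ M e)
    survivors : ∀ f {m} → Indicates (f ∈ M) m →
      m * transversals (U ∖ f) (erase M f) ≤ m * sum (λ e → τ e * (1ℚ - meet e f))
    survivors f (holds f∈M) = *-monoʳ 0≤1 (sum-mono (transversal-erase {U} f∈M))
    survivors f (fails _)   = ℚ.≤-reflexive (trans (ℚ.*-zeroˡ (transversals (U ∖ f) (erase M f)))
      (sym (ℚ.*-zeroˡ (sum (λ e → τ e * (1ℚ - meet e f))))))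
    sum-E-χ : ∀ e → sum (λ f → χ M f * meet e f) ≡ sum (λ v → E e v * χ U v)
    sum-E-χ e = begin-equality
      sum (λ f → χ M f * meet e f)                          ≡⟨ sum-cong-≗ (λ f → *-distribˡ-sum (χ M f) (λ v → E e v * E f v)) ⟩
      sum (λ f → sum (λ v → χ M f * (E e v * E f v)))       ≡⟨ ∑-comm (λ f v → χ M f * (E e v * E f v)) ⟩
      sum (λ v → sum (λ f → χ M f * (E e v * E f v)))       ≡⟨ sum-cong-≗ (λ v → sum-cong-≗ λ f → *-swap (χ M f) (E e v) (E f v)) ⟩
      sum (λ v → sum (λ f → E e v * (χ M f * E f v)))       ≡⟨ sum-cong-≗ (λ v → *-distribˡ-sum (E e v) (λ f → χ M f * E f v)) ⟨
      sum (λ v → E e v * sum (λ f → χ M f * E f v))         ≡⟨ sum-cong-≗ (λ v → cong (E e v *_) (cov v)) ⟩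
      sum (λ v → E e v * χ U v)                             ∎
    inside-sum : ∀ e → edge H e ⊆ U → sum (λ v → E e v * χ U v) ≡ ι 3
    inside-sum e e⊆U = trans (sum-cong-≗ λ v → absorb v (E-indicates e v)) (sum-E e)
      where
      absorb : ∀ v {a} → Indicates (v ∈ edge H e) a → a * χ U v ≡ a
      absorb v (holds v∈e) = trans (ℚ.*-identityˡ (χ U v)) (ind≡1 (χ-indicates U v) (e⊆U v∈e))
      absorb v (fails _)   = ℚ.*-zeroˡ (χ U v)
    perEdge : ∀ e → sum (λ f → χ M f * (τ e * (1ℚ - meet e f))) ≡ (sum (χ M) - ι 3) * τ e
    perEdge e = begin-equality
      sum (λ f → χ M f * (τ e * (1ℚ - meet e f)))           ≡⟨ sum-cong-≗ (λ f → regroup (χ M f) (τ e) (meet e f)) ⟩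
      sum (λ f → τ e * (χ M f - χ M f * meet e f))          ≡⟨ *-distribˡ-sum (τ e) (λ f → χ M f - χ M f * meet e f) ⟨
      τ e * sum (λ f → χ M f - χ M f * meet e f)            ≡⟨ cong (τ e *_) (sum-sub (χ M) (λ f → χ M f * meet e f)) ⟩
      τ e * (sum (χ M) - sum (λ f → χ M f * meet e f))      ≡⟨ cong (λ a → τ e * (sum (χ M) - a)) (sum-E-χ e) ⟩
      τ e * (sum (χ M) - sum (λ v → E e v * χ U v))         ≡⟨ onlyInside (In-indicates U e) ⟩
      (sum (χ M) - ι 3) * τ e                               ∎
      where
      regroup : ∀ a b c → a * (b * (1ℚ - c)) ≡ b * (a - a * c)
      regroup = solve-∀ ℚ-ring
      onlyInside : ∀ {i} → Indicates (edge H e ⊆ U) i →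
        i * (1ℚ - χ M e) * (sum (χ M) - sum (λ v → E e v * χ U v)) ≡ (sum (χ M) - ι 3) * (i * (1ℚ - χ M e))
      onlyInside (holds e⊆U) = trans (cong (λ a → 1ℚ * (1ℚ - χ M e) * (sum (χ M) - a)) (inside-sum e e⊆U))
        (ℚ.*-comm (1ℚ * (1ℚ - χ M e)) (sum (χ M) - ι 3))
      onlyInside (fails _) = vanish (1ℚ - χ M e) (sum (χ M) - sum (λ v → E e v * χ U v)) (sum (χ M) - ι 3)
        where
        vanish : ∀ a b c → 0ℚ * a * b ≡ c * (0ℚ * a)
        vanish = solve-∀ ℚ-ring

  0≤degree : ∀ U v → 0ℚ ≤ degree U v
  0≤degree U v = sum-nonneg λ e → *-nonneg (0≤E e v) (ind-nonneg (In-indicates U e))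

  -- As `M` covers `U` exactly, the left side adds the degree of each vertex of `U` once, and this
  -- counts an edge inside `U` three times. Such edges are transversals or belong to `M`.
  sum-degrees≤ : ∀ {U M} → Covers U M →
    sum (λ f → sum (λ v → χ M f * E f v * degree U v)) ≤ ι 3 * (sum (χ M) + transversals U M)
  sum-degrees≤ {U} {M} cov = begin
    sum (λ f → sum (λ v → χ M f * E f v * degree U v))        ≡⟨ ∑-comm (λ f v → χ M f * E f v * degree U v) ⟩
    sum (λ v → sum (λ f → χ M f * E f v * degree U v))        ≡⟨ sum-cong-≗ (λ v → *-distribʳ-sum (degree U v) (λ f → χ M f * E f v)) ⟨
    sum (λ v → sum (λ f → χ M f * E f v) * degree U v)        ≡⟨ sum-cong-≗ (λ v → cong (_* degree U v) (cov v)) ⟩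
    sum (λ v → χ U v * degree U v)                            ≤⟨ sum-mono (λ v → *-monoˡ (0≤degree U v) (ind≤1 (χ-indicates U v))) ⟩
    sum (λ v → 1ℚ * degree U v)                               ≡⟨ sum-cong-≗ (λ v → ℚ.*-identityˡ (degree U v)) ⟩
    sum (λ v → sum (λ e → E e v * In U e))                    ≡⟨ ∑-comm (λ v e → E e v * In U e) ⟩
    sum (λ e → sum (λ v → E e v * In U e))                    ≡⟨ sum-cong-≗ (λ e → *-distribʳ-sum (In U e) (E e)) ⟨
    sum (λ e → sum (E e) * In U e)                            ≡⟨ sum-cong-≗ (λ e → cong (_* In U e) (sum-E e)) ⟩
    sum (λ e → ι 3 * In U e)                                  ≡⟨ *-distribˡ-sum (ι 3) (In U) ⟨
    ι 3 * sum (In U)                                          ≤⟨ *-monoʳ (0≤ι 3) (sum-mono λ e → split (In-indicates U e) (χ-indicates M e)) ⟩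
    ι 3 * sum (λ e → χ M e + In U e * (1ℚ - χ M e))           ≡⟨ cong (ι 3 *_) (∑-distrib-+ (χ M) (λ e → In U e * (1ℚ - χ M e))) ⟩
    ι 3 * (sum (χ M) + transversals U M)                      ∎
    where
    split : ∀ {P Q i m} → Indicates P i → Indicates Q m → i ≤ m + i * (1ℚ - m)
    split (holds _) (holds _) = ℚ.≤-refl
    split (holds _) (fails _) = ℚ.≤-refl
    split (fails _) (holds _) = 0≤1
    split (fails _) (fails _) = ℚ.≤-refl

  1≤degree : ∀ {U f v} → edge H f ⊆ U → v ∈ edge H f → 1ℚ ≤ degree U v
  1≤degree {U} {f} {v} f⊆U v∈f = begin
    1ℚ                 ≡⟨ cong₂ _*_ (ind≡1 (E-indicates f v) v∈f) (ind≡1 (In-indicates U f) f⊆U) ⟨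
    E f v * In U f     ≤⟨ term≤sum (λ e → *-nonneg (0≤E e v) (ind-nonneg (In-indicates U e))) f ⟩
    degree U v         ∎

  -- The number of edges, and perfect matchings as exact covers.

  -- Counts triples (u, v, e) with u and v in e. Distinct u and v share at most one edge, and u = v
  -- gives the degree of u. Allowing 1 on the diagonal as well gives n² where n(n-1) would be exact;
  -- only a lower-order term is lost.
  9*size≤ : ι 3 * ι 3 * ι (size H) ≤ ι n * ι n + ι 3 * ι (size H)
  9*size≤ = begin
    ι 3 * ι 3 * ι (size H)
      ≡⟨ trans (ℚ.*-comm (ι 3 * ι 3) (ι (size H))) (sym (sum-const (size H) (ι 3 * ι 3))) ⟩
    sum {size H} (λ _ → ι 3 * ι 3)
      ≡⟨ sum-cong-≗ (λ e → cong₂ _*_ (sum-E e) (sum-E e)) ⟨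
    sum (λ e → sum (E e) * sum (E e))
      ≡⟨ sum-cong-≗ (λ e → trans (*-distribʳ-sum (sum (E e)) (E e)) (sum-cong-≗ λ u → *-distribˡ-sum (E e u) (E e))) ⟩
    sum (λ e → sum (λ u → sum (λ v → E e u * E e v)))
      ≡⟨ trans (∑-comm (λ e u → sum (λ v → E e u * E e v))) (sum-cong-≗ λ u → ∑-comm (λ e v → E e u * E e v)) ⟩
    sum (λ u → sum (λ v → sum (λ e → E e u * E e v)))
      ≤⟨ sum-mono (λ u → sum-mono λ v → codegree u v) ⟩
    sum (λ u → sum (λ v → 1ℚ + 𝟙 (u Fin.≟ v) * deg u))
      ≤⟨ sum-mono perVertex ⟩
    sum (λ u → ι n + deg u)
      ≡⟨ ∑-distrib-+ {n} (λ _ → ι n) deg ⟩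
    sum {n} (λ _ → ι n) + sum deg
      ≡⟨ cong₂ _+_ (sum-const n (ι n)) sum-deg ⟩
    ι n * ι n + ι 3 * ι (size H)
      ∎
    where
    deg : Fin n → ℚ
    deg u = sum (λ e → E e u)
    0≤deg : ∀ u → 0ℚ ≤ deg u
    0≤deg u = sum-nonneg λ e → 0≤E e u
    codegree : ∀ u v → sum (λ e → E e u * E e v) ≤ 1ℚ + 𝟙 (u Fin.≟ v) * deg u
    codegree u v with u Fin.≟ v
    ... | no  u≢v  = ℚ.≤-trans
      (sum-atMostOne (λ e → ind-× (E-indicates e u) (E-indicates e v))
        λ e f (u∈e , v∈e) (u∈f , v∈f) → common-pair u≢v u∈e v∈e u∈f v∈f)
      (ℚ.≤-reflexive (sym (cong (1ℚ +_) (ℚ.*-zeroˡ (deg u)))))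
    ... | yes refl = ℚ.≤-trans (sum-mono λ e → ℚ.≤-trans (*-monoʳ (0≤E e u) (ind≤1 (E-indicates e u))) (ℚ.≤-reflexive (ℚ.*-identityʳ (E e u))))
      (≤-byDifference 1ℚ 0≤1 (trans (ℚ.+-comm (deg u) 1ℚ) (cong (1ℚ +_) (sym (ℚ.*-identityˡ (deg u))))))
    perVertex : ∀ u → sum (λ v → 1ℚ + 𝟙 (u Fin.≟ v) * deg u) ≤ ι n + deg u
    perVertex u = begin
      sum (λ v → 1ℚ + 𝟙 (u Fin.≟ v) * deg u)                    ≡⟨ ∑-distrib-+ {n} (λ _ → 1ℚ) (λ v → 𝟙 (u Fin.≟ v) * deg u) ⟩
      sum {n} (λ _ → 1ℚ) + sum (λ v → 𝟙 (u Fin.≟ v) * deg u)    ≡⟨ cong₂ _+_ (trans (sum-const n 1ℚ) (ℚ.*-identityʳ (ι n))) (sym (*-distribʳ-sum (deg u) (λ v → 𝟙 (u Fin.≟ v)))) ⟩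
      ι n + sum (λ v → 𝟙 (u Fin.≟ v)) * deg u                   ≤⟨ ℚ.+-monoʳ-≤ (ι n) (*-monoˡ (0≤deg u)
                                                                     (sum-atMostOne (λ v → 𝟙-indicates (u Fin.≟ v)) λ v w u≡v u≡w → trans (sym u≡v) u≡w)) ⟩
      ι n + 1ℚ * deg u                                          ≡⟨ cong (ι n +_) (ℚ.*-identityˡ (deg u)) ⟩
      ι n + deg u                                               ∎
    sum-deg : sum deg ≡ ι 3 * ι (size H)
    sum-deg = begin-equality
      sum (λ u → sum (λ e → E e u))      ≡⟨ ∑-comm (λ u e → E e u) ⟩
      sum (λ e → sum (E e))              ≡⟨ sum-cong-≗ sum-E ⟩
      sum {size H} (λ _ → ι 3)           ≡⟨ sum-const (size H) (ι 3) ⟩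
      ι (size H) * ι 3                   ≡⟨ ℚ.*-comm (ι (size H)) (ι 3) ⟩
      ι 3 * ι (size H)                   ∎

  6*size≤n² : ι 6 * ι (size H) ≤ ι n * ι n
  6*size≤n² = begin
    ι 6 * ι (size H)                                                ≡⟨ regroup (ι (size H)) ⟩
    ι 3 * ι 3 * ι (size H) + - (ι 3 * ι (size H))                   ≤⟨ ℚ.+-monoˡ-≤ (- (ι 3 * ι (size H))) 9*size≤ ⟩
    ι n * ι n + ι 3 * ι (size H) + - (ι 3 * ι (size H))             ≡⟨ cancel (ι n * ι n) (ι 3 * ι (size H)) ⟩
    ι n * ι n                                                       ∎
    where
    regroup : ∀ s → ι 6 * s ≡ ι 3 * ι 3 * s + - (ι 3 * s)
    regroup s = trans (cong (_* s) (refl {x = ι 3 * ι 3 - ι 3})) (expand (ι 3) s)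
      where
      expand : ∀ a s → (a * a - a) * s ≡ a * a * s + - (a * s)
      expand = solve-∀ ℚ-ring
    cancel : ∀ a b → a + b + - b ≡ a
    cancel = solve-∀ ℚ-ring

  perfectMatching⇒covers : ∀ {M} → IsPerfectMatching H M → Covers Subset.⊤ M
  perfectMatching⇒covers {M} (disjoint , cover) v = trans (ℚ.≤-antisym atMost atLeast)
    (sym (ind≡1 (χ-indicates Subset.⊤ v) Subset.∈⊤))
    where
    indicates : ∀ f → Indicates (f ∈ M × v ∈ edge H f) (χ M f * E f v)
    indicates f = ind-× (χ-indicates M f) (E-indicates f v)
    unique : ∀ f g → f ∈ M × v ∈ edge H f → g ∈ M × v ∈ edge H g → f ≡ g
    unique f g (f∈M , v∈f) (g∈M , v∈g) with f Fin.≟ g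
    ... | yes f≡g = f≡g
    ... | no  f≢g = contradiction (v , Subset.x∈p∩q⁺ (v∈f , v∈g)) (disjoint f g f∈M g∈M f≢g)
    atMost : sum (λ f → χ M f * E f v) ≤ 1ℚ
    atMost = sum-atMostOne indicates unique
    atLeast : 1ℚ ≤ sum (λ f → χ M f * E f v)
    atLeast with f , f∈M×v∈f ← cover v = ℚ.≤-trans (ℚ.≤-reflexive (sym (ind≡1 (indicates f) f∈M×v∈f)))
      (term≤sum (λ g → ind-nonneg (indicates g)) f)

  covers-⊤⇒n≡3∣M∣ : ∀ {M} → Covers Subset.⊤ M → n ≡ 3 ℕ.* Subset.∣ M ∣
  covers-⊤⇒n≡3∣M∣ {M} cov = ι-injective (begin-equality
    ι n                                             ≡⟨ ℚ.*-identityʳ (ι n) ⟨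
    ι n * 1ℚ                                        ≡⟨ sum-const n 1ℚ ⟨
    sum {n} (λ _ → 1ℚ)                              ≡⟨ sum-cong-≗ {n} (λ v → ind≡1 (χ-indicates Subset.⊤ v) Subset.∈⊤) ⟨
    sum (χ {n} Subset.⊤)                            ≡⟨ sum-cong-≗ cov ⟨
    sum (λ v → sum (λ f → χ M f * E f v))           ≡⟨ ∑-comm (λ v f → χ M f * E f v) ⟩
    sum (λ f → sum (λ v → χ M f * E f v))           ≡⟨ sum-cong-≗ (λ f → *-distribˡ-sum (χ M f) (E f)) ⟨
    sum (λ f → χ M f * sum (E f))                   ≡⟨ sum-cong-≗ (λ f → cong (χ M f *_) (sum-E f)) ⟩
    sum (λ f → χ M f * ι 3)                         ≡⟨ *-distribʳ-sum (ι 3) (χ M) ⟨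
    sum (χ M) * ι 3                                 ≡⟨ cong (_* ι 3) (ι∣∣ M) ⟨
    ι Subset.∣ M ∣ * ι 3                            ≡⟨ ℚ.*-comm (ι Subset.∣ M ∣) (ι 3) ⟩
    ι 3 * ι Subset.∣ M ∣                            ≡⟨ ι-* 3 Subset.∣ M ∣ ⟨
    ι (3 ℕ.* Subset.∣ M ∣)                          ∎)

  no-perfectMatchings : (∀ m → n ≢ 3 ℕ.* m) → #perfectMatchings H ≡ 0
  no-perfectMatchings 3∤n = ι-injective (begin-equality
    ι (#perfectMatchings H)                              ≡⟨ ι-length-filter-subsets (size H) (isPerfectMatching? H) ⟩
    ∑ˢ (size H) (λ M → 𝟙 (isPerfectMatching? H M))       ≡⟨ ∑ˢ-cong (size H) (λ M → ind≡0 (𝟙-indicates (isPerfectMatching? H M))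
                                                              λ pm → 3∤n Subset.∣ M ∣ (covers-⊤⇒n≡3∣M∣ {M} (perfectMatching⇒covers {M} pm))) ⟩
    ∑ˢ (size H) (λ _ → 0ℚ)                               ≡⟨ ∑ˢ-zero (size H) ⟩
    0ℚ                                                   ∎)

  -- The lower bound on the probability of reproducing a given matching.

  module LowerBound (κ : ℚ) (0≤κ : 0ℚ ≤ κ) where
    open Factors κ

    -- target r bounds the expected number of transversals when r edges of M are
    -- left, and factor r = (r + target r) / r the expected number of choices.
    target β : ℕ → ℚ
    target r = κ * (ι r * (ι r * ι r))
    -- `β` measures how much each transversal beyond the target raises the expected sum of the
    -- ratios to come. With R edges left it adds 1/(Rc) to the present ratio, and a fraction (R-3)/R
    -- of the surplus goes on to the next round.
    β zero    = 0ℚ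
    β (suc r) = inv (ι (suc r)) * (inv (factor (suc r)) + β r * ι (suc r ℕ.∸ 3))

    1≤factor : ∀ r → 1ℚ ≤ factor r
    1≤factor r = ≤-byDifference (κ * (ι r * ι r)) (*-nonneg 0≤κ (square-nonneg (ι r))) refl

    factors-nonneg : ∀ r → 0ℚ ≤ factors r
    factors-nonneg zero    = 0≤1
    factors-nonneg (suc r) = *-nonneg (ℚ.≤-trans 0≤1 (1≤factor (suc r))) (factors-nonneg r)

    β-nonneg : ∀ r → 0ℚ ≤ β r
    β-nonneg zero    = ℚ.≤-refl
    β-nonneg (suc r) = *-nonneg (0≤inv (ι (suc r)))
      (+-nonneg (0≤inv (factor (suc r))) (*-nonneg (β-nonneg r) (0≤ι (suc r ℕ.∸ 3))))

    -- With R = r + 1 this is 1 - 3/R ≤ (1 - 1/R)³, cleared of denominators. Truncated subtraction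
    -- makes the left side 0 for R ≤ 3.
    cube-step : ∀ r → (suc r ℕ.∸ 3) ℕ.* (suc r ℕ.* (suc r ℕ.* suc r)) ℕ.≤ suc r ℕ.* (r ℕ.* (r ℕ.* r))
    cube-step zero          = ℕ.z≤n
    cube-step (suc zero)    = ℕ.z≤n
    cube-step (suc (suc k)) = ℕ.≤-trans (ℕ.m≤m+n _ ((3 ℕ.+ k) ℕ.* (3 ℕ.* k ℕ.+ 8))) (ℕ.≤-reflexive (identity k))
      where
      identity : ∀ k → k ℕ.* ((3 ℕ.+ k) ℕ.* ((3 ℕ.+ k) ℕ.* (3 ℕ.+ k))) ℕ.+ (3 ℕ.+ k) ℕ.* (3 ℕ.* k ℕ.+ 8) ≡
                 (3 ℕ.+ k) ℕ.* ((2 ℕ.+ k) ℕ.* ((2 ℕ.+ k) ℕ.* (2 ℕ.+ k)))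
      identity = ℕ-Solver.solve-∀

    target-step : ∀ r → ι (suc r ℕ.∸ 3) * target (suc r) ≤ ι (suc r) * target r
    target-step r = begin
      ι (suc r ℕ.∸ 3) * (κ * (ι (suc r) * (ι (suc r) * ι (suc r))))     ≡⟨ *-swap (ι (suc r ℕ.∸ 3)) κ (ι (suc r) * (ι (suc r) * ι (suc r))) ⟩
      κ * (ι (suc r ℕ.∸ 3) * (ι (suc r) * (ι (suc r) * ι (suc r))))     ≡⟨ cong (κ *_) (cast (suc r ℕ.∸ 3) (suc r)) ⟨
      κ * ι ((suc r ℕ.∸ 3) ℕ.* (suc r ℕ.* (suc r ℕ.* suc r)))           ≤⟨ *-monoʳ 0≤κ (ι-mono-≤ (cube-step r)) ⟩
      κ * ι (suc r ℕ.* (r ℕ.* (r ℕ.* r)))                               ≡⟨ cong (κ *_) (cast (suc r) r) ⟩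
      κ * (ι (suc r) * (ι r * (ι r * ι r)))                             ≡⟨ *-swap (ι (suc r)) κ (ι r * (ι r * ι r)) ⟨
      ι (suc r) * (κ * (ι r * (ι r * ι r)))                             ∎
      where
      cast : ∀ a b → ι (a ℕ.* (b ℕ.* (b ℕ.* b))) ≡ ι a * (ι b * (ι b * ι b))
      cast a b = trans (ι-* a (b ℕ.* (b ℕ.* b))) (cong (ι a *_)
        (trans (ι-* b (b ℕ.* b)) (cong (ι b *_) (ι-* b b))))

    module Step (r : ℕ) (U : Subset n) (M : Subset (size H)) (cov : Covers U M)
                (∣M∣ : sum (χ M) ≡ ι (suc r)) (xs : List ℚ) (0≤xs : NonNegList xs) where
      R c ic b P B A T D ΣT r3 S : ℚ
      R  = ι (suc r)
      c  = factor (suc r)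
      ic = inv c
      b  = β r
      P  = productᴸ xs
      B  = 1ℚ + ι (length xs) - sumᴸ xs
      -- The part of the inductive bound that is the same for all pairs (f, v); the additional 1 is
      -- there because the list grows by one ratio.
      A  = B + 1ℚ + b * target r
      T  = transversals U M
      D  = sum (λ f → sum (λ v → χ M f * E f v * degree U v))
      ΣT = sum (λ f → χ M f * transversals (U ∖ f) (erase M f))
      r3 = ι (suc r ℕ.∸ 3)
      S  = sum (λ f → sum (λ v → χ M f * E f v * (inv (degree U v) * weight r (U ∖ f) (erase M f))))

      Tₑ : Fin (size H) → ℚ
      Tₑ f = transversals (U ∖ f) (erase M f)

      0≤P : 0ℚ ≤ P
      0≤P = productᴸ-nonneg 0≤xs

      bracket : ℚ → Fin (size H) → ℚ
      bracket d f = A - (d * ic + b * Tₑ f)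

      -- Multiplying the inductive bound by c/d removes the new ratio d/c from the product and turns
      -- `factors r` into `factors (suc r)`. Here d ≥ 1, because f itself is among the edges at v,
      -- so `inv d` is a true reciprocal.
      perPair : ∀ f v →
        (f ∈ M → v ∈ edge H f →
          degree U v * ic * P * (1ℚ + ι (suc (length xs)) - (degree U v * ic + sumᴸ xs) - b * (Tₑ f - target r)) ≤
          factors r * weight r (U ∖ f) (erase M f)) →
        χ M f * E f v * (P * bracket (degree U v) f) ≤
        χ M f * E f v * (factors (suc r) * (inv (degree U v) * weight r (U ∖ f) (erase M f)))
      perPair f v ih = cases (χ-indicates M f) (E-indicates f v)
        where
        d w : ℚ
        d = degree U v
        w = weight r (U ∖ f) (erase M f)
        cases : ∀ {m x} → Indicates (f ∈ M) m → Indicates (v ∈ edge H f) x →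
          m * x * (P * bracket d f) ≤ m * x * (factors (suc r) * (inv d * w))
        cases {x = x} (fails _) _ = ℚ.≤-reflexive (vanish x (P * bracket d f) (factors (suc r) * (inv d * w)))
          where
          vanish : ∀ x a b → 0ℚ * x * a ≡ 0ℚ * x * b
          vanish = solve-∀ ℚ-ring
        cases (holds _) (fails _) = ℚ.≤-reflexive (vanish (P * bracket d f) (factors (suc r) * (inv d * w)))
          where
          vanish : ∀ a b → 1ℚ * 0ℚ * a ≡ 1ℚ * 0ℚ * b
          vanish = solve-∀ ℚ-ring
        cases (holds f∈M) (holds v∈f) = *-monoʳ 0≤1 (begin
          P * bracket d f
            ≡⟨ ℚ.*-identityˡ (P * bracket d f) ⟨
          1ℚ * 1ℚ * (P * bracket d f)
            ≡⟨ cong₂ (λ a a′ → a * a′ * (P * bracket d f)) (*-inv (1≤factor (suc r))) (*-inv (1≤degree {U} {f} (covers⇒⊆ {U} cov f∈M) v∈f)) ⟨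
          c * ic * (d * inv d) * (P * (B + 1ℚ + b * target r - (d * ic + b * Tₑ f)))
            ≡⟨ regroup c ic d (inv d) P (ι (length xs)) (sumᴸ xs) b (target r) (Tₑ f) ⟩
          c * inv d * (d * ic * P * (1ℚ + (1ℚ + ι (length xs)) - (d * ic + sumᴸ xs) - b * (Tₑ f - target r)))
            ≡⟨ cong (λ l → c * inv d * (d * ic * P * (1ℚ + l - (d * ic + sumᴸ xs) - b * (Tₑ f - target r)))) (ι-suc (length xs)) ⟨
          c * inv d * (d * ic * P * (1ℚ + ι (suc (length xs)) - (d * ic + sumᴸ xs) - b * (Tₑ f - target r)))
            ≤⟨ *-monoʳ (*-nonneg (ℚ.≤-trans 0≤1 (1≤factor (suc r))) (0≤inv d)) (ih f∈M v∈f) ⟩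
          c * inv d * (factors r * w)
            ≡⟨ regroup′ c (inv d) (factors r) w ⟩
          factors (suc r) * (inv d * w)
            ∎)
          where
          regroup : ∀ c ic d id P l s b t Tf →
            c * ic * (d * id) * (P * (1ℚ + l - s + 1ℚ + b * t - (d * ic + b * Tf))) ≡
            c * id * (d * ic * P * (1ℚ + (1ℚ + l) - (d * ic + s) - b * (Tf - t)))
          regroup = solve-∀ ℚ-ring
          regroup′ : ∀ c i p w → c * i * (p * w) ≡ c * p * (i * w)
          regroup′ = solve-∀ ℚ-ring

      sum-brackets : sum (λ f → sum (λ v → χ M f * E f v * (P * bracket (degree U v) f))) ≡
                     P * (A * (ι 3 * R) - (ic * D + b * (ι 3 * ΣT)))
      sum-brackets = begin-equality
        sum (λ f → sum (λ v → χ M f * E f v * (P * bracket (degree U v) f)))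
          ≡⟨ sum-cong-≗ inner ⟩
        sum (λ f → P * A * ι 3 * χ M f - (P * ic * Dₑ f + P * b * ι 3 * (χ M f * Tₑ f)))
          ≡⟨ sum-sub (λ f → P * A * ι 3 * χ M f) (λ f → P * ic * Dₑ f + P * b * ι 3 * (χ M f * Tₑ f)) ⟩
        sum (λ f → P * A * ι 3 * χ M f) - sum (λ f → P * ic * Dₑ f + P * b * ι 3 * (χ M f * Tₑ f))
          ≡⟨ cong₂ _-_ (sym (*-distribˡ-sum (P * A * ι 3) (χ M)))
               (trans (∑-distrib-+ (λ f → P * ic * Dₑ f) (λ f → P * b * ι 3 * (χ M f * Tₑ f)))
                 (cong₂ _+_ (sym (*-distribˡ-sum (P * ic) Dₑ)) (sym (*-distribˡ-sum (P * b * ι 3) (λ f → χ M f * Tₑ f))))) ⟩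
        P * A * ι 3 * sum (χ M) - (P * ic * D + P * b * ι 3 * ΣT)
          ≡⟨ cong (λ a → P * A * ι 3 * a - (P * ic * D + P * b * ι 3 * ΣT)) ∣M∣ ⟩
        P * A * ι 3 * R - (P * ic * D + P * b * ι 3 * ΣT)
          ≡⟨ regroup P A (ι 3) R ic D b ΣT ⟩
        P * (A * (ι 3 * R) - (ic * D + b * (ι 3 * ΣT)))
          ∎
        where
        Dₑ : Fin (size H) → ℚ
        Dₑ f = sum (λ v → χ M f * E f v * degree U v)
        regroup : ∀ P A t R ic D b S → P * A * t * R - (P * ic * D + P * b * t * S) ≡ P * (A * (t * R) - (ic * D + b * (t * S)))
        regroup = solve-∀ ℚ-ring
        inner : ∀ f → sum (λ v → χ M f * E f v * (P * bracket (degree U v) f)) ≡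
                      P * A * ι 3 * χ M f - (P * ic * Dₑ f + P * b * ι 3 * (χ M f * Tₑ f))
        inner f = begin-equality
          sum (λ v → χ M f * E f v * (P * bracket (degree U v) f))
            ≡⟨ sum-cong-≗ (λ v → expand (χ M f) (E f v) P A (degree U v) ic b (Tₑ f)) ⟩
          sum (λ v → P * χ M f * (A - b * Tₑ f) * E f v - P * ic * (χ M f * E f v * degree U v))
            ≡⟨ sum-sub (λ v → P * χ M f * (A - b * Tₑ f) * E f v) (λ v → P * ic * (χ M f * E f v * degree U v)) ⟩
          sum (λ v → P * χ M f * (A - b * Tₑ f) * E f v) - sum (λ v → P * ic * (χ M f * E f v * degree U v))
            ≡⟨ cong₂ _-_ (sym (*-distribˡ-sum (P * χ M f * (A - b * Tₑ f)) (E f)))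
                 (sym (*-distribˡ-sum (P * ic) (λ v → χ M f * E f v * degree U v))) ⟩
          P * χ M f * (A - b * Tₑ f) * sum (E f) - P * ic * Dₑ f
            ≡⟨ cong (λ a → P * χ M f * (A - b * Tₑ f) * a - P * ic * Dₑ f) (sum-E f) ⟩
          P * χ M f * (A - b * Tₑ f) * ι 3 - P * ic * Dₑ f
            ≡⟨ collect P (χ M f) A b (Tₑ f) (ι 3) ic (Dₑ f) ⟩
          P * A * ι 3 * χ M f - (P * ic * Dₑ f + P * b * ι 3 * (χ M f * Tₑ f))
            ∎
          where
          expand : ∀ m x P A d ic b Tf → m * x * (P * (A - (d * ic + b * Tf))) ≡
                   P * m * (A - b * Tf) * x - P * ic * (m * x * d)
          expand = solve-∀ ℚ-ring
          collect : ∀ P m A b Tf t ic D → P * m * (A - b * Tf) * t - P * ic * D ≡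
                    P * A * t * m - (P * ic * D + P * b * t * (m * Tf))
          collect = solve-∀ ℚ-ring

      ΣT≤ : ΣT ≤ r3 * T
      ΣT≤ = begin
        ΣT                          ≤⟨ sum-transversals-erase {U} {M} cov ⟩
        (sum (χ M) - ι 3) * T       ≡⟨ cong (λ a → (a - ι 3) * T) ∣M∣ ⟩
        (R - ι 3) * T               ≤⟨ *-monoˡ (transversals-nonneg U M) (≤+⇒-≤ {R} {ι 3} {r3}
                                         (ℚ.≤-trans (ι-mono-≤ (ℕ.m≤n+m∸n (suc r) 3)) (ℚ.≤-reflexive (ι-+ 3 (suc r ℕ.∸ 3))))) ⟩
        r3 * T                      ∎

      D≤ : D ≤ ι 3 * (R + T)
      D≤ = ℚ.≤-trans (sum-degrees≤ {U} {M} cov) (ℚ.≤-reflexive (cong (λ a → ι 3 * (a + T)) ∣M∣))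

      -- The reason for the choice of `factor`: with exactly `target` transversals the bound on the
      -- mean ratio is 1.
      balance : ic * (R + target (suc r)) ≡ R
      balance = trans (regroup ic R κ) (trans (cong (λ a → a * R) (*-inv (1≤factor (suc r)))) (ℚ.*-identityˡ R))
        where
        regroup : ∀ i R k → i * (R + k * (R * (R * R))) ≡ (1ℚ + k * (R * R)) * i * R
        regroup = solve-∀ ℚ-ring

      -- The average over the 3R pairs (f, v). The mean ratio is at most 1 + (T - tR)/(Rc), and the
      -- mean of the next surplus is at most (R-3)/R times the present one. The recursion of `β`
      -- collects exactly these two effects.
      expectation : ι 3 * R * (P * (B - β (suc r) * (T - target (suc r)))) ≤
                    P * (A * (ι 3 * R) - (ic * D + b * (ι 3 * ΣT)))
      expectation = begin
        ι 3 * R * (P * (B - inv R * (ic + b * r3) * (T - tR)))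
          ≡⟨ pull (ι 3) R P B (inv R) (ic + b * r3) (T - tR) ⟩
        P * (ι 3 * (R * B - R * inv R * (ic + b * r3) * (T - tR)))
          ≡⟨ cong (λ a → P * (ι 3 * (R * B - a * (ic + b * r3) * (T - tR)))) (*-inv (1≤ι r)) ⟩
        P * (ι 3 * (R * B - 1ℚ * (ic + b * r3) * (T - tR)))
          -- The slack has one summand for each of `ΣT≤`, `D≤` and `target-step`; the remaining
          -- discrepancy vanishes by `balance`.
          ≤⟨ *-monoʳ 0≤P (≤-byDifference
               (ι 3 * (b * (r3 * T - ΣT)) + ic * (ι 3 * (R + T) - D) + ι 3 * (b * (R * target r - r3 * tR)))
               (+-nonneg (+-nonneg
                 (*-nonneg (0≤ι 3) (*-nonneg (β-nonneg r) (p≤q⇒0≤q-p ΣT≤)))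
                 (*-nonneg (0≤inv c) (p≤q⇒0≤q-p D≤)))
                 (*-nonneg (0≤ι 3) (*-nonneg (β-nonneg r) (p≤q⇒0≤q-p (target-step r)))))
               (trans (identity (ι 3) R B ic b r3 T tR ΣT D (target r))
                 (trans (cong (λ a → (B + 1ℚ + b * target r) * (ι 3 * R) - (ic * D + b * (ι 3 * ΣT)) + ι 3 * (a - R)) balance)
                   (drop (A * (ι 3 * R) - (ic * D + b * (ι 3 * ΣT))) (ι 3) R)))) ⟩
        P * (A * (ι 3 * R) - (ic * D + b * (ι 3 * ΣT)))
          ∎
        where
        tR : ℚ
        tR = target (suc r)
        pull : ∀ t R P B i g q → t * R * (P * (B - i * g * q)) ≡ P * (t * (R * B - R * i * g * q))
        pull = solve-∀ ℚ-ring
        identity : ∀ t R B ic b r3 T tR S D tr →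
          t * (R * B - 1ℚ * (ic + b * r3) * (T - tR)) + (t * (b * (r3 * T - S)) + ic * (t * (R + T) - D) + t * (b * (R * tr - r3 * tR))) ≡
          (B + 1ℚ + b * tr) * (t * R) - (ic * D + b * (t * S)) + t * (ic * (R + tR) - R)
        identity = solve-∀ ℚ-ring
        drop : ∀ a t R → a + t * (R - R) ≡ a
        drop = solve-∀ ℚ-ring

      sum-weights : sum (λ f → sum (λ v → χ M f * E f v * (factors (suc r) * (inv (degree U v) * weight r (U ∖ f) (erase M f))))) ≡
                    ι 3 * R * (factors (suc r) * weight (suc r) U M)
      sum-weights = begin-equality
        sum (λ f → sum (λ v → χ M f * E f v * (C * W f v)))    ≡⟨ sum-cong-≗ (λ f → sum-cong-≗ λ v → *-swap (χ M f * E f v) C (W f v)) ⟩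
        sum (λ f → sum (λ v → C * (χ M f * E f v * W f v)))    ≡⟨ sum-cong-≗ (λ f → *-distribˡ-sum C (λ v → χ M f * E f v * W f v)) ⟨
        sum (λ f → C * sum (λ v → χ M f * E f v * W f v))      ≡⟨ *-distribˡ-sum C (λ f → sum (λ v → χ M f * E f v * W f v)) ⟨
        C * S                                                  ≡⟨ ℚ.*-identityˡ (C * S) ⟨
        1ℚ * (C * S)                                           ≡⟨ cong (_* (C * S)) (*-inv (1≤3* r)) ⟨
        ι 3 * R * inv (ι 3 * R) * (C * S)                      ≡⟨ regroup (ι 3 * R) (inv (ι 3 * R)) C S ⟩
        ι 3 * R * (C * (inv (ι 3 * R) * S))                    ∎
        where
        C : ℚ
        C = factors (suc r)
        W : Fin (size H) → Fin n → ℚ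
        W f v = inv (degree U v) * weight r (U ∖ f) (erase M f)
        regroup : ∀ a i c s → a * i * (c * s) ≡ a * (c * (i * s))
        regroup = solve-∀ ℚ-ring

    -- The list xs holds the ratios between the numbers of choices met so far
    -- and their bounds. The claim is AM-GM for the ratios along a whole run of
    -- the process, averaged over the part of the run that is still to come.
    weight-lower : ∀ r U M → Covers U M → sum (χ M) ≡ ι r → ∀ xs → NonNegList xs →
      productᴸ xs * (1ℚ + ι (length xs) - sumᴸ xs - β r * (transversals U M - target r)) ≤
      factors r * weight r U M
    weight-lower zero U M cov ∣M∣ xs 0≤xs = begin
      productᴸ xs * (1ℚ + ι (length xs) - sumᴸ xs - 0ℚ * (transversals U M - target 0))
        ≡⟨ cong (productᴸ xs *_) (drop (1ℚ + ι (length xs) - sumᴸ xs) (transversals U M - target 0)) ⟩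
      productᴸ xs * (1ℚ + ι (length xs) - sumᴸ xs)
        -- The run is complete and `xs` holds all its ratios; only at this point is AM-GM applied.
        ≤⟨ am-gm-deficit xs 0≤xs ⟩
      1ℚ
        ≡⟨ isEmpty≡1 M ∣M∣ ⟨
      isEmpty M
        ≡⟨ ℚ.*-identityˡ (isEmpty M) ⟨
      1ℚ * isEmpty M
        ∎
      where
      drop : ∀ a b → a - 0ℚ * b ≡ a
      drop = solve-∀ ℚ-ring
    weight-lower (suc r) U M cov ∣M∣ xs 0≤xs =
      *-cancelˡ (ι 3 * R) (ℚ.<-≤-trans 0<1 (1≤3* r)) (begin
        ι 3 * R * (P * (B - β (suc r) * (T - target (suc r))))
          ≤⟨ expectation ⟩
        P * (A * (ι 3 * R) - (ic * D + b * (ι 3 * ΣT)))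
          ≡⟨ sum-brackets ⟨
        sum (λ f → sum (λ v → χ M f * E f v * (P * bracket (degree U v) f)))
          ≤⟨ sum-mono (λ f → sum-mono λ v → perPair f v λ f∈M v∈f →
               weight-lower r (U ∖ f) (erase M f) (covers-erase {U} cov f∈M) (∣erase∣ f f∈M)
                 (degree U v * ic ∷ xs) (*-nonneg (0≤degree U v) (0≤inv c) ∷ 0≤xs)) ⟩
        sum (λ f → sum (λ v → χ M f * E f v * (factors (suc r) * (inv (degree U v) * weight r (U ∖ f) (erase M f)))))
          ≡⟨ sum-weights ⟩
        ι 3 * R * (factors (suc r) * weight (suc r) U M)
          ∎)
      where
      open Step r U M cov ∣M∣ xs 0≤xs
      ∣erase∣ : ∀ f → f ∈ M → sum (χ (erase M f)) ≡ ι r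
      ∣erase∣ f f∈M = trans (sum-χ-erase f∈M) (trans (cong (_- 1ℚ) (trans ∣M∣ (ι-suc r))) (cancel (ι r)))
        where
        cancel : ∀ a → 1ℚ + a - 1ℚ ≡ a
        cancel = solve-∀ ℚ-ring

    1≤factors*weight : ∀ r U M → Covers U M → sum (χ M) ≡ ι r → transversals U M ≤ target r →
                       1ℚ ≤ factors r * weight r U M
    1≤factors*weight r U M cov ∣M∣ T≤ = ℚ.≤-trans
      (≤-byDifference (β r * (target r - transversals U M)) (*-nonneg (β-nonneg r) (p≤q⇒0≤q-p T≤))
        (regroup (β r) (target r) (transversals U M)))
      (weight-lower r U M cov ∣M∣ [] [])
      where
      regroup : ∀ b t T → 1ℚ + b * (t - T) ≡ 1ℚ * (1ℚ + 0ℚ - 0ℚ - b * (T - t))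
      regroup = solve-∀ ℚ-ring

    #perfectMatchings≤factors : ∀ m → n ≡ 3 ℕ.* m → ι (size H) ≤ target m → ι (#perfectMatchings H) ≤ factors m
    #perfectMatchings≤factors m n≡3m size≤ = begin
      ι (#perfectMatchings H)                                       ≡⟨ ι-length-filter-subsets (size H) (isPerfectMatching? H) ⟩
      ∑ˢ (size H) (λ M → 𝟙 (isPerfectMatching? H M))                ≤⟨ ∑ˢ-mono (size H) (λ M → perMatching M (𝟙-indicates (isPerfectMatching? H M))) ⟩
      ∑ˢ (size H) (λ M → factors m * coveringWeight m Subset.⊤ M)   ≡⟨ ∑ˢ-*ˡ (size H) (factors m) (coveringWeight m Subset.⊤) ⟩
      factors m * ∑ˢ (size H) (coveringWeight m Subset.⊤)           ≤⟨ *-monoʳ (factors-nonneg m) (total-weight≤1 m Subset.⊤ ∣⊤∣) ⟩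
      factors m * 1ℚ                                                ≡⟨ ℚ.*-identityʳ (factors m) ⟩
      factors m                                                     ∎
      where
      ∣⊤∣ : sum (χ {n} Subset.⊤) ≡ ι 3 * ι m
      ∣⊤∣ = trans (sym (ι∣∣ {n} Subset.⊤)) (trans (cong ι (trans (Subset.∣⊤∣≡n n) n≡3m)) (ι-* 3 m))
      perMatching : ∀ M {p} → Indicates (IsPerfectMatching H M) p → p ≤ factors m * coveringWeight m Subset.⊤ M
      perMatching M (fails _)  = *-nonneg (factors-nonneg m) (coveringWeight-nonneg m Subset.⊤ M)
      perMatching M (holds pm) = begin
        1ℚ                                          ≤⟨ 1≤factors*weight m Subset.⊤ M cov
                                                         (trans (sym (ι∣∣ M)) (cong ι ∣M∣≡m))
                                                         (ℚ.≤-trans (transversals≤size Subset.⊤ M) size≤) ⟩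
        factors m * weight m Subset.⊤ M             ≡⟨ cong (factors m *_) (ℚ.*-identityˡ (weight m Subset.⊤ M)) ⟨
        factors m * (1ℚ * weight m Subset.⊤ M)      ≡⟨ cong (λ a → factors m * (a * weight m Subset.⊤ M)) (ind≡1 (𝟙-indicates (covers? Subset.⊤ M)) cov) ⟨
        factors m * coveringWeight m Subset.⊤ M     ∎
        where
        cov : Covers Subset.⊤ M
        cov = perfectMatching⇒covers {M} pm
        ∣M∣≡m : Subset.∣ M ∣ ≡ m
        ∣M∣≡m = ℕ.*-cancelˡ-≡ Subset.∣ M ∣ m 3 (trans (sym (covers-⊤⇒n≡3∣M∣ {M} cov)) n≡3m)

-- From rational estimates to real numbers.

module RealBounds where
  open import Data.Rational
  open RationalArithmetic
  open Asymptotics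
  open Factors
  open ℚ.≤-Reasoning

  seq-^ : ∀ x n k → seq (x Real.^ n) k ≡ seq x k ^ n
  seq-^ x zero    k = refl
  seq-^ x (suc n) k = cong (seq x k *_) (seq-^ x n k)

  -- The tangent at r + δ, evaluated at r. The coefficient of δ depends on the bound `B` and not on
  -- r, so one constant serves all entries of a bounded sequence.
  ^-perturb : ∀ n {r δ B} → 0ℚ ≤ r → 0ℚ ≤ δ → r ≤ B → δ ≤ 1ℚ →
              (r + δ) ^ n ≤ r ^ n + ι n * (B + 1ℚ) ^ n * δ
  ^-perturb zero {r} {δ} {B} _ _ _ _ = ℚ.≤-reflexive (unit δ)
    where
    unit : ∀ δ → 1ℚ ≡ 1ℚ + 0ℚ * 1ℚ * δ
    unit = solve-∀ ℚ-ring
  ^-perturb (suc n) {r} {δ} {B} 0≤r 0≤δ r≤B δ≤1 = begin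
    z ^ suc n                                                                ≡⟨ split (z ^ suc n) (ι (suc n)) (z ^ n) r δ ⟩
    z ^ suc n + ι (suc n) * (z ^ n * (r - z)) + ι (suc n) * z ^ n * δ        ≤⟨ ℚ.+-mono-≤ (^-tangent n 0≤z 0≤r)
                                                                                  (*-monoˡ 0≤δ (*-monoʳ (0≤ι (suc n)) z^n≤)) ⟩
    r ^ suc n + ι (suc n) * (B + 1ℚ) ^ suc n * δ                             ∎
    where
    z : ℚ
    z = r + δ
    0≤z : 0ℚ ≤ z
    0≤z = +-nonneg 0≤r 0≤δ
    1≤B+1 : 1ℚ ≤ B + 1ℚ
    1≤B+1 = ≤-byDifference B (ℚ.≤-trans 0≤r r≤B) (ℚ.+-comm 1ℚ B)
    z^n≤ : z ^ n ≤ (B + 1ℚ) ^ suc n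
    z^n≤ = ℚ.≤-trans (^-mono n 0≤z (ℚ.+-mono-≤ r≤B δ≤1)) (^-monoʳ 1≤B+1 (ℕ.n≤1+n n))
    split : ∀ p c q r δ → p ≡ p + c * (q * (r - (r + δ))) + c * q * δ
    split = solve-∀ ℚ-ring

  -- The k-th entry of root 3 x misses the cube root of x k by less than 1/(k+1).
  ≤-root³ : ∀ {b x} m n → n ≡ m ℕ.* 3 → (∀ k → 1 ℕ.≤ k → b ≤ seq x k ^ m) → (∀ k → 0ℚ ≤ seq x k) →
            fromℚ b Real.≤ x ^[ n / 3 ]
  ≤-root³ {b} {x} m n n≡m*3 b≤ 0≤x ε 0<ε = close (CauchyLemmas.cauchy-bounded (cauchy (root 3 x)))
    where
    r : ℕ → ℚ
    r k = approxRoot 3 k (seq x k)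
    0≤r : ∀ k → 0ℚ ≤ r k
    0≤r k = RootLemmas.approxRoot-nonneg 3 k (seq x k)
    close : (∃ λ B → ∃ λ N → 0ℚ < B × (∀ k → N ℕ.≤ k → ∣ r k ∣ ≤ B)) →
            ∃ λ N → ∀ k → N ℕ.≤ k → b ≤ seq (root 3 x Real.^ n) k + ε
    -- The rounding error 1/(k+1) is magnified at most K times, so it is pushed below ε/K. If K < 1,
    -- the cut-off in `inv K` does no harm, since K * inv K ≤ 1 still holds.
    close (B , N , 0<B , ∣r∣≤B) = let M , small = archimedean (ε * inv K) (*-pos 0<ε (0<inv K)) in
      suc (N ℕ.⊔ M) , λ k ≤k →
        let N⊔M≤k = ℕ.≤-trans (ℕ.n≤1+n (N ℕ.⊔ M)) ≤k in
        entry k (ℕ.≤-trans (ℕ.s≤s ℕ.z≤n) ≤k) (∣r∣≤B k (ℕ.m⊔n≤o⇒m≤o N M N⊔M≤k)) (small k (ℕ.m⊔n≤o⇒n≤o N M N⊔M≤k))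
      where
      K : ℚ
      K = ι n * (B + 1ℚ) ^ n
      0≤K : 0ℚ ≤ K
      0≤K = *-nonneg (0≤ι n) (^-nonneg n (+-nonneg (ℚ.<⇒≤ 0<B) 0≤1))
      entry : ∀ k → 1 ℕ.≤ k → ∣ r k ∣ ≤ B → 1/suc k ≤ ε * inv K → b ≤ seq (root 3 x Real.^ n) k + ε
      entry k 1≤k ∣r∣≤B small = begin
        b                                        ≤⟨ b≤ k 1≤k ⟩
        seq x k ^ m                              ≤⟨ ^-mono m (0≤x k) (ℚ.≤-trans (ℚ.p≤p⊔q (seq x k) 0ℚ) (ℚ.<⇒≤ (RootLemmas.<approxRoot-^ 2 k (seq x k)))) ⟩
        ((r k + 1/suc k) ^ 3) ^ m                ≡⟨ ^-assocʳ (r k + 1/suc k) 3 m ⟩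
        (r k + 1/suc k) ^ (3 ℕ.* m)              ≡⟨ cong ((r k + 1/suc k) ^_) (trans (ℕ.*-comm 3 m) (sym n≡m*3)) ⟩
        (r k + 1/suc k) ^ n                      ≤⟨ ^-perturb n (0≤r k) (0≤1/suc k) (ℚ.≤-trans (p≤∣p∣ (r k)) ∣r∣≤B) (1/suc≤1 k) ⟩
        r k ^ n + K * 1/suc k                    ≤⟨ ℚ.+-monoʳ-≤ (r k ^ n) (*-monoʳ 0≤K small) ⟩
        r k ^ n + K * (ε * inv K)                ≡⟨ cong (r k ^ n +_) (*-swap K ε (inv K)) ⟩
        r k ^ n + ε * (K * inv K)                ≤⟨ ℚ.+-monoʳ-≤ (r k ^ n) (ℚ.≤-trans (*-monoʳ (ℚ.<⇒≤ 0<ε) (*-inv≤1 K)) (ℚ.≤-reflexive (ℚ.*-identityʳ ε))) ⟩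
        r k ^ n + ε                              ≡⟨ cong (_+ ε) (seq-^ (root 3 x) n k) ⟨
        seq (root 3 x Real.^ n) k + ε            ∎

  -- Abstract, lest 2⁴⁰ be evaluated with the gcds of rational arithmetic.
  abstract
    C : ℚ
    C = (1ℚ + 1ℚ) ^ 40

    1≤C : 1ℚ ≤ C
    1≤C = 1≤^ 40 (≤-byDifference 1ℚ 0≤1 refl)

    [1+u]⁴⁰≤1+Cu : ∀ {u} → 0ℚ ≤ u → u ≤ 1ℚ → (1ℚ + u) ^ 40 ≤ 1ℚ + C * u
    [1+u]⁴⁰≤1+Cu = [1+u]^k≤1+2^ku 40

  -- For n = 3m this is C/j, with j the integer part of the fourth root of m; `scale` takes m - 1 as
  -- its argument, hence `ℕ.pred`.
  errorTerm : ℕ → ℚ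
  errorTerm n = C * 1/suc (scale (ℕ.pred (n ℕ./ 3)))

  errorTerm-nonneg : ∀ n → 0ℚ ≤ errorTerm n
  errorTerm-nonneg n = *-nonneg (ℚ.≤-trans 0≤1 1≤C) (0≤1/suc (scale (ℕ.pred (n ℕ./ 3))))

  η : ℕ → ℝ
  η n = fromℚ (errorTerm n)

  errorTerm-small : ∀ δ → 0ℚ < δ → ∃ λ N → ∀ n → N ℕ.≤ n → errorTerm n ≤ δ
  errorTerm-small δ 0<δ = let J , small = archimedean (δ * inv C) (*-pos 0<δ (0<inv C)) in
    -- From here on n/3 is at least (J+1)⁴, so the scale is at least J.
    suc J ℕ.^ 4 ℕ.* 3 , λ n ≤n →
      let J≤ = scale-unbounded J (ℕ.pred (n ℕ./ 3)) (ℕ.≤-trans (≤n/3 (suc J ℕ.^ 4) n ≤n) (≤-suc-pred (n ℕ./ 3))) in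
      begin
        C * 1/suc (scale (ℕ.pred (n ℕ./ 3)))     ≤⟨ *-monoʳ (ℚ.≤-trans 0≤1 1≤C) (small _ J≤) ⟩
        C * (δ * inv C)                          ≡⟨ *-swap C δ (inv C) ⟩
        δ * (C * inv C)                          ≤⟨ *-monoʳ (ℚ.<⇒≤ 0<δ) (*-inv≤1 C) ⟩
        δ * 1ℚ                                   ≡⟨ ℚ.*-identityʳ δ ⟩
        δ                                        ∎
    where
    ≤-suc-pred : ∀ l → l ℕ.≤ suc (ℕ.pred l)
    ≤-suc-pred zero    = ℕ.z≤n
    ≤-suc-pred (suc l) = ℕ.≤-refl
    ≤n/3 : ∀ a n → a ℕ.* 3 ℕ.≤ n → a ℕ.≤ n ℕ./ 3
    ≤n/3 a n ≤n = ℕ.≤-trans (ℕ.≤-reflexive (sym (ℕ.m*n/n≡m a 3))) (ℕ./-monoˡ-≤ 3 ≤n)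

  η⟶0 : η ⟶ 0ℝ
  η⟶0 ε 0<ε = let δ = Real._<_.gap 0<ε
                  0<δ/2 = half-pos (Real._<_.gap>0 0<ε)
                  N , small = errorTerm-small (δ * ½) 0<δ/2 in
    N , λ n N≤n → record
      -- One half of the gap of ε absorbs the error term, the other half is the gap that remains.
      { gap = δ * ½ ; gap>0 = 0<δ/2 ; from = Real._<_.from 0<ε
      ; eventually = λ k from≤k → begin
          ∣ errorTerm n + - 0ℚ ∣ + δ * ½     ≡⟨ cong (λ a → ∣ a ∣ + δ * ½) (ℚ.+-identityʳ (errorTerm n)) ⟩
          ∣ errorTerm n ∣ + δ * ½            ≡⟨ cong (_+ δ * ½) (ℚ.0≤p⇒∣p∣≡p (errorTerm-nonneg n)) ⟩
          errorTerm n + δ * ½                ≤⟨ ℚ.+-monoˡ-≤ (δ * ½) (small n N≤n) ⟩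
          δ * ½ + δ * ½                      ≡⟨ half+half δ ⟩
          δ                                  ≡⟨ ℚ.+-identityˡ δ ⟨
          0ℚ + δ                             ≤⟨ Real._<_.eventually 0<ε k from≤k ⟩
          seq ε k                            ∎
      }

  bound : ℕ → ℝ
  bound n = (1ℝ Real.+ η n) Real.* (fromℕ n Real.÷ (fromℕ 2 Real.* Real.e Real.^ 2))

  -- The gap recorded in `0<2e²` is 1, the cut-off of `inv`; hence the k-th entry of the real
  -- reciprocal is `inv (2e² k)` by computation.
  2e² : ℕ → ℚ
  2e² k = ι 2 * (expSum k * (expSum k * 1ℚ))

  bound-nonneg : ∀ n k → 0ℚ ≤ seq (bound n) k
  bound-nonneg n k = *-nonneg (+-nonneg 0≤1 (errorTerm-nonneg n)) (*-nonneg (0≤ι n) (0≤inv (2e² k)))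

  1≤2e² : ∀ N → 1ℚ ≤ 2e² (suc N)
  1≤2e² N = *-mono 0≤1 (ℚ.≤-trans 0≤1 1≤e²) (1≤ι 1) 1≤e²
    where
    1≤e : 1ℚ ≤ expSum (suc N)
    1≤e = ExpLemmas.expSum-mono (ℕ.≤⇒≤′ (ℕ.s≤s (ℕ.z≤n {N})))
    1≤e² : 1ℚ ≤ expSum (suc N) * (expSum (suc N) * 1ℚ)
    1≤e² = 1≤^ 2 1≤e

  open IsSteinerTripleSystem

  -- Valid entry by entry, because `Scale.factors≤` allows any nonempty partial sum for e. The
  -- condition on k excludes the empty one, for which `inv` would not be a reciprocal.
  #perfectMatchings≤bound : ∀ m {n} → n ≡ suc m ℕ.* 3 → (H : Hypergraph n) → IsSteinerTripleSystem H →
    ∀ k → 1 ℕ.≤ k → ι (#perfectMatchings H) ≤ seq (bound n) k ^ suc m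
  #perfectMatchings≤bound m {n} n≡m′*3 H sts (suc N) _ = begin
    ι (#perfectMatchings H)                            ≤⟨ #perfectMatchings≤factors m′ n≡3m′ size≤ ⟩
    factors κ m′                                       ≤⟨ Scale.factors≤ i m′ (proj₁ spec) (proj₂ spec) 0≤κ 2m′κ≡3 N y (0≤inv (2e² (suc N))) (*-inv (1≤2e² N)) ⟩
    (g ^ 40 * (ι (3 ℕ.* m′) * y)) ^ m′                 ≡⟨ cong (λ l → (g ^ 40 * (ι l * y)) ^ m′) n≡3m′ ⟨
    (g ^ 40 * (ι n * y)) ^ m′                          ≤⟨ ^-mono m′ (*-nonneg (^-nonneg 40 (+-nonneg 0≤1 (0≤1/suc i))) 0≤ny) (*-monoˡ 0≤ny g⁴⁰≤) ⟩
    ((1ℚ + errorTerm n) * (ι n * y)) ^ m′              ∎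
    where
    m′ : ℕ
    m′ = suc m
    n≡3m′ : n ≡ 3 ℕ.* m′
    n≡3m′ = trans n≡m′*3 (ℕ.*-comm m′ 3)
    κ y g : ℚ
    -- Chosen so that the initial target κm³ = 3m²/2 is n²/6, the bound of `6*size≤n²` on the number
    -- of edges.
    κ = ι 3 * inv (ι 2 * ι m′)
    y = inv (2e² (suc N))
    i : ℕ
    i = scale m
    g = 1ℚ + 1/suc i
    spec = proj₂ (scale-spec m)
    0≤κ : 0ℚ ≤ κ
    0≤κ = *-nonneg (0≤ι 3) (0≤inv (ι 2 * ι m′))
    0≤ny : 0ℚ ≤ ι n * y
    0≤ny = *-nonneg (0≤ι n) (0≤inv (2e² (suc N)))
    2m′κ≡3 : ι 2 * ι m′ * κ ≡ ι 3
    2m′κ≡3 = trans (*-swap (ι 2 * ι m′) (ι 3) (inv (ι 2 * ι m′)))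
      (trans (cong (ι 3 *_) (*-inv (*-mono 0≤1 (0≤ι m′) (1≤ι 1) (1≤ι m)))) (ℚ.*-identityʳ (ι 3)))
    open Greedy H sts
    open LowerBound κ 0≤κ
    size≤ : ι (size H) ≤ target m′
    size≤ = *-cancelˡ (ι 6) (0<ι 5) (begin
      ι 6 * ι (size H)                                            ≤⟨ 6*size≤n² ⟩
      ι n * ι n                                                   ≡⟨ cong (λ a → a * a) (trans (cong ι n≡3m′) (ι-* 3 m′)) ⟩
      ι 3 * ι m′ * (ι 3 * ι m′)                                   ≡⟨ cong (λ a → ι 3 * ι m′ * (a * ι m′)) 2m′κ≡3 ⟨
      ι 3 * ι m′ * (ι 2 * ι m′ * κ * ι m′)                        ≡⟨ regroup (ι 3) (ι 2) (ι m′) κ ⟩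
      ι 3 * ι 2 * (κ * (ι m′ * (ι m′ * ι m′)))                    ≡⟨ cong (_* target m′) (ι-* 3 2) ⟨
      ι 6 * target m′                                             ∎)
      where
      regroup : ∀ a b m k → a * m * (b * m * k * m) ≡ a * b * (k * (m * (m * m)))
      regroup = solve-∀ ℚ-ring
    g⁴⁰≤ : g ^ 40 ≤ 1ℚ + errorTerm n
    g⁴⁰≤ = begin
      g ^ 40                          ≤⟨ [1+u]⁴⁰≤1+Cu (0≤1/suc i) (1/suc≤1 i) ⟩
      1ℚ + C * 1/suc i                ≡⟨ cong (λ l → 1ℚ + C * 1/suc (scale (ℕ.pred l))) (trans (cong (ℕ._/ 3) n≡m′*3) (ℕ.m*n/n≡m m′ 3)) ⟨
      1ℚ + errorTerm n                ∎

  #perfectMatchings≤1 : (H : Hypergraph 0) → IsSteinerTripleSystem H → ι (#perfectMatchings H) ≤ 1ℚ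
  #perfectMatchings≤1 H sts = #perfectMatchings≤factors 0 refl (*-cancelˡ (ι 6) (0<ι 5) 6*size≤n²)
    where
    open Greedy H sts
    -- Without vertices there are no edges, and the quotient 3/2m is undefined; κ = 0 gives a target
    -- of 0 and an empty product.
    open LowerBound 0ℚ ℚ.≤-refl

  #perfectMatchings≤ : ∀ n (S : Hypergraph n) → IsSteinerTripleSystem S →
                       fromℕ (#perfectMatchings S) Real.≤ bound n ^[ n / 3 ]
  #perfectMatchings≤ n S sts = byDivisibility n S sts (3 ∣? n)
    where
    byDivisibility : ∀ n (S : Hypergraph n) → IsSteinerTripleSystem S → Dec (3 ∣ n) →
                     fromℕ (#perfectMatchings S) Real.≤ bound n ^[ n / 3 ]
    byDivisibility n S sts (yes (divides (suc m) n≡)) =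
      ≤-root³ {x = bound n} (suc m) n n≡ (#perfectMatchings≤bound m n≡ S sts) (bound-nonneg n)
    byDivisibility _ S sts (yes (divides zero refl)) =
      ≤-root³ {x = bound 0} 0 0 refl (λ _ _ → #perfectMatchings≤1 S sts) (bound-nonneg 0)
    byDivisibility n S sts (no 3∤n) ε 0<ε = 0 , λ k _ → begin
      ι (#perfectMatchings S)             ≡⟨ cong ι (Greedy.no-perfectMatchings S sts λ m n≡ → 3∤n (divides m (trans n≡ (ℕ.*-comm 3 m)))) ⟩
      0ℚ                                  ≤⟨ +-nonneg (^-nonneg n (RootLemmas.approxRoot-nonneg 3 k (seq (bound n) k))) (ℚ.<⇒≤ 0<ε) ⟩
      seq (root 3 (bound n)) k ^ n + ε    ≡⟨ cong (_+ ε) (seq-^ (root 3 (bound n)) n k) ⟨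
      seq (bound n ^[ n / 3 ]) k + ε      ∎

open import Defs

theorem1p2 : Σ[ η ∈ (ℕ → ℝ) ] (
    (η ⟶ 0ℝ) ×
    (∀ n (S : Hypergraph n) → IsSteinerTripleSystem S →
    fromℕ (#perfectMatchings S) ≤
    ((1ℝ + η n) * (fromℕ n ÷ (fromℕ 2 * e ^ 2))) ^[ n / 3 ]))
theorem1p2 = RealBounds.η , RealBounds.η⟶0 , RealBounds.#perfectMatchings≤
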